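{- Let $\Xi=\langle k_1,\ldots,k_s\,|\,l_1,\ldots,l_t\rangle$ be a simple type and let $v(\Xi)=s+t$. Then $$|\Xi|=\sum (-1)^{n-1}\,(v(\Xi)-1)^{n-2}\prod_{p=1}^{n}(v(\Xi_p)-1)!,$$ where the sum runs over all partitions $\Xi=\Xi_1\cup\cdots\cup\Xi_n$, $n=1,2,\ldots$, of $\Xi$ (including the trivial $1$-partition $\Xi$ itself, whose summand equals $(v(\Xi)-2)!$).
   Context: A w-tree is a finite connected plane tree in which every vertex and every edge carries a positive integer weight, such that the weight of each vertex equals the sum of the weights of the edges incident to it; its vertices are properly 2-colored white and black. The type $\langle k_1,\ldots,k_s\,|\,l_1,\ldots,l_t\rangle$ (positive integers with $\sum k_i=\sum l_j$) is the set of w-trees with $s$ white vertices of weights $k_1,\ldots,k_s$ and $t$ black vertices of weights $l_1,\ldots,l_t$, up to orientation-preserving isotopy of the plane preserving colors and weights; $|\Xi|$ is the number of such trees and $v(\Xi)=s+t$ is the number of vertices. The type is simple if the $k_i$ are pairwise distinct and the $l_j$ are pairwise distinct. An $n$-partition of $\Xi$ is an (unordered) collection of pairwise disjoint nonempty sets $I_1,\ldots,I_n$ with union $\{1,\ldots,s\}$ together with pairwise disjoint nonempty sets $J_1,\ldots,J_n$ with union $\{1,\ldots,t\}$ such that $\sum_{i\in I_p}k_i=\sum_{j\in J_p}l_j$ for each $p=1,\ldots,n$; the subtypes are $\Xi_p=\langle \{k_i\}_{i\in I_p}\,|\,\{l_j\}_{j\in J_p}\rangle$ with $v(\Xi_p)=|I_p|+|J_p|$,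 and one writes $\Xi=\Xi_1\cup\cdots\cup\Xi_n$. The type itself counts as its $1$-partition. -}

module Defs where

open import Data.Nat using (ℕ; zero; suc; _<_; _∸_; _≤_; _+_; _^_)
open import Data.Nat using (_!)
open import Data.Integer as ℤ using (ℤ; +_; -1ℤ)
open import Data.Fin using (Fin; _≟_; toℕ)
open import Data.Sum using (_⊎_; inj₁; inj₂)
open import Data.Product using (Σ; _×_; _,_; ∃; ∃-syntax)
open import Data.Empty using (⊥)
open import Data.Vec using (Vec; lookup; count)
open import Data.List using (List; []; _∷_; _++_; [_]; length; map; allFin; foldr)
open import Data.Nat.ListAction renaming (sum to sumL; product to productL)
open import Data.List.Membership.Propositional using (_∈_)
open import Data.List.Relation.Unary.All using (All)
open import Data.List.Relation.Unary.Unique.Propositional using (Unique)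
open import Data.List.Relation.Unary.Linked using (Linked)
open import Relation.Binary.Construct.Closure.ReflexiveTransitive using (Star)
open import Relation.Binary.PropositionalEquality using (_≡_)
open import Relation.Nullary using (¬_; yes; no)

Σᶠ : ∀ {n} → (Fin n → ℕ) → ℕ
Σᶠ {n} f = sumL (map f (allFin n))

Πᶠ : ∀ {n} → (Fin n → ℕ) → ℕ
Πᶠ {n} f = productL (map f (allFin n))

sumℤ : List ℤ → ℤ
sumℤ = foldr ℤ._+_ (+ 0)

Enumerates : ∀ {A : Set} → (A → Set) → List A → Set
Enumerates {A} P xs = Unique xs × All P xs × (∀ x → P x → x ∈ xs)

-- W-trees of a simple type <k_1..k_s | l_1..l_t>.
-- Since the type is simple, every vertex is identified by its colour
-- and weight; white vertex i (weight k i), black vertex j (weight l j).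
-- A plane tree with labelled vertices up to orientation-preserving
-- isotopy is the abstract tree together with its rotation system
-- (counter-clockwise cyclic order of the neighbours at each vertex).
--
-- Raw data:
--   * edge weights  W i j  (0 = no edge between white i and black j),
--   * for each white vertex i a map Fin t → Fin t (ccw successor of
--     neighbours of i, identity on non-neighbours),
--   * for each black vertex j a map Fin s → Fin s (likewise).

WData : ℕ → ℕ → Set
WData s t = Vec (Vec ℕ t) s × Vec (Vec (Fin t) t) s × Vec (Vec (Fin s) s) t

Vertex : ℕ → ℕ → Set
Vertex s t = Fin s ⊎ Fin t

Adj : ∀ {s t} → Vec (Vec ℕ t) s → Vertex s t → Vertex s t → Set
Adj W (inj₁ i) (inj₂ j) = 0 < lookup (lookup W i) j
Adj W (inj₂ j) (inj₁ i) = 0 < lookup (lookup W i) j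
Adj W (inj₁ _) (inj₁ _) = ⊥
Adj W (inj₂ _) (inj₂ _) = ⊥

Connected : ∀ {s t} → Vec (Vec ℕ t) s → Set
Connected W = ∀ u v → Star (Adj W) u v

IsCycle : ∀ {s t} → Vec (Vec ℕ t) s → List (Vertex s t) → Set
IsCycle W [] = ⊥
IsCycle W (v ∷ vs) = 2 ≤ length vs × Unique (v ∷ vs) × Linked (Adj W) ((v ∷ vs) ++ [ v ])

Acyclic : ∀ {s t} → Vec (Vec ℕ t) s → Set
Acyclic W = ∀ cs → ¬ IsCycle W cs

IsTree : ∀ {s t} → Vec (Vec ℕ t) s → Set
IsTree W = Connected W × Acyclic W

iter : ∀ {m} → (Fin m → Fin m) → ℕ → Fin m → Fin m
iter σ zero x = x
iter σ (suc n) x = σ (iter σ n x)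

IsCyclicOn : ∀ {m} → (Fin m → Set) → (Fin m → Fin m) → Set
IsCyclicOn {m} N σ =
  (∀ x → ¬ N x → σ x ≡ x) ×
  (∀ x → N x → N (σ x)) ×
  (∀ x y → N x → N y → σ x ≡ σ y → x ≡ y) ×
  (∀ x y → N x → N y → ∃[ n ] iter σ n x ≡ y)

IsWTree : ∀ {s t} → (Fin s → ℕ) → (Fin t → ℕ) → WData s t → Set
IsWTree {s} {t} k l (W , ρw , ρb) =
  (∀ i → Σᶠ (λ j → lookup (lookup W i) j) ≡ k i) ×
  (∀ j → Σᶠ (λ i → lookup (lookup W i) j) ≡ l j) ×
  IsTree W ×
  (∀ i → IsCyclicOn (λ j → Adj W (inj₁ i) (inj₂ j)) (lookup (lookup ρw i))) ×
  (∀ j → IsCyclicOn (λ i → Adj W (inj₂ j) (inj₁ i)) (lookup (lookup ρb j)))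

-- Partitions of a type.  An n-partition is encoded by block labels
-- f : white index ↦ block, g : black index ↦ block (both onto Fin n),
-- with balanced weights in every block.  To make the collection
-- unordered, blocks are numbered in order of their least white index
-- (canonical labelling): a label p < f i already occurs before i.

PData : ℕ → ℕ → Set
PData s t = Σ ℕ (λ n → Vec (Fin n) s × Vec (Fin n) t)

sel : ∀ {n} → Fin n → Fin n → ℕ → ℕ
sel q p x with q ≟ p
... | yes _ = x
... | no _ = 0

blockWeight : ∀ {m n} → (Fin m → ℕ) → Vec (Fin n) m → Fin n → ℕ
blockWeight w f p = Σᶠ (λ i → sel (lookup f i) p (w i))

blockSize : ∀ {s t n} → Vec (Fin n) s → Vec (Fin n) t → Fin n → ℕ
blockSize f g p = count (_≟ p) f + count (_≟ p) g

IsPartition : ∀ {s t} → (Fin s → ℕ) → (Fin t → ℕ) → PData s t → Set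
IsPartition {s} {t} k l (n , f , g) =
  1 ≤ n ×
  (∀ p → ∃[ i ] lookup f i ≡ p) ×
  (∀ p → ∃[ j ] lookup g j ≡ p) ×
  (∀ p → blockWeight k f p ≡ blockWeight l g p) ×
  (∀ i (p : Fin n) → toℕ p < toℕ (lookup f i) →
     ∃[ i' ] (toℕ i' < toℕ i × lookup f i' ≡ p))

summand : ∀ {s t} → ℕ → PData s t → ℤ
summand v (zero , f , g) = + 0
summand v (suc zero , f , g) = + ((v ∸ 2) !)
summand v (suc (suc m) , f , g) =
  (-1ℤ ℤ.^ suc m) ℤ.* (+ ((v ∸ 1) ^ m) ℤ.* + Πᶠ (λ p → (blockSize f g p ∸ 1) !))

{-# OPTIONS --safe #-}
-- Work in the ring generated by variables ε_v, one for each vertex v, with ε_v² = 0.  Let f (g) be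
-- the generating function of plane trees on sets of vertices in which one white (black) vertex, the
-- root, has weight left over; the excess is carried by a half-edge inserted into the rotation at the
-- root.  Deleting the last edge before the half-edge cuts such a tree into a white-rooted and a
-- black-rooted one, and so does deleting any edge of a tree without half-edge.  Hence
-- f + g + Z = Σ ε_v + f g, where Z is the part of f g of weight 0, and the coefficient of Z at the
-- set V of all v(Ξ) vertices is (v(Ξ) - 1) |Ξ|, because a tree has v(Ξ) - 1 edges.
--
-- With C = 1 + Z this is a Wiener–Hopf factorisation C - Σ ε_v = (1 - f)(1 - g).  In its logarithmic
-- derivative the terms of f and g have no part of weight 0, and what remains says that ε_v ↦ ε_v / C
-- inverts ε_v ↦ ε_v exp B, where B = Σ (|S| - 1)! ε^S over the balanced sets S.  Lagrange inversion
-- yields (1 - v(Ξ)) [V] C = [V] exp (-(v(Ξ) - 1) B), and the coefficient of the exponential is a sum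
-- over the partitions of Ξ.
module Submission where

open import Defs
open import Data.Nat using (ℕ; _≤_; _<_; _+_)
open import Data.Fin using (Fin)
open import Data.Integer using (+_)
open import Data.List using (List; length; map)
open import Data.Product using (_×_; ∃-syntax)
open import Function.Definitions using (Injective)
open import Relation.Binary.PropositionalEquality using (_≡_)
open import Algebra using (AbelianGroup; CommutativeRing)
import Algebra.Properties.Group
import Algebra.Solver.Ring
open import Algebra.Solver.Ring.AlmostCommutativeRing using (fromCommutativeRing; _-Raw-AlmostCommutative⟶_)
open import Algebra.Structures using (IsCommutativeRing)
open import Data.Bool using (Bool; true; false; if_then_else_)
import Data.Bool.Properties as Boolₚ
open import Data.Empty using (⊥; ⊥-elim)
open import Data.Fin as Fin using (zero; suc; toℕ; _↑ˡ_; _↑ʳ_)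
import Data.Fin.Properties as Finₚ
open import Data.Integer as ℤ using (ℤ; -1ℤ)
import Data.Integer.Properties as ℤₚ
open import Data.Integer.Tactic.RingSolver using () renaming (solve-∀ to ℤ-solve-∀)
open import Data.List as List using ([]; _∷_; _++_; allFin; filter; upTo; deduplicate)
open import Data.List.Membership.DecPropositional using (_∈?_)
open import Data.List.Membership.Propositional using (_∈_; _∉_)
open import Data.List.Membership.Propositional.Properties
  using (∈-map⁺; ∈-map⁻; ∈-++⁺ˡ; ∈-++⁺ʳ; ∈-++⁻; ∈-filter⁺; ∈-filter⁻; ∈-deduplicate⁺; ∈-deduplicate⁻; ∈-allFin; ∈-upTo⁺; ∈-upTo⁻)
open import Data.List.Membership.Propositional.Properties.WithK using (unique∧set⇒bag)
import Data.List.Properties as Listₚ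
open import Data.List.Relation.Binary.BagAndSetEquality using (∼bag⇒↭)
open import Data.List.Relation.Binary.Permutation.Propositional using (_↭_; ↭⇒↭ₛ)
import Data.List.Relation.Binary.Permutation.Propositional.Properties as ↭ₚ
open import Data.List.Relation.Binary.Permutation.Setoid.Properties using (foldr-commMonoid)
open import Data.List.Relation.Unary.All as All using (All; []; _∷_)
import Data.List.Relation.Unary.All.Properties as Allₚ
open import Data.List.Relation.Unary.AllPairs using ([]; _∷_)
open import Data.List.Relation.Unary.Any using (here; there)
open import Data.List.Relation.Unary.Linked using (Linked; []; [-]; _∷_)
open import Data.List.Relation.Unary.Unique.Propositional using (Unique)
import Data.List.Relation.Unary.Unique.DecPropositional.Properties as UniqueDecₚ
import Data.List.Relation.Unary.Unique.Propositional.Properties as Uniqueₚ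
open import Data.Maybe using (Maybe; just; nothing)
open import Data.Nat as ℕ using (zero; suc; _*_; _∸_; _⊓_; _!; z≤n; s≤s; s≤s⁻¹; _≤?_; _<?_)
import Data.Nat.ListAction as ℕ-List
import Data.Nat.Properties as ℕₚ
open import Data.Nat.Tactic.RingSolver using () renaming (solve-∀ to ℕ-solve-∀)
open import Data.Product using (Σ; _,_; proj₁; proj₂; ∃)
import Data.Product.Properties as Productₚ
open import Data.Sum as Sum using (_⊎_; inj₁; inj₂)
import Data.Sum.Properties as Sumₚ
open import Data.Unit using (⊤; tt)
open import Data.Vec as Vec using (Vec; []; _∷_; lookup; count)
import Data.Vec.Properties as Vecₚ
open import Data.Vec.Relation.Binary.Pointwise.Inductive as Pointwise using (Pointwise; []; _∷_)
open import Function using (_∘_; id; mk⇔)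
open import Relation.Binary.Construct.Closure.ReflexiveTransitive as Star using (Star; _◅_; _◅◅_) renaming (ε to nil)
open import Relation.Binary.Definitions using (DecidableEquality; Symmetric; Tri; tri<; tri≈; tri>)
open import Relation.Binary.PropositionalEquality
  using (_≢_; refl; sym; trans; cong; cong₂; subst; subst₂; isEquivalence; setoid; module ≡-Reasoning)
open import Relation.Nullary using (¬_; Dec; yes; no)
open import Relation.Nullary.Decidable using (_×-dec_)
open import Relation.Unary using (Decidable)

-- Square-free series

-- Joining undoes a cut: if the half-edges of the two pieces weigh x and y, the new edge gets the
-- smaller weight and the difference stays as a half-edge at one end. So the terms of f g are trees
-- with a distinguished edge, and the sign of the weight of the vertex set tells whether such a tree
-- belongs to f, to g or to Z.
--
-- The logarithmic derivative uses the Euler derivation `D`. It fixes Σ ε_v, so C - D C is (1 - f)(1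
-- - g) minus its own derivative, and Σ ε_v has disappeared. On the other hand 1 / (C - Σ ε_v) is,
-- up to the factor C, the image of 1 / (1 - Σ ε_v) under ε_v ↦ ε_v / C. The latter series has
-- factorials as coefficients; this is the origin of the substitution and of the (|S| - 1)! in B.
--
-- Coefficients are integers, so division is avoided: exponentials and divided powers are defined by
-- recursion on the variables, logarithms are replaced by differential equations, and both sides of
-- the theorem are compared after multiplication by (v(Ξ) - 1)².

infixr 5 _+ε_
infixl 6 _⊕_
infixl 7 _⊛_

-- The commutative ring ℤ[ε₁, …, εₙ] with all εᵢ² = 0; a +ε b stands for a + ε b,
-- where ε belongs to the first of the remaining variables.
data K : ℕ → Set where
  const : ℤ → K 0
  _+ε_  : ∀ {n} → K n → K n → K (suc n)

const-injective : ∀ {x y} → const x ≡ const y → x ≡ y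
const-injective refl = refl

+ε-injectiveˡ : ∀ {n} {a b c d : K n} → a +ε b ≡ c +ε d → a ≡ c
+ε-injectiveˡ refl = refl

+ε-injectiveʳ : ∀ {n} {a b c d : K n} → a +ε b ≡ c +ε d → b ≡ d
+ε-injectiveʳ refl = refl

_⊕_ : ∀ {n} → K n → K n → K n
const x  ⊕ const y  = const (x ℤ.+ y)
(a +ε b) ⊕ (c +ε d) = (a ⊕ c) +ε (b ⊕ d)

⊝_ : ∀ {n} → K n → K n
⊝ const x  = const (ℤ.- x)
⊝ (a +ε b) = (⊝ a) +ε (⊝ b)

_⊛_ : ∀ {n} → K n → K n → K n
const x  ⊛ const y  = const (x ℤ.* y)
(a +ε b) ⊛ (c +ε d) = (a ⊛ c) +ε (a ⊛ d ⊕ b ⊛ c)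

ι : ∀ {n} → ℤ → K n
ι {zero}  z = const z
ι {suc n} z = ι z +ε ι (+ 0)

𝟘 𝟙 : ∀ {n} → K n
𝟘 = ι (+ 0)
𝟙 = ι (+ 1)

⊕-assoc : ∀ {n} (a b c : K n) → (a ⊕ b) ⊕ c ≡ a ⊕ (b ⊕ c)
⊕-assoc (const x) (const y) (const z) = cong const (ℤₚ.+-assoc x y z)
⊕-assoc (a +ε b) (c +ε d) (e +ε f) = cong₂ _+ε_ (⊕-assoc a c e) (⊕-assoc b d f)

⊕-comm : ∀ {n} (a b : K n) → a ⊕ b ≡ b ⊕ a
⊕-comm (const x) (const y) = cong const (ℤₚ.+-comm x y)
⊕-comm (a +ε b) (c +ε d) = cong₂ _+ε_ (⊕-comm a c) (⊕-comm b d)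

⊕-identityˡ : ∀ {n} (a : K n) → 𝟘 ⊕ a ≡ a
⊕-identityˡ (const x) = cong const (ℤₚ.+-identityˡ x)
⊕-identityˡ (a +ε b) = cong₂ _+ε_ (⊕-identityˡ a) (⊕-identityˡ b)

⊕-identityʳ : ∀ {n} (a : K n) → a ⊕ 𝟘 ≡ a
⊕-identityʳ a = trans (⊕-comm a 𝟘) (⊕-identityˡ a)

⊝-inverseˡ : ∀ {n} (a : K n) → ⊝ a ⊕ a ≡ 𝟘
⊝-inverseˡ (const x) = cong const (ℤₚ.+-inverseˡ x)
⊝-inverseˡ (a +ε b) = cong₂ _+ε_ (⊝-inverseˡ a) (⊝-inverseˡ b)

⊛-comm : ∀ {n} (a b : K n) → a ⊛ b ≡ b ⊛ a
⊛-comm (const x) (const y) = cong const (ℤₚ.*-comm x y)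
⊛-comm (a +ε b) (c +ε d) = cong₂ _+ε_ (⊛-comm a c)
  (trans (⊕-comm (a ⊛ d) (b ⊛ c)) (cong₂ _⊕_ (⊛-comm b c) (⊛-comm a d)))

⊛-zeroˡ : ∀ {n} (a : K n) → 𝟘 ⊛ a ≡ 𝟘
⊛-zeroˡ (const x) = cong const (ℤₚ.*-zeroˡ x)
⊛-zeroˡ (a +ε b) = cong₂ _+ε_ (⊛-zeroˡ a)
  (trans (cong₂ _⊕_ (⊛-zeroˡ b) (⊛-zeroˡ a)) (⊕-identityˡ 𝟘))

⊛-identityˡ : ∀ {n} (a : K n) → 𝟙 ⊛ a ≡ a
⊛-identityˡ (const x) = cong const (ℤₚ.*-identityˡ x)
⊛-identityˡ (a +ε b) = cong₂ _+ε_ (⊛-identityˡ a)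
  (trans (cong₂ _⊕_ (⊛-identityˡ b) (⊛-zeroˡ a)) (⊕-identityʳ b))

⊛-distribˡ : ∀ {n} (a b c : K n) → a ⊛ (b ⊕ c) ≡ a ⊛ b ⊕ a ⊛ c
⊛-distribˡ (const x) (const y) (const z) = cong const (ℤₚ.*-distribˡ-+ x y z)
⊛-distribˡ (a +ε b) (c +ε d) (e +ε f) = cong₂ _+ε_ (⊛-distribˡ a c e)
  (trans (cong₂ _⊕_ (⊛-distribˡ a d f) (⊛-distribˡ b c e)) (interchange (a ⊛ d) (a ⊛ f) (b ⊛ c) (b ⊛ e)))
  where
  interchange : ∀ {n} (p q r s : K n) → (p ⊕ q) ⊕ (r ⊕ s) ≡ (p ⊕ r) ⊕ (q ⊕ s)
  interchange p q r s = begin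
    (p ⊕ q) ⊕ (r ⊕ s) ≡⟨ ⊕-assoc p q (r ⊕ s) ⟩
    p ⊕ (q ⊕ (r ⊕ s)) ≡⟨ cong (p ⊕_) (⊕-assoc q r s) ⟨
    p ⊕ ((q ⊕ r) ⊕ s) ≡⟨ cong (λ z → p ⊕ (z ⊕ s)) (⊕-comm q r) ⟩
    p ⊕ ((r ⊕ q) ⊕ s) ≡⟨ cong (p ⊕_) (⊕-assoc r q s) ⟩
    p ⊕ (r ⊕ (q ⊕ s)) ≡⟨ ⊕-assoc p r (q ⊕ s) ⟨
    (p ⊕ r) ⊕ (q ⊕ s) ∎
    where open ≡-Reasoning

⊛-distribʳ : ∀ {n} (a b c : K n) → (b ⊕ c) ⊛ a ≡ b ⊛ a ⊕ c ⊛ a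
⊛-distribʳ a b c = trans (⊛-comm (b ⊕ c) a)
  (trans (⊛-distribˡ a b c) (cong₂ _⊕_ (⊛-comm a b) (⊛-comm a c)))

⊛-assoc : ∀ {n} (a b c : K n) → (a ⊛ b) ⊛ c ≡ a ⊛ (b ⊛ c)
⊛-assoc (const x) (const y) (const z) = cong const (ℤₚ.*-assoc x y z)
⊛-assoc (a +ε b) (c +ε d) (e +ε f) = cong₂ _+ε_ (⊛-assoc a c e) (begin
  (a ⊛ c) ⊛ f ⊕ (a ⊛ d ⊕ b ⊛ c) ⊛ e             ≡⟨ cong₂ _⊕_ (⊛-assoc a c f) (⊛-distribʳ e (a ⊛ d) (b ⊛ c)) ⟩
  a ⊛ (c ⊛ f) ⊕ ((a ⊛ d) ⊛ e ⊕ (b ⊛ c) ⊛ e)     ≡⟨ cong (a ⊛ (c ⊛ f) ⊕_) (cong₂ _⊕_ (⊛-assoc a d e) (⊛-assoc b c e)) ⟩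
  a ⊛ (c ⊛ f) ⊕ (a ⊛ (d ⊛ e) ⊕ b ⊛ (c ⊛ e))     ≡⟨ ⊕-assoc (a ⊛ (c ⊛ f)) (a ⊛ (d ⊛ e)) (b ⊛ (c ⊛ e)) ⟨
  (a ⊛ (c ⊛ f) ⊕ a ⊛ (d ⊛ e)) ⊕ b ⊛ (c ⊛ e)     ≡⟨ cong (_⊕ b ⊛ (c ⊛ e)) (⊛-distribˡ a (c ⊛ f) (d ⊛ e)) ⟨
  a ⊛ (c ⊛ f ⊕ d ⊛ e) ⊕ b ⊛ (c ⊛ e)             ∎)
  where open ≡-Reasoning

K-isCommutativeRing : ∀ {n} → IsCommutativeRing {A = K n} _≡_ _⊕_ _⊛_ ⊝_ 𝟘 𝟙
K-isCommutativeRing = record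
  { isRing = record
    { +-isAbelianGroup = record
      { isGroup = record
        { isMonoid = record
          { isSemigroup = record
            { isMagma = record { isEquivalence = isEquivalence ; ∙-cong = cong₂ _⊕_ }
            ; assoc = ⊕-assoc }
          ; identity = ⊕-identityˡ , ⊕-identityʳ }
        ; inverse = ⊝-inverseˡ , λ a → trans (⊕-comm a (⊝ a)) (⊝-inverseˡ a)
        ; ⁻¹-cong = cong ⊝_ }
      ; comm = ⊕-comm }
    ; *-cong = cong₂ _⊛_
    ; *-assoc = ⊛-assoc
    ; *-identity = ⊛-identityˡ , λ a → trans (⊛-comm a 𝟙) (⊛-identityˡ a)
    ; distrib = ⊛-distribˡ , ⊛-distribʳ }
  ; *-comm = ⊛-comm }

K-ring : ℕ → CommutativeRing _ _
K-ring n = record { isCommutativeRing = K-isCommutativeRing {n} }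

⊛-zeroʳ : ∀ {n} (a : K n) → a ⊛ 𝟘 ≡ 𝟘
⊛-zeroʳ a = trans (⊛-comm a 𝟘) (⊛-zeroˡ a)

⊛-identityʳ : ∀ {n} (a : K n) → a ⊛ 𝟙 ≡ a
⊛-identityʳ a = trans (⊛-comm a 𝟙) (⊛-identityˡ a)

ι-+ : ∀ {n} x y → ι {n} (x ℤ.+ y) ≡ ι x ⊕ ι y
ι-+ {zero} x y = refl
ι-+ {suc n} x y = cong₂ _+ε_ (ι-+ x y) (sym (⊕-identityˡ 𝟘))

ι-* : ∀ {n} x y → ι {n} (x ℤ.* y) ≡ ι x ⊛ ι y
ι-* {zero} x y = refl
ι-* {suc n} x y = cong₂ _+ε_ (ι-* x y)
  (sym (trans (cong₂ _⊕_ (⊛-zeroʳ (ι x)) (⊛-zeroˡ (ι y))) (⊕-identityˡ 𝟘)))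

ι-neg : ∀ {n} x → ι {n} (ℤ.- x) ≡ ⊝ ι x
ι-neg {zero} x = refl
ι-neg {suc n} x = cong₂ _+ε_ (ι-neg x) (ι-neg (+ 0))

ℤ-homomorphism : ∀ n → CommutativeRing.rawRing ℤₚ.+-*-commutativeRing -Raw-AlmostCommutative⟶ fromCommutativeRing (K-ring n)
ℤ-homomorphism n = record
  { ⟦_⟧ = ι ; +-homo = ι-+ ; *-homo = ι-* ; -‿homo = ι-neg ; 0-homo = refl ; 1-homo = refl }

ι-weaklyDec : ∀ n (x y : ℤ) → Maybe (ι {n} x ≡ ι y)
ι-weaklyDec n x y with x ℤ.≟ y
... | yes eq = just (cong ι eq)
... | no _ = nothing

module Solve {n : ℕ} where
  open Algebra.Solver.Ring (CommutativeRing.rawRing ℤₚ.+-*-commutativeRing)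
    (fromCommutativeRing (K-ring n)) (ℤ-homomorphism n) (ι-weaklyDec n) public

open Solve using (solve; _:+_; _:*_; _:-_; :-_; _:=_; con)

coef : ∀ {n} → K n → Vec Bool n → ℤ
coef (const x) []           = x
coef (a +ε b)  (false ∷ S) = coef a S
coef (a +ε b)  (true ∷ S)  = coef b S

top c₀ : ∀ {n} → K n → ℤ
top (const x) = x
top (a +ε b)  = top b
c₀ (const x) = x
c₀ (a +ε b)  = c₀ a

top-⊕ : ∀ {n} (a b : K n) → top (a ⊕ b) ≡ top a ℤ.+ top b
top-⊕ (const x) (const y) = refl
top-⊕ (a +ε b) (c +ε d) = top-⊕ b d

top-⊝ : ∀ {n} (a : K n) → top (⊝ a) ≡ ℤ.- top a
top-⊝ (const x) = refl
top-⊝ (a +ε b) = top-⊝ b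

top-𝟘 : ∀ n → top {n} 𝟘 ≡ + 0
top-𝟘 zero = refl
top-𝟘 (suc n) = top-𝟘 n

top-ι⊛ : ∀ {n} z (a : K n) → top (ι z ⊛ a) ≡ z ℤ.* top a
top-ι⊛ z (const x) = refl
top-ι⊛ {suc n} z (a +ε b) = trans (top-⊕ (ι z ⊛ b) (𝟘 ⊛ a))
  (trans (cong₂ ℤ._+_ (top-ι⊛ z b) (trans (cong top (⊛-zeroˡ a)) (top-𝟘 n))) (ℤₚ.+-identityʳ _))

c₀-⊛ : ∀ {n} (a b : K n) → c₀ (a ⊛ b) ≡ c₀ a ℤ.* c₀ b
c₀-⊛ (const x) (const y) = refl
c₀-⊛ (a +ε b) (c +ε d) = c₀-⊛ a c

c₀-⊕ : ∀ {n} (a b : K n) → c₀ (a ⊕ b) ≡ c₀ a ℤ.+ c₀ b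
c₀-⊕ (const x) (const y) = refl
c₀-⊕ (a +ε b) (c +ε d) = c₀-⊕ a c

c₀-⊝ : ∀ {n} (a : K n) → c₀ (⊝ a) ≡ ℤ.- c₀ a
c₀-⊝ (const x) = refl
c₀-⊝ (a +ε b) = c₀-⊝ a

c₀-ι : ∀ n z → c₀ {n} (ι z) ≡ z
c₀-ι zero z = refl
c₀-ι (suc n) z = c₀-ι n z

infixr 8 _^ᴷ_
_^ᴷ_ : ∀ {n} → K n → ℕ → K n
a ^ᴷ zero  = 𝟙
a ^ᴷ suc k = a ⊛ a ^ᴷ k

c₀-^ : ∀ {n} (a : K n) k → c₀ a ≡ + 1 → c₀ (a ^ᴷ k) ≡ + 1
c₀-^ {n} a zero e = c₀-ι n _
c₀-^ a (suc k) e = trans (c₀-⊛ a (a ^ᴷ k)) (cong₂ ℤ._*_ e (c₀-^ a k e))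

-- Meant for series with constant term 1, hence the value `𝟙` on constants. The ε-part is the
-- solution x of `a x + b a⁻¹ = 0`.
inv : ∀ {n} → K n → K n
inv (const x) = 𝟙
inv (a +ε b)  = inv a +ε ⊝ (inv a ⊛ inv a ⊛ b)

inv-inverse : ∀ {n} (a : K n) → c₀ a ≡ + 1 → a ⊛ inv a ≡ 𝟙
inv-inverse (const x) refl = refl
inv-inverse (a +ε b) e = cong₂ _+ε_ (inv-inverse a e) (begin
  a ⊛ ⊝ (inv a ⊛ inv a ⊛ b) ⊕ b ⊛ inv a
    ≡⟨ solve 3 (λ a i b → a :* (:- (i :* i :* b)) :+ b :* i := (con (+ 1) :- a :* i) :* i :* b) refl a (inv a) b ⟩
  (𝟙 ⊕ ⊝ (a ⊛ inv a)) ⊛ inv a ⊛ b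
    ≡⟨ cong (λ z → (𝟙 ⊕ ⊝ z) ⊛ inv a ⊛ b) (inv-inverse a e) ⟩
  (𝟙 ⊕ ⊝ 𝟙) ⊛ inv a ⊛ b
    ≡⟨ solve 2 (λ i b → (con (+ 1) :- con (+ 1)) :* i :* b := con (+ 0)) refl (inv a) b ⟩
  𝟘 ∎)
  where open ≡-Reasoning

c₀-inv : ∀ {n} (a : K n) → c₀ (inv a) ≡ + 1
c₀-inv (const x) = refl
c₀-inv (a +ε b) = c₀-inv a

-- The Euler derivation: εᵢ₁⋯εᵢₘ ↦ m εᵢ₁⋯εᵢₘ.
D : ∀ {n} → K n → K n
D (const x) = 𝟘
D (a +ε b)  = D a +ε (D b ⊕ b)

D-⊕ : ∀ {n} (a b : K n) → D (a ⊕ b) ≡ D a ⊕ D b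
D-⊕ (const x) (const y) = refl
D-⊕ (a +ε b) (c +ε d) = cong₂ _+ε_ (D-⊕ a c) (trans (cong (_⊕ (b ⊕ d)) (D-⊕ b d))
  (solve 4 (λ p q r s → (p :+ q) :+ (r :+ s) := (p :+ r) :+ (q :+ s)) refl (D b) (D d) b d))

D-⊛ : ∀ {n} (a b : K n) → D (a ⊛ b) ≡ D a ⊛ b ⊕ a ⊛ D b
D-⊛ (const x) (const y) = sym (trans (cong₂ _⊕_ (⊛-zeroˡ (const y)) (⊛-zeroʳ (const x))) refl)
D-⊛ (a +ε b) (c +ε d) = cong₂ _+ε_ (D-⊛ a c) (begin
  D (a ⊛ d ⊕ b ⊛ c) ⊕ (a ⊛ d ⊕ b ⊛ c)
    ≡⟨ cong (_⊕ (a ⊛ d ⊕ b ⊛ c)) (trans (D-⊕ (a ⊛ d) (b ⊛ c)) (cong₂ _⊕_ (D-⊛ a d) (D-⊛ b c))) ⟩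
  (D a ⊛ d ⊕ a ⊛ D d ⊕ (D b ⊛ c ⊕ b ⊛ D c)) ⊕ (a ⊛ d ⊕ b ⊛ c)
    ≡⟨ solve 8 (λ a b c d a' b' c' d' →
         (a' :* d :+ a :* d' :+ (b' :* c :+ b :* c')) :+ (a :* d :+ b :* c)
         := (a' :* d :+ (b' :+ b) :* c) :+ (a :* (d' :+ d) :+ b :* c')) refl
         a b c d (D a) (D b) (D c) (D d) ⟩
  (D a ⊛ d ⊕ (D b ⊕ b) ⊛ c) ⊕ (a ⊛ (D d ⊕ d) ⊕ b ⊛ D c) ∎)
  where open ≡-Reasoning

D-ι : ∀ n z → D {n} (ι z) ≡ 𝟘
D-ι zero z = refl
D-ι (suc n) z = cong₂ _+ε_ (D-ι n z) (trans (cong (_⊕ 𝟘) (D-ι n (+ 0))) (⊕-identityˡ 𝟘))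

D-ι⊛ : ∀ {n} z (a : K n) → D (ι z ⊛ a) ≡ ι z ⊛ D a
D-ι⊛ {n} z a = trans (D-⊛ (ι z) a) (trans (cong (λ e → e ⊛ a ⊕ ι z ⊛ D a) (D-ι n z))
  (solve 2 (λ a b → con (+ 0) :* a :+ b := b) refl a (ι z ⊛ D a)))

-- The power rule, multiplied by `a` to avoid the exponent k - 1.
D-^ : ∀ {n} (a : K n) k → D (a ^ᴷ k) ⊛ a ≡ ι (+ k) ⊛ (a ^ᴷ k ⊛ D a)
D-^ {n} a zero = trans (cong (_⊛ a) (D-ι n _))
  (solve 2 (λ a b → con (+ 0) :* a := con (+ 0) :* b) refl a (𝟙 ⊛ D a))
D-^ a (suc k) = begin
  D (a ⊛ a ^ᴷ k) ⊛ a                       ≡⟨ cong (_⊛ a) (D-⊛ a (a ^ᴷ k)) ⟩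
  (D a ⊛ a ^ᴷ k ⊕ a ⊛ D (a ^ᴷ k)) ⊛ a
    ≡⟨ solve 4 (λ a a' p p' → (a' :* p :+ a :* p') :* a := a' :* p :* a :+ a :* (p' :* a)) refl a (D a) (a ^ᴷ k) (D (a ^ᴷ k)) ⟩
  D a ⊛ a ^ᴷ k ⊛ a ⊕ a ⊛ (D (a ^ᴷ k) ⊛ a)  ≡⟨ cong (λ z → D a ⊛ a ^ᴷ k ⊛ a ⊕ a ⊛ z) (D-^ a k) ⟩
  D a ⊛ a ^ᴷ k ⊛ a ⊕ a ⊛ (ι (+ k) ⊛ (a ^ᴷ k ⊛ D a))
    ≡⟨ solve 4 (λ a a' p k → a' :* p :* a :+ a :* (k :* (p :* a')) := (con (+ 1) :+ k) :* ((a :* p) :* a')) refl a (D a) (a ^ᴷ k) (ι (+ k)) ⟩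
  (𝟙 ⊕ ι (+ k)) ⊛ (a ⊛ a ^ᴷ k ⊛ D a)       ≡⟨ cong (_⊛ (a ⊛ a ^ᴷ k ⊛ D a)) (ι-+ (+ 1) (+ k)) ⟨
  ι (+ suc k) ⊛ (a ⊛ a ^ᴷ k ⊛ D a)         ∎
  where open ≡-Reasoning

top-D : ∀ {n} (a : K n) → top (D a) ≡ + n ℤ.* top a
top-D (const x) = sym (ℤₚ.*-zeroˡ x)
top-D {suc n} (a +ε b) = trans (top-⊕ (D b) b) (trans (cong (ℤ._+ top b) (top-D b))
  (trans (ℤₚ.+-comm (+ n ℤ.* top b) (top b)) (sym (ℤₚ.suc-* (+ n) (top b)))))

-- On monomials of degree m the operator acts as multiplication by m + j + 1, which can be cancelled
-- in the integers. The ε-part has lost one degree, so the induction raises `j`.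
D+j≡𝟘⇒≡𝟘 : ∀ {n} j (a : K n) → D a ⊕ ι (+ suc j) ⊛ a ≡ 𝟘 → a ≡ 𝟘
D+j≡𝟘⇒≡𝟘 j (const x) e = cong const (ℤₚ.*-cancelˡ-≡ (+ suc j) x (+ 0)
  (trans (sym (ℤₚ.+-identityˡ _)) (trans (const-injective e) (sym (ℤₚ.*-zeroʳ (+ suc j))))))
D+j≡𝟘⇒≡𝟘 j (a +ε b) e = cong₂ _+ε_ (D+j≡𝟘⇒≡𝟘 j a (+ε-injectiveˡ e)) (D+j≡𝟘⇒≡𝟘 (suc j) b (begin
    D b ⊕ ι (+ suc (suc j)) ⊛ b            ≡⟨ cong (λ z → D b ⊕ z ⊛ b) (ι-+ (+ 1) (+ suc j)) ⟩
    D b ⊕ (𝟙 ⊕ ι (+ suc j)) ⊛ b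
      ≡⟨ solve 4 (λ a b b' k → b' :+ (con (+ 1) :+ k) :* b := (b' :+ b) :+ (k :* b :+ con (+ 0) :* a)) refl a b (D b) (ι (+ suc j)) ⟩
    (D b ⊕ b) ⊕ (ι (+ suc j) ⊛ b ⊕ 𝟘 ⊛ a) ≡⟨ +ε-injectiveʳ e ⟩
    𝟘 ∎))
  where
  open ≡-Reasoning

-- Takes the place of logarithms: a product of two units is shown to be 1 by differentiating it.
D≡𝟘⇒≡ι : ∀ {n} (a : K n) → D a ≡ 𝟘 → a ≡ ι (c₀ a)
D≡𝟘⇒≡ι (const x) e = refl
D≡𝟘⇒≡ι (a +ε b) e = cong₂ _+ε_ (D≡𝟘⇒≡ι a (+ε-injectiveˡ e))
  (D+j≡𝟘⇒≡𝟘 0 b (trans (cong (D b ⊕_) (⊛-identityˡ b)) (+ε-injectiveʳ e)))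

-- Exponential of the nilpotent part.
exp : ∀ {n} → K n → K n
exp (const x) = 𝟙
exp (a +ε b)  = exp a +ε exp a ⊛ b

c₀-exp : ∀ {n} (a : K n) → c₀ (exp a) ≡ + 1
c₀-exp (const x) = refl
c₀-exp (a +ε b) = c₀-exp a

D-exp : ∀ {n} (a : K n) → D (exp a) ≡ exp a ⊛ D a
D-exp (const x) = refl
D-exp (a +ε b) = cong₂ _+ε_ (D-exp a) (begin
  D (exp a ⊛ b) ⊕ exp a ⊛ b                     ≡⟨ cong (_⊕ exp a ⊛ b) (D-⊛ (exp a) b) ⟩
  (D (exp a) ⊛ b ⊕ exp a ⊛ D b) ⊕ exp a ⊛ b     ≡⟨ cong (λ z → (z ⊛ b ⊕ exp a ⊛ D b) ⊕ exp a ⊛ b) (D-exp a) ⟩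
  (exp a ⊛ D a ⊛ b ⊕ exp a ⊛ D b) ⊕ exp a ⊛ b
    ≡⟨ solve 4 (λ e a' b b' → (e :* a' :* b :+ e :* b') :+ e :* b := e :* (b' :+ b) :+ e :* b :* a') refl (exp a) (D a) b (D b) ⟩
  exp a ⊛ (D b ⊕ b) ⊕ exp a ⊛ b ⊛ D a ∎)
  where open ≡-Reasoning

-- The part of weight -z, when the i-th variable has weight wᵢ.
π : ∀ {n} → ℤ → Vec ℤ n → K n → K n
π z [] (const x) with z ℤ.≟ + 0
... | yes _ = const x
... | no _  = const (+ 0)
π z (w ∷ ws) (a +ε b) = π z ws a +ε π (z ℤ.+ w) ws b

π-𝟘 : ∀ {n} z (ws : Vec ℤ n) → π z ws 𝟘 ≡ 𝟘
π-𝟘 z [] with z ℤ.≟ + 0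
... | yes _ = refl
... | no _  = refl
π-𝟘 z (w ∷ ws) = cong₂ _+ε_ (π-𝟘 z ws) (π-𝟘 (z ℤ.+ w) ws)

π-ι : ∀ {n} (ws : Vec ℤ n) x → π (+ 0) ws (ι x) ≡ ι x
π-ι [] x = refl
π-ι (w ∷ ws) x = cong₂ _+ε_ (π-ι ws x) (π-𝟘 (+ 0 ℤ.+ w) ws)

π-⊕ : ∀ {n} z (ws : Vec ℤ n) a b → π z ws (a ⊕ b) ≡ π z ws a ⊕ π z ws b
π-⊕ z [] (const x) (const y) with z ℤ.≟ + 0
... | yes _ = refl
... | no _  = refl
π-⊕ z (w ∷ ws) (a +ε b) (c +ε d) = cong₂ _+ε_ (π-⊕ z ws a c) (π-⊕ (z ℤ.+ w) ws b d)

π-D : ∀ {n} z (ws : Vec ℤ n) a → π z ws (D a) ≡ D (π z ws a)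
π-D z [] (const x) with z ℤ.≟ + 0
... | yes _ = refl
... | no _  = refl
π-D z (w ∷ ws) (a +ε b) = cong₂ _+ε_ (π-D z ws a)
  (trans (π-⊕ (z ℤ.+ w) ws (D b) b) (cong (_⊕ π (z ℤ.+ w) ws b) (π-D (z ℤ.+ w) ws b)))

-- `P` constrains the weights of the monomials with nonzero coefficient. The predicate is translated
-- along the recursion, so it can be an order relation as well as an equation.
Supp : ∀ {n} → (ℤ → Set) → Vec ℤ n → K n → Set
Supp P [] (const x)        = x ≡ + 0 ⊎ P (+ 0)
Supp P (w ∷ ws) (a +ε b) = Supp P ws a × Supp (λ z → P (w ℤ.+ z)) ws b

Supp-mono : ∀ {n} {P Q : ℤ → Set} (ws : Vec ℤ n) a → (∀ z → P z → Q z) → Supp P ws a → Supp Q ws a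
Supp-mono [] (const x) h (inj₁ e) = inj₁ e
Supp-mono [] (const x) h (inj₂ p) = inj₂ (h _ p)
Supp-mono (w ∷ ws) (a +ε b) h (p , q) = Supp-mono ws a h p , Supp-mono ws b (λ z → h (w ℤ.+ z)) q

Supp-𝟘 : ∀ {n} {P : ℤ → Set} (ws : Vec ℤ n) → Supp P ws 𝟘
Supp-𝟘 [] = inj₁ refl
Supp-𝟘 (w ∷ ws) = Supp-𝟘 ws , Supp-𝟘 ws

Supp-ι : ∀ {n} {P : ℤ → Set} (ws : Vec ℤ n) x → P (+ 0) → Supp P ws (ι x)
Supp-ι [] x p = inj₂ p
Supp-ι (w ∷ ws) x p = Supp-ι ws x p , Supp-𝟘 ws

Supp-⊕ : ∀ {n} {P : ℤ → Set} (ws : Vec ℤ n) a b → Supp P ws a → Supp P ws b → Supp P ws (a ⊕ b)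
Supp-⊕ [] (const _) (const _) (inj₁ refl) (inj₁ refl) = inj₁ refl
Supp-⊕ [] (const _) (const _) (inj₁ _) (inj₂ q) = inj₂ q
Supp-⊕ [] (const _) (const _) (inj₂ p) _ = inj₂ p
Supp-⊕ (w ∷ ws) (a +ε b) (c +ε d) (p , q) (r , s) = Supp-⊕ ws a c p r , Supp-⊕ ws b d q s

Supp-⊝ : ∀ {n} {P : ℤ → Set} (ws : Vec ℤ n) a → Supp P ws a → Supp P ws (⊝ a)
Supp-⊝ [] (const _) (inj₁ refl) = inj₁ refl
Supp-⊝ [] (const _) (inj₂ p) = inj₂ p
Supp-⊝ (w ∷ ws) (a +ε b) (p , q) = Supp-⊝ ws a p , Supp-⊝ ws b q

Supp-D : ∀ {n} {P : ℤ → Set} (ws : Vec ℤ n) a → Supp P ws a → Supp P ws (D a)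
Supp-D [] (const _) p = inj₁ refl
Supp-D (w ∷ ws) (a +ε b) (p , q) = Supp-D ws a p , Supp-⊕ ws (D b) b (Supp-D ws b q) q

Supp-⊛ : ∀ {n} {P Q R : ℤ → Set} (ws : Vec ℤ n) a b → (∀ x y → P x → Q y → R (x ℤ.+ y)) →
         Supp P ws a → Supp Q ws b → Supp R ws (a ⊛ b)
Supp-⊛ [] (const x) (const y) h (inj₁ refl) _ = inj₁ (ℤₚ.*-zeroˡ y)
Supp-⊛ [] (const x) (const y) h (inj₂ _) (inj₁ refl) = inj₁ (ℤₚ.*-zeroʳ x)
Supp-⊛ [] (const x) (const y) h (inj₂ p) (inj₂ q) = inj₂ (h _ _ p q)
Supp-⊛ {R = R} (w ∷ ws) (a +ε b) (c +ε d) h (p , q) (r , s) =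
  Supp-⊛ ws a c h p r ,
  Supp-⊕ ws (a ⊛ d) (b ⊛ c)
    (Supp-⊛ ws a d (λ x y px qy → subst R (swap x y w) (h x (w ℤ.+ y) px qy)) p s)
    (Supp-⊛ ws b c (λ x y px qy → subst R (ℤₚ.+-assoc w x y) (h (w ℤ.+ x) y px qy)) q r)
  where
  swap : ∀ x y w → x ℤ.+ (w ℤ.+ y) ≡ w ℤ.+ (x ℤ.+ y)
  swap = ℤ-solve-∀

Supp-inv : ∀ {n} {P : ℤ → Set} (ws : Vec ℤ n) a → P (+ 0) → (∀ x y → P x → P y → P (x ℤ.+ y)) →
           Supp P ws a → Supp P ws (inv a)
Supp-inv [] (const x) p0 h p = inj₂ p0
Supp-inv {P = P} (w ∷ ws) (a +ε b) p0 h (p , q) = ia , Supp-⊝ ws _ (Supp-⊛ ws (inv a ⊛ inv a) b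
    (λ x y px py → subst P (swap x y w) (h x (w ℤ.+ y) px py)) (Supp-⊛ ws (inv a) (inv a) h ia ia) q)
  where
  ia = Supp-inv ws a p0 h p
  swap : ∀ x y w → x ℤ.+ (w ℤ.+ y) ≡ w ℤ.+ (x ℤ.+ y)
  swap = ℤ-solve-∀

Supp-c₀ : ∀ {n} {P : ℤ → Set} (ws : Vec ℤ n) a → ¬ P (+ 0) → Supp P ws a → c₀ a ≡ + 0
Supp-c₀ [] (const x) h (inj₁ e) = e
Supp-c₀ [] (const x) h (inj₂ p) = ⊥-elim (h p)
Supp-c₀ (w ∷ ws) (a +ε b) h (p , q) = Supp-c₀ ws a h p

Supp-π : ∀ {n} z (ws : Vec ℤ n) a → Supp (λ x → z ℤ.+ x ≡ + 0) ws (π z ws a)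
Supp-π z [] (const x) with z ℤ.≟ + 0
... | yes e = inj₂ (trans (ℤₚ.+-identityʳ z) e)
... | no _  = inj₁ refl
Supp-π z (w ∷ ws) (a +ε b) = Supp-π z ws a ,
  Supp-mono ws _ (λ x e → trans (sym (ℤₚ.+-assoc z w x)) e) (Supp-π (z ℤ.+ w) ws b)

π-disjoint : ∀ {n} {P : ℤ → Set} z (ws : Vec ℤ n) a → (∀ x → P x → z ℤ.+ x ≢ + 0) → Supp P ws a → π z ws a ≡ 𝟘
π-disjoint z [] (const x) h p with z ℤ.≟ + 0
π-disjoint z [] (const x) h (inj₁ e) | yes _ = cong const e
π-disjoint z [] (const x) h (inj₂ p) | yes e = ⊥-elim (h _ p (trans (ℤₚ.+-identityʳ z) e))
... | no _  = refl
π-disjoint z (w ∷ ws) (a +ε b) h (p , q) = cong₂ _+ε_ (π-disjoint z ws a h p)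
  (π-disjoint (z ℤ.+ w) ws b (λ x px e → h (w ℤ.+ x) px (trans (sym (ℤₚ.+-assoc z w x)) e)) q)

-- Each monomial of `b` is shifted by the same weight `u`, so the projection of the product selects
-- a single weight in `b`.
π-homogeneous : ∀ {n} z u (ws : Vec ℤ n) a b → Supp (_≡ u) ws a → π z ws (a ⊛ b) ≡ a ⊛ π (z ℤ.+ u) ws b
π-homogeneous z u [] (const x) (const y) (inj₁ refl) with z ℤ.≟ + 0 | (z ℤ.+ u) ℤ.≟ + 0
... | yes _ | yes _ = refl
... | yes _ | no _  = refl
... | no _  | yes _ = refl
... | no _  | no _  = refl
π-homogeneous z u [] (const x) (const y) (inj₂ refl) rewrite ℤₚ.+-identityʳ z with z ℤ.≟ + 0
... | yes _ = refl
... | no _  = cong const (sym (ℤₚ.*-zeroʳ x))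
π-homogeneous z u (w ∷ ws) (a +ε b) (c +ε d) (p , q) = cong₂ _+ε_ (π-homogeneous z u ws a c p) (begin
  π (z ℤ.+ w) ws (a ⊛ d ⊕ b ⊛ c)                         ≡⟨ π-⊕ (z ℤ.+ w) ws (a ⊛ d) (b ⊛ c) ⟩
  π (z ℤ.+ w) ws (a ⊛ d) ⊕ π (z ℤ.+ w) ws (b ⊛ c)
    -- In an element of pure weight `u`, the coefficient of a variable of weight `w` has pure weight
    -- `u - w`.
    ≡⟨ cong₂ _⊕_ (π-homogeneous (z ℤ.+ w) u ws a d p)
         (π-homogeneous (z ℤ.+ w) (u ℤ.- w) ws b c (Supp-mono ws b (λ x e → trans (cancel w x) (cong (ℤ._- w) e)) q)) ⟩
  a ⊛ π (z ℤ.+ w ℤ.+ u) ws d ⊕ b ⊛ π (z ℤ.+ w ℤ.+ (u ℤ.- w)) ws c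
    ≡⟨ cong₂ (λ r s → a ⊛ π r ws d ⊕ b ⊛ π s ws c) (swap z w u) (cancel′ z w u) ⟩
  a ⊛ π (z ℤ.+ u ℤ.+ w) ws d ⊕ b ⊛ π (z ℤ.+ u) ws c ∎)
  where
  open ≡-Reasoning
  cancel : ∀ w x → x ≡ w ℤ.+ x ℤ.- w
  cancel = ℤ-solve-∀
  swap : ∀ z w u → z ℤ.+ w ℤ.+ u ≡ z ℤ.+ u ℤ.+ w
  swap = ℤ-solve-∀
  cancel′ : ∀ z w u → z ℤ.+ w ℤ.+ (u ℤ.- w) ≡ z ℤ.+ u
  cancel′ = ℤ-solve-∀

-- Substitution of square-zero elements for the variables

ev : ∀ {m n} → Vec (K m) n → K n → K m
ev []       (const x) = ι x
ev (u ∷ us) (a +ε b)  = ev us a ⊕ ev us b ⊛ u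

ev-𝟘 : ∀ {m n} (us : Vec (K m) n) → ev us 𝟘 ≡ 𝟘
ev-𝟘 [] = refl
ev-𝟘 (u ∷ us) = trans (cong₂ (λ p q → p ⊕ q ⊛ u) (ev-𝟘 us) (ev-𝟘 us))
  (solve 1 (λ u → con (+ 0) :+ con (+ 0) :* u := con (+ 0)) refl u)

ev-ι : ∀ {m n} (us : Vec (K m) n) z → ev us (ι z) ≡ ι z
ev-ι [] z = refl
ev-ι (u ∷ us) z = trans (cong₂ (λ p q → p ⊕ q ⊛ u) (ev-ι us z) (ev-𝟘 us))
  (solve 2 (λ u z → z :+ con (+ 0) :* u := z) refl u (ι z))

ev-⊕ : ∀ {m n} (us : Vec (K m) n) a b → ev us (a ⊕ b) ≡ ev us a ⊕ ev us b
ev-⊕ [] (const x) (const y) = ι-+ x y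
ev-⊕ (u ∷ us) (a +ε b) (c +ε d) = trans (cong₂ (λ p q → p ⊕ q ⊛ u) (ev-⊕ us a c) (ev-⊕ us b d))
  (solve 5 (λ a b c d u → (a :+ c) :+ (b :+ d) :* u := (a :+ b :* u) :+ (c :+ d :* u)) refl
    (ev us a) (ev us b) (ev us c) (ev us d) u)

-- u behaves like c ε for a variable ε of weight w and a unit c of weight 0 with D c = (q - 1) c.
record Variable {m} (ws : Vec ℤ m) (q : K m) (w : ℤ) (u : K m) : Set where
  field
    square      : u ⊛ u ≡ 𝟘
    euler       : D u ≡ u ⊛ q
    homogeneous : Supp (_≡ w) ws u
    c₀-zero     : c₀ u ≡ + 0

open Variable

Variables : ∀ {m n} → Vec ℤ m → K m → Vec ℤ n → Vec (K m) n → Set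
Variables ws q = Pointwise (Variable ws q)

module _ {m} {ws : Vec ℤ m} {q : K m} where

  -- `_⊛_` drops the product of the two ε-parts; after the substitution this product carries the
  -- factor `u ⊛ u`, which is 0.
  ev-⊛ : ∀ {n} {ws' : Vec ℤ n} {us} → Variables ws q ws' us → ∀ a b → ev us (a ⊛ b) ≡ ev us a ⊛ ev us b
  ev-⊛ [] (const x) (const y) = ι-* x y
  ev-⊛ {us = u ∷ us} (v ∷ vs) (a +ε b) (c +ε d) = begin
    ev us (a ⊛ c) ⊕ ev us (a ⊛ d ⊕ b ⊛ c) ⊛ u
      ≡⟨ cong₂ (λ p q → p ⊕ q ⊛ u) (ev-⊛ vs a c)
           (trans (ev-⊕ us (a ⊛ d) (b ⊛ c)) (cong₂ _⊕_ (ev-⊛ vs a d) (ev-⊛ vs b c))) ⟩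
    A ⊛ C ⊕ (A ⊛ D' ⊕ B ⊛ C) ⊛ u
      ≡⟨ solve 5 (λ A B C D u → A :* C :+ (A :* D :+ B :* C) :* u
           := (A :+ B :* u) :* (C :+ D :* u) :- B :* D :* (u :* u)) refl A B C D' u ⟩
    (A ⊕ B ⊛ u) ⊛ (C ⊕ D' ⊛ u) ⊕ ⊝ (B ⊛ D' ⊛ (u ⊛ u))
      ≡⟨ cong (λ z → (A ⊕ B ⊛ u) ⊛ (C ⊕ D' ⊛ u) ⊕ ⊝ (B ⊛ D' ⊛ z)) (square v) ⟩
    (A ⊕ B ⊛ u) ⊛ (C ⊕ D' ⊛ u) ⊕ ⊝ (B ⊛ D' ⊛ 𝟘)
      ≡⟨ solve 3 (λ P B D → P :- B :* D :* con (+ 0) := P) refl ((A ⊕ B ⊛ u) ⊛ (C ⊕ D' ⊛ u)) B D' ⟩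
    (A ⊕ B ⊛ u) ⊛ (C ⊕ D' ⊛ u) ∎
    where
    open ≡-Reasoning
    A = ev us a
    B = ev us b
    C = ev us c
    D' = ev us d

  -- Chain rule: a monomial of degree m turns into a product of m elements with `D u = u q`, so its
  -- derivative is m q times itself, and the factor m is the Euler derivation before the
  -- substitution.
  D-ev : ∀ {n} {ws' : Vec ℤ n} {us} → Variables ws q ws' us → ∀ a → D (ev us a) ≡ ev us (D a) ⊛ q
  D-ev [] (const x) = trans (D-ι m x) (sym (⊛-zeroˡ q))
  D-ev {us = u ∷ us} (v ∷ vs) (a +ε b) = begin
    D (ev us a ⊕ ev us b ⊛ u)
      ≡⟨ trans (D-⊕ (ev us a) (ev us b ⊛ u)) (cong₂ _⊕_ (D-ev vs a) (trans (D-⊛ (ev us b) u) (cong₂ (λ x y → x ⊛ u ⊕ ev us b ⊛ y) (D-ev vs b) (euler v)))) ⟩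
    ev us (D a) ⊛ q ⊕ (ev us (D b) ⊛ q ⊛ u ⊕ ev us b ⊛ (u ⊛ q))
      ≡⟨ solve 5 (λ a' b' b u q → a' :* q :+ (b' :* q :* u :+ b :* (u :* q)) := (a' :+ (b' :+ b) :* u) :* q) refl
           (ev us (D a)) (ev us (D b)) (ev us b) u q ⟩
    (ev us (D a) ⊕ (ev us (D b) ⊕ ev us b) ⊛ u) ⊛ q
      ≡⟨ cong (λ z → (ev us (D a) ⊕ z ⊛ u) ⊛ q) (ev-⊕ us (D b) b) ⟨
    (ev us (D a) ⊕ ev us (D b ⊕ b) ⊛ u) ⊛ q ∎
    where open ≡-Reasoning

  -- Every variable is replaced by an element of its own weight.
  π-ev : ∀ {n} {ws' : Vec ℤ n} {us} → Variables ws q ws' us → ∀ z a → π z ws (ev us a) ≡ ev us (π z ws' a)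
  π-ev [] z (const x) with z ℤ.≟ + 0
  ... | yes refl = π-ι ws x
  ... | no z≢0 = π-disjoint {P = _≡ + 0} z ws (ι x)
    (λ y y≡0 e → z≢0 (trans (sym (ℤₚ.+-identityʳ z)) (trans (cong (λ r → z ℤ.+ r) (sym y≡0)) e))) (Supp-ι ws x refl)
  π-ev {ws' = w ∷ ws'} {us = u ∷ us} (v ∷ vs) z (a +ε b) =
    trans (π-⊕ z ws (ev us a) (ev us b ⊛ u)) (cong₂ _⊕_ (π-ev vs z a) (begin
      π z ws (ev us b ⊛ u)            ≡⟨ cong (π z ws) (⊛-comm (ev us b) u) ⟩
      π z ws (u ⊛ ev us b)            ≡⟨ π-homogeneous z w ws u (ev us b) (homogeneous v) ⟩
      u ⊛ π (z ℤ.+ w) ws (ev us b)    ≡⟨ cong (u ⊛_) (π-ev vs (z ℤ.+ w) b) ⟩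
      u ⊛ ev us (π (z ℤ.+ w) ws' b)   ≡⟨ ⊛-comm u _ ⟩
      ev us (π (z ℤ.+ w) ws' b) ⊛ u   ∎))
    where open ≡-Reasoning

  c₀-ev : ∀ {n} {ws' : Vec ℤ n} {us} → Variables ws q ws' us → ∀ a → c₀ (ev us a) ≡ c₀ a
  c₀-ev [] (const x) = c₀-ι m x
  c₀-ev {us = u ∷ us} (v ∷ vs) (a +ε b) = begin
    c₀ (ev us a ⊕ ev us b ⊛ u)                 ≡⟨ c₀-⊕ (ev us a) (ev us b ⊛ u) ⟩
    c₀ (ev us a) ℤ.+ c₀ (ev us b ⊛ u)          ≡⟨ cong₂ ℤ._+_ (c₀-ev vs a) (trans (c₀-⊛ (ev us b) u) (cong (c₀ (ev us b) ℤ.*_) (c₀-zero v))) ⟩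
    c₀ a ℤ.+ c₀ (ev us b) ℤ.* + 0              ≡⟨ cong (λ z → c₀ a ℤ.+ z) (ℤₚ.*-zeroʳ (c₀ (ev us b))) ⟩
    c₀ a ℤ.+ + 0                               ≡⟨ ℤₚ.+-identityʳ (c₀ a) ⟩
    c₀ a                                       ∎
    where open ≡-Reasoning

embed : ∀ {n} → K n → K (suc n)
embed a = a +ε 𝟘

ε : ∀ n → Vec (K n) n
ε zero    = []
ε (suc n) = (𝟘 +ε 𝟙) ∷ Vec.map embed (ε n)

ε-variables : ∀ {n} (ws : Vec ℤ n) → Variables ws 𝟙 ws (ε n)
ε-variables [] = []
ε-variables {suc n} (w ∷ ws) = record
    { square = cong₂ _+ε_ (⊛-zeroˡ 𝟘) (trans (cong₂ _⊕_ (⊛-zeroˡ 𝟙) (⊛-zeroʳ 𝟙)) (⊕-identityˡ 𝟘))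
    ; euler = trans (cong₂ _+ε_ (D-ι n _) (trans (cong (_⊕ 𝟙) (D-ι n _)) (⊕-identityˡ 𝟙))) (sym (⊛-identityʳ _))
    ; homogeneous = Supp-𝟘 ws , Supp-ι ws _ (ℤₚ.+-identityʳ w)
    ; c₀-zero = c₀-ι n _ }
  ∷ subst (λ vs → Variables (w ∷ ws) 𝟙 vs (Vec.map embed (ε n))) (Vecₚ.map-id ws)
      (Pointwise.map⁺ lift (ε-variables ws))
  where
  lift : ∀ {w' u} → Variable ws 𝟙 w' u → Variable (w ∷ ws) 𝟙 w' (embed u)
  lift {u = u} v = record
    { square = cong₂ _+ε_ (square v) (solve 1 (λ u → u :* con (+ 0) :+ con (+ 0) :* u := con (+ 0)) refl u)
    ; euler = trans (cong₂ _+ε_ (trans (euler v) (⊛-identityʳ u)) (trans (cong (_⊕ 𝟘) (D-ι n _)) (⊕-identityˡ 𝟘))) (sym (⊛-identityʳ _))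
    ; homogeneous = homogeneous v , Supp-𝟘 ws
    ; c₀-zero = c₀-zero v }

εΣ : ∀ n → K n
εΣ zero    = 𝟘
εΣ (suc n) = εΣ n +ε 𝟙

D-εΣ : ∀ n → D (εΣ n) ≡ εΣ n
D-εΣ zero = refl
D-εΣ (suc n) = cong₂ _+ε_ (D-εΣ n) (trans (cong (_⊕ 𝟙) (D-ι n _)) (⊕-identityˡ 𝟙))

ev-embed : ∀ {m n} (us : Vec (K m) n) a → ev (Vec.map embed us) a ≡ embed (ev us a)
ev-embed [] (const x) = refl
ev-embed (u ∷ us) (a +ε b) = trans (cong₂ (λ p q → p ⊕ q ⊛ embed u) (ev-embed us a) (ev-embed us b))
  (cong₂ _+ε_ refl (solve 2 (λ b u → con (+ 0) :+ (b :* con (+ 0) :+ con (+ 0) :* u) := con (+ 0)) refl (ev us b) u))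

ev-scale-εΣ : ∀ {m n} (c : K m) (us : Vec (K m) n) → ev (Vec.map (c ⊛_) us) (εΣ n) ≡ c ⊛ ev us (εΣ n)
ev-scale-εΣ c [] = sym (⊛-zeroʳ c)
ev-scale-εΣ {n = suc n} c (u ∷ us) = trans
  (cong₂ (λ p q → p ⊕ q ⊛ (c ⊛ u)) (ev-scale-εΣ c us) (trans (ev-ι (Vec.map (c ⊛_) us) _) (sym (ev-ι us _))))
  (solve 4 (λ c a i u → c :* a :+ i :* (c :* u) := c :* (a :+ i :* u)) refl c (ev us (εΣ n)) (ev us 𝟙) u)

ev-ε-εΣ : ∀ n → ev (ε n) (εΣ n) ≡ εΣ n
ev-ε-εΣ zero = refl
ev-ε-εΣ (suc n) = trans (cong₂ (λ p q → p ⊕ q ⊛ (𝟘 +ε 𝟙)) (trans (ev-embed (ε n) (εΣ n)) (cong embed (ev-ε-εΣ n))) (ev-ι (Vec.map embed (ε n)) _))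
  (cong₂ _+ε_ (solve 1 (λ a → a :+ con (+ 1) :* con (+ 0) := a) refl (εΣ n))
    (solve 0 (con (+ 0) :+ (con (+ 1) :* con (+ 1) :+ con (+ 0) :* con (+ 0)) := con (+ 1)) refl))

ε∏ : ∀ n → K n
ε∏ zero    = 𝟙
ε∏ (suc n) = 𝟘 +ε ε∏ n

-- The part `e` may stay unknown: the result is going to be multiplied by the first variable, which
-- annihilates it.
scaleTail : ∀ {m n} (c d : K m) (us : Vec (K m) n) (a : K n) →
  Σ (K m) λ e → ev (Vec.map ((c +ε d) ⊛_) (Vec.map embed us)) a ≡ ev (Vec.map (c ⊛_) us) a +ε e
scaleTail c d [] (const x) = 𝟘 , refl
scaleTail c d (u ∷ us) (a +ε b) with scaleTail c d us a | scaleTail c d us b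
... | e , eq | f , eq' = _ , cong₂ (λ p q → p ⊕ q ⊛ ((c +ε d) ⊛ embed u)) eq eq'

-- Substituting c ε for each variable multiplies the full product by a power of `c`, and against the
-- full product only constant terms matter. The factor `h` is arbitrary because every step of the
-- induction moves one `c` into it.
top-⊛-ev-ε∏ : ∀ {n} (h c : K n) → c₀ h ≡ + 1 → c₀ c ≡ + 1 → top (h ⊛ ev (Vec.map (c ⊛_) (ε n)) (ε∏ n)) ≡ + 1
top-⊛-ev-ε∏ (const x) (const y) refl refl = refl
top-⊛-ev-ε∏ {suc n} (h +ε h') (c +ε c') p q with scaleTail c c' (ε n) (ε∏ n) | ev-𝟘 (Vec.map ((c +ε c') ⊛_) (Vec.map embed (ε n)))
... | e , eq | z = trans (cong top (begin
    (h +ε h') ⊛ (ev us 𝟘 ⊕ ev us (ε∏ n) ⊛ ((c +ε c') ⊛ (𝟘 +ε 𝟙)))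
      ≡⟨ cong₂ (λ r s → (h +ε h') ⊛ (r ⊕ s ⊛ ((c +ε c') ⊛ (𝟘 +ε 𝟙)))) z eq ⟩
    (h +ε h') ⊛ (𝟘 ⊕ (E +ε e) ⊛ ((c +ε c') ⊛ (𝟘 +ε 𝟙)))
      ≡⟨ cong₂ _+ε_ refl (solve 6 (λ h h' c c' E e →
           h :* (con (+ 0) :+ (E :* (c :* con (+ 1) :+ c' :* con (+ 0)) :+ e :* (c :* con (+ 0))))
           :+ h' :* (con (+ 0) :+ E :* (c :* con (+ 0)))
           := (h :* c) :* E) refl h h' c c' E e) ⟩
    (h ⊛ (𝟘 ⊕ E ⊛ (c ⊛ 𝟘))) +ε ((h ⊛ c) ⊛ E) ∎))
  (top-⊛-ev-ε∏ (h ⊛ c) c (trans (c₀-⊛ h c) (cong₂ ℤ._*_ p q)) q)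
  where
  open ≡-Reasoning
  us = Vec.map ((c +ε c') ⊛_) (Vec.map embed (ε n))
  E = ev (Vec.map (c ⊛_) (ε n)) (ε∏ n)

-- Linear functionals that are eigenvectors of the Euler derivation

private module ℤ-group = Algebra.Properties.Group (AbelianGroup.group ℤₚ.+-0-abelianGroup)

record Linear {n} (λ′ : K n → ℤ) : Set where
  field
    additive : ∀ a b → λ′ (a ⊕ b) ≡ λ′ a ℤ.+ λ′ b
    scalar   : ∀ z a → λ′ (ι z ⊛ a) ≡ z ℤ.* λ′ a
open Linear

module _ {n} {λ′ : K (suc n) → ℤ} (lin : Linear λ′) where

  linear-embed : Linear (λ a → λ′ (embed a))
  linear-embed .additive a b = trans (cong λ′ (cong ((a ⊕ b) +ε_) (sym (⊕-identityˡ 𝟘)))) (additive lin _ _)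
  linear-embed .scalar z a = trans
    (cong λ′ (cong ((ι z ⊛ a) +ε_) (solve 2 (λ z a → con (+ 0) := z :* con (+ 0) :+ con (+ 0) :* a) refl (ι z) a)))
    (scalar lin z _)

  linear-ε : Linear (λ b → λ′ (𝟘 +ε b))
  linear-ε .additive a b = trans (cong λ′ (cong (_+ε (a ⊕ b)) (sym (⊕-identityˡ 𝟘)))) (additive lin _ _)
  linear-ε .scalar z a = trans
    (cong λ′ (cong₂ _+ε_ (sym (⊛-zeroʳ (ι z))) (solve 2 (λ z a → z :* a := z :* a :+ con (+ 0) :* con (+ 0)) refl (ι z) a)))
    (scalar lin z _)

  linear-split : ∀ a b → λ′ (a +ε b) ≡ λ′ (embed a) ℤ.+ λ′ (𝟘 +ε b)
  linear-split a b = trans (cong λ′ (cong₂ _+ε_ (sym (⊕-identityʳ a)) (sym (⊕-identityˡ b)))) (additive lin _ _)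

  eigen-embed : ∀ v → (∀ a → λ′ (D a) ≡ + v ℤ.* λ′ a) → ∀ a → λ′ (embed (D a)) ≡ + v ℤ.* λ′ (embed a)
  eigen-embed v h a = trans (cong λ′ (cong (D a +ε_) (sym (trans (cong (_⊕ 𝟘) (D-ι n _)) (⊕-identityˡ 𝟘))))) (h (embed a))

  -- Multiplication by the first variable raises degrees by one, so the eigenvalue on the ε-part is
  -- one smaller.
  eigen-ε : ∀ v → (∀ a → λ′ (D a) ≡ + suc v ℤ.* λ′ a) → ∀ b → λ′ (𝟘 +ε D b) ≡ + v ℤ.* λ′ (𝟘 +ε b)
  eigen-ε v h b = ℤ-group.∙-cancelʳ x _ _ (begin
    λ′ (𝟘 +ε D b) ℤ.+ x          ≡⟨ additive linear-ε (D b) b ⟨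
    λ′ (𝟘 +ε (D b ⊕ b))          ≡⟨ cong (λ z → λ′ (z +ε (D b ⊕ b))) (D-ι n _) ⟨
    λ′ (D (𝟘 +ε b))              ≡⟨ h (𝟘 +ε b) ⟩
    + suc v ℤ.* x                ≡⟨ ℤₚ.suc-* (+ v) x ⟩
    x ℤ.+ + v ℤ.* x              ≡⟨ ℤₚ.+-comm x _ ⟩
    + v ℤ.* x ℤ.+ x              ∎)
    where
    open ≡-Reasoning
    x = λ′ (𝟘 +ε b)

-- Monomials have degree at most n, so the eigenvalues of `D` on `K n` do not exceed n.
eigen-vanish : ∀ {n} v → n < v → (λ′ : K n → ℤ) → Linear λ′ →
               (∀ a → λ′ (D a) ≡ + v ℤ.* λ′ a) → ∀ a → λ′ a ≡ + 0
eigen-vanish (suc v) lt λ′ lin h (const x) = ℤₚ.*-cancelˡ-≡ (+ suc v) _ (+ 0) (begin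
  + suc v ℤ.* λ′ (const x)       ≡⟨ h (const x) ⟨
  λ′ 𝟘                           ≡⟨ scalar lin (+ 0) 𝟘 ⟩
  + 0 ℤ.* λ′ 𝟘                   ≡⟨ ℤₚ.*-zeroˡ (λ′ 𝟘) ⟩
  + 0                            ≡⟨ ℤₚ.*-zeroʳ (+ suc v) ⟨
  + suc v ℤ.* + 0                ∎)
  where open ≡-Reasoning
eigen-vanish (suc v) (s≤s lt) λ′ lin h (a +ε b) = trans (linear-split lin a b) (cong₂ ℤ._+_
  (eigen-vanish (suc v) (ℕₚ.m≤n⇒m≤1+n lt) _ (linear-embed lin) (eigen-embed lin (suc v) h) a)
  (eigen-vanish v lt _ (linear-ε lin) (eigen-ε lin v h) b))

-- The full product is the only monomial of degree n; eigenvalue n forces the functional to vanish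
-- on all others. Lagrange inversion will be an instance of this.
eigen-top : ∀ {n} (λ′ : K n → ℤ) → Linear λ′ → (∀ a → λ′ (D a) ≡ + n ℤ.* λ′ a) →
            ∀ a → λ′ a ≡ top a ℤ.* λ′ (ε∏ n)
eigen-top λ′ lin h (const x) = trans (cong (λ z → λ′ (const z)) (sym (ℤₚ.*-identityʳ x))) (scalar lin x 𝟙)
eigen-top {suc n} λ′ lin h (a +ε b) = trans (linear-split lin a b) (trans (cong₂ ℤ._+_
  (eigen-vanish (suc n) ℕₚ.≤-refl _ (linear-embed lin) (eigen-embed lin (suc n) h) a)
  (eigen-top _ (linear-ε lin) (eigen-ε lin n h) b)) (ℤₚ.+-identityˡ _))

-- The coefficient of εᵢ₁⋯εᵢₘ is (m + j)!, so that T n 0 = 1 / (1 - Σᵢ εᵢ).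
T : ∀ n → ℕ → K n
T zero j    = const (+ (j !))
T (suc n) j = T n j +ε T n (suc j)

1-εΣ : ∀ n → K n
1-εΣ n = 𝟙 ⊕ ⊝ εΣ n

-- Together with `1-εΣ⊛T₀` this identifies `T n j` with j! / (1 - Σ ε)^(j + 1).
1-εΣ⊛T-suc : ∀ n j → 1-εΣ n ⊛ T n (suc j) ≡ ι (+ suc j) ⊛ T n j
1-εΣ⊛T-suc zero j = cong const (trans (ℤₚ.*-identityˡ _) (ℤₚ.pos-* (suc j) (j !)))
1-εΣ⊛T-suc (suc n) j = cong₂ _+ε_ (1-εΣ⊛T-suc n j) (begin
  1-εΣ n ⊛ T n (suc (suc j)) ⊕ (𝟘 ⊕ ⊝ 𝟙) ⊛ T n (suc j)  ≡⟨ cong (_⊕ (𝟘 ⊕ ⊝ 𝟙) ⊛ T n (suc j)) (1-εΣ⊛T-suc n (suc j)) ⟩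
  ι (+ suc (suc j)) ⊛ T n (suc j) ⊕ (𝟘 ⊕ ⊝ 𝟙) ⊛ T n (suc j)
    ≡⟨ cong (λ z → z ⊛ T n (suc j) ⊕ (𝟘 ⊕ ⊝ 𝟙) ⊛ T n (suc j)) (ι-+ (+ 1) (+ suc j)) ⟩
  (𝟙 ⊕ ι (+ suc j)) ⊛ T n (suc j) ⊕ (𝟘 ⊕ ⊝ 𝟙) ⊛ T n (suc j)
    ≡⟨ solve 3 (λ j t s → (con (+ 1) :+ j) :* t :+ (con (+ 0) :- con (+ 1)) :* t := j :* t :+ con (+ 0) :* s) refl (ι (+ suc j)) (T n (suc j)) (T n j) ⟩
  ι (+ suc j) ⊛ T n (suc j) ⊕ 𝟘 ⊛ T n j ∎)
  where open ≡-Reasoning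

1-εΣ⊛T₀ : ∀ n → 1-εΣ n ⊛ T n 0 ≡ 𝟙
1-εΣ⊛T₀ zero = refl
1-εΣ⊛T₀ (suc n) = cong₂ _+ε_ (1-εΣ⊛T₀ n) (trans (cong (_⊕ (𝟘 ⊕ ⊝ 𝟙) ⊛ T n 0) (1-εΣ⊛T-suc n 0))
  (solve 1 (λ t → con (+ 1) :* t :+ (con (+ 0) :- con (+ 1)) :* t := con (+ 0)) refl (T n 0)))

-- In degree m this is (m + j + 1) (m + j)! = (m + j + 1)!.
D-T : ∀ n j → D (T n j) ⊕ ι (+ suc j) ⊛ T n j ≡ T n (suc j)
D-T zero j = cong const (trans (ℤₚ.+-identityˡ _) (sym (ℤₚ.pos-* (suc j) (j !))))
D-T (suc n) j = cong₂ _+ε_ (D-T n j) (begin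
  (D t' ⊕ t') ⊕ (ι (+ suc j) ⊛ t' ⊕ 𝟘 ⊛ T n j)
    ≡⟨ solve 4 (λ d t s j → (d :+ t) :+ (j :* t :+ con (+ 0) :* s) := d :+ (con (+ 1) :+ j) :* t) refl (D t') t' (T n j) (ι (+ suc j)) ⟩
  D t' ⊕ (𝟙 ⊕ ι (+ suc j)) ⊛ t'   ≡⟨ cong (λ z → D t' ⊕ z ⊛ t') (ι-+ (+ 1) (+ suc j)) ⟨
  D t' ⊕ ι (+ suc (suc j)) ⊛ t'   ≡⟨ D-T n (suc j) ⟩
  T n (suc (suc j))               ∎)
  where
  open ≡-Reasoning
  t' = T n (suc j)

-- - log (1 - Σᵢ εᵢ): the coefficient of εᵢ₁⋯εᵢₘ is (m - 1)!.
L : ∀ n → K n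
L zero    = 𝟘
L (suc n) = L n +ε T n 0

𝟙⊕D-L : ∀ n → 𝟙 ⊕ D (L n) ≡ T n 0
𝟙⊕D-L zero = refl
𝟙⊕D-L (suc n) = cong₂ _+ε_ (𝟙⊕D-L n) (trans
  (solve 2 (λ d t → con (+ 0) :+ (d :+ t) := d :+ con (+ 1) :* t) refl (D (T n 0)) (T n 0)) (D-T n 0))

-- Wiener–Hopf factorisation and Lagrange inversion

-- f and g play the role of the factors of the Wiener–Hopf factorisation
-- C - Σ εᵢ = (1 - f)(1 - g), where f has positive, g negative and C = 1 + Z zero weight.
module WienerHopf {n} (ws : Vec ℤ n) (f g : K n)
  (f>0 : Supp (λ z → + 0 ℤ.< z) ws f) (g<0 : Supp (λ z → z ℤ.< + 0) ws g)
  (factorisation : f ⊕ g ⊕ π (+ 0) ws (f ⊛ g) ≡ εΣ n ⊕ f ⊛ g) where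

  open ≡-Reasoning

  π₀ : K n → K n
  π₀ = π (+ 0) ws

  Z C N⁺ N⁻ B⁺ B⁻ R c q : K n
  Z  = π₀ (f ⊛ g)
  C  = 𝟙 ⊕ Z
  N⁺ = 𝟙 ⊕ ⊝ f
  N⁻ = 𝟙 ⊕ ⊝ g
  B⁺ = inv N⁺
  B⁻ = inv N⁻
  R  = B⁺ ⊛ B⁻
  c  = inv C
  -- This is D u / u for u = ε / C, the factor that the chain rule `D-ev` produces for the
  -- substitution `φ`.
  q  = 𝟙 ⊕ ⊝ (c ⊛ D C)

  c₀-1- : ∀ (a : K n) → c₀ a ≡ + 0 → c₀ (𝟙 ⊕ ⊝ a) ≡ + 1
  c₀-1- a e = trans (c₀-⊕ {n} 𝟙 (⊝ a)) (cong₂ ℤ._+_ (c₀-ι n (+ 1)) (trans (c₀-⊝ a) (cong ℤ.-_ e)))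

  N⁺⊛B⁺ : N⁺ ⊛ B⁺ ≡ 𝟙
  N⁺⊛B⁺ = inv-inverse N⁺ (c₀-1- f (Supp-c₀ ws f (ℤₚ.<-irrefl refl) f>0))

  N⁻⊛B⁻ : N⁻ ⊛ B⁻ ≡ 𝟙
  N⁻⊛B⁻ = inv-inverse N⁻ (c₀-1- g (Supp-c₀ ws g (ℤₚ.<-irrefl refl) g<0))

  Supp-Z : Supp (_≡ + 0) ws Z
  Supp-Z = Supp-mono ws Z (λ x e → trans (sym (ℤₚ.+-identityˡ x)) e) (Supp-π (+ 0) ws (f ⊛ g))

  Supp-C : Supp (_≡ + 0) ws C
  Supp-C = Supp-⊕ ws 𝟙 Z (Supp-ι ws (+ 1) refl) Supp-Z

  Supp-c : Supp (_≡ + 0) ws c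
  Supp-c = Supp-inv ws C refl (λ { _ _ refl refl → refl }) Supp-C

  c₀-C : c₀ C ≡ + 1
  c₀-C = trans (c₀-⊕ 𝟙 Z) (cong₂ ℤ._+_ (c₀-ι n (+ 1)) (begin
    c₀ Z                    ≡⟨ c₀-Z ⟩
    + 0                     ∎))
    where
    c₀-π₀ : ∀ {m} (ws : Vec ℤ m) a → c₀ a ≡ + 0 → c₀ (π (+ 0) ws a) ≡ + 0
    c₀-π₀ [] (const x) e = e
    c₀-π₀ (w ∷ ws) (a +ε b) e = c₀-π₀ ws a e
    c₀-Z : c₀ Z ≡ + 0
    c₀-Z = c₀-π₀ ws (f ⊛ g) (trans (c₀-⊛ f g) (cong (ℤ._* c₀ g) (Supp-c₀ ws f (ℤₚ.<-irrefl refl) f>0)))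

  C⊛c : C ⊛ c ≡ 𝟙
  C⊛c = inv-inverse C c₀-C

  c₀-c : c₀ c ≡ + 1
  c₀-c = c₀-inv C

  q⊛C : q ⊛ C ≡ C ⊕ ⊝ D C
  q⊛C = begin
    (𝟙 ⊕ ⊝ (c ⊛ D C)) ⊛ C      ≡⟨ solve 3 (λ C c d → (con (+ 1) :- c :* d) :* C := C :- C :* c :* d) refl C c (D C) ⟩
    C ⊕ ⊝ (C ⊛ c ⊛ D C)        ≡⟨ cong (λ z → C ⊕ ⊝ (z ⊛ D C)) C⊛c ⟩
    C ⊕ ⊝ (𝟙 ⊛ D C)            ≡⟨ cong (λ z → C ⊕ ⊝ z) (⊛-identityˡ (D C)) ⟩
    C ⊕ ⊝ D C                  ∎

  C≡εΣ⊕N⁺⊛N⁻ : C ≡ εΣ n ⊕ N⁺ ⊛ N⁻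
  C≡εΣ⊕N⁺⊛N⁻ = begin
    𝟙 ⊕ Z
      ≡⟨ solve 3 (λ f g Z → con (+ 1) :+ Z := con (+ 1) :- f :- g :+ (f :+ g :+ Z)) refl f g Z ⟩
    𝟙 ⊕ ⊝ f ⊕ ⊝ g ⊕ (f ⊕ g ⊕ Z)
      ≡⟨ cong (𝟙 ⊕ ⊝ f ⊕ ⊝ g ⊕_) factorisation ⟩
    𝟙 ⊕ ⊝ f ⊕ ⊝ g ⊕ (εΣ n ⊕ f ⊛ g)
      ≡⟨ solve 3 (λ f g e → con (+ 1) :- f :- g :+ (e :+ f :* g) := e :+ (con (+ 1) :- f) :* (con (+ 1) :- g)) refl f g (εΣ n) ⟩
    εΣ n ⊕ N⁺ ⊛ N⁻ ∎

  R-inverse : (C ⊕ ⊝ εΣ n) ⊛ R ≡ 𝟙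
  R-inverse = begin
    (C ⊕ ⊝ εΣ n) ⊛ R                        ≡⟨ cong (λ z → (z ⊕ ⊝ εΣ n) ⊛ R) C≡εΣ⊕N⁺⊛N⁻ ⟩
    (εΣ n ⊕ N⁺ ⊛ N⁻ ⊕ ⊝ εΣ n) ⊛ (B⁺ ⊛ B⁻)
      ≡⟨ solve 5 (λ e a b a' b' → (e :+ a :* b :- e) :* (a' :* b') := (a :* a') :* (b :* b')) refl (εΣ n) N⁺ N⁻ B⁺ B⁻ ⟩
    (N⁺ ⊛ B⁺) ⊛ (N⁻ ⊛ B⁻)                   ≡⟨ cong₂ _⊛_ N⁺⊛B⁺ N⁻⊛B⁻ ⟩
    𝟙 ⊛ 𝟙                                   ≡⟨ ⊛-identityˡ 𝟙 ⟩
    𝟙                                       ∎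

  -- The two copies of `εΣ n` cancel, and `R` turns what remains into logarithmic derivatives.
  [C-DC]⊛R : (C ⊕ ⊝ D C) ⊛ R ≡ 𝟙 ⊕ (⊝ (D N⁺ ⊛ B⁺) ⊕ ⊝ (D N⁻ ⊛ B⁻))
  [C-DC]⊛R = begin
    (C ⊕ ⊝ D C) ⊛ R
      ≡⟨ cong₂ (λ x y → (x ⊕ ⊝ y) ⊛ R) C≡εΣ⊕N⁺⊛N⁻ (trans (cong D C≡εΣ⊕N⁺⊛N⁻)
           (trans (D-⊕ (εΣ n) (N⁺ ⊛ N⁻)) (cong₂ _⊕_ (D-εΣ n) (D-⊛ N⁺ N⁻)))) ⟩
    (εΣ n ⊕ N⁺ ⊛ N⁻ ⊕ ⊝ (εΣ n ⊕ (D N⁺ ⊛ N⁻ ⊕ N⁺ ⊛ D N⁻))) ⊛ (B⁺ ⊛ B⁻)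
      ≡⟨ solve 7 (λ e a b da db a' b' →
           (e :+ a :* b :- (e :+ (da :* b :+ a :* db))) :* (a' :* b')
           := (a :* a') :* (b :* b') :+ (:- (da :* a' :* (b :* b')) :+ :- (db :* b' :* (a :* a')))) refl
           (εΣ n) N⁺ N⁻ (D N⁺) (D N⁻) B⁺ B⁻ ⟩
    (N⁺ ⊛ B⁺) ⊛ (N⁻ ⊛ B⁻) ⊕ (⊝ (D N⁺ ⊛ B⁺ ⊛ (N⁻ ⊛ B⁻)) ⊕ ⊝ (D N⁻ ⊛ B⁻ ⊛ (N⁺ ⊛ B⁺)))
      ≡⟨ cong₂ (λ x y → x ⊛ y ⊕ (⊝ (D N⁺ ⊛ B⁺ ⊛ y) ⊕ ⊝ (D N⁻ ⊛ B⁻ ⊛ x))) N⁺⊛B⁺ N⁻⊛B⁻ ⟩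
    𝟙 ⊛ 𝟙 ⊕ (⊝ (D N⁺ ⊛ B⁺ ⊛ 𝟙) ⊕ ⊝ (D N⁻ ⊛ B⁻ ⊛ 𝟙))
      ≡⟨ solve 2 (λ x y → con (+ 1) :* con (+ 1) :+ (:- (x :* con (+ 1)) :+ :- (y :* con (+ 1))) := con (+ 1) :+ (:- x :+ :- y)) refl
           (D N⁺ ⊛ B⁺) (D N⁻ ⊛ B⁻) ⟩
    𝟙 ⊕ (⊝ (D N⁺ ⊛ B⁺) ⊕ ⊝ (D N⁻ ⊛ B⁻)) ∎

  D-1- : ∀ a → D (𝟙 ⊕ ⊝ a) ≡ ⊝ D a
  D-1- a = begin
    D (𝟙 ⊕ ⊝ a)           ≡⟨ cong (λ z → D (𝟙 ⊕ z)) (solve 1 (λ a → :- a := con (ℤ.- + 1) :* a) refl a) ⟩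
    D (𝟙 ⊕ ι (ℤ.- + 1) ⊛ a) ≡⟨ trans (D-⊕ 𝟙 (ι (ℤ.- + 1) ⊛ a)) (cong₂ _⊕_ (D-ι n (+ 1)) (D-ι⊛ (ℤ.- + 1) a)) ⟩
    𝟘 ⊕ ι (ℤ.- + 1) ⊛ D a ≡⟨ solve 1 (λ a → con (+ 0) :+ con (ℤ.- + 1) :* a := :- a) refl (D a) ⟩
    ⊝ D a                 ∎

  -- The derivative has only positive weights and the inverse of `N⁺` only nonnegative ones, so
  -- weight 0 cannot occur in the product.
  π₀-term⁺ : π₀ (⊝ (D N⁺ ⊛ B⁺)) ≡ 𝟘
  π₀-term⁺ = π-disjoint {P = λ z → + 0 ℤ.< z} (+ 0) ws _ (λ x 0<x e → ℤₚ.<-irrefl (sym (trans (sym (ℤₚ.+-identityˡ x)) e)) 0<x)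
    (Supp-⊝ ws _ (Supp-⊛ {Q = λ z → + 0 ℤ.≤ z} ws (D N⁺) B⁺ (λ x y p q → ℤₚ.+-mono-<-≤ p q)
      (subst (Supp _ ws) (sym (D-1- f)) (Supp-⊝ ws (D f) (Supp-D ws f f>0)))
      (Supp-inv ws N⁺ ℤₚ.≤-refl (λ x y → ℤₚ.+-mono-≤)
        (Supp-⊕ ws 𝟙 (⊝ f) (Supp-ι ws (+ 1) ℤₚ.≤-refl) (Supp-⊝ ws f (Supp-mono ws f (λ z → ℤₚ.<⇒≤) f>0))))))

  π₀-term⁻ : π₀ (⊝ (D N⁻ ⊛ B⁻)) ≡ 𝟘
  π₀-term⁻ = π-disjoint {P = λ z → z ℤ.< + 0} (+ 0) ws _ (λ x x<0 e → ℤₚ.<-irrefl (trans (sym (ℤₚ.+-identityˡ x)) e) x<0)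
    (Supp-⊝ ws _ (Supp-⊛ {Q = λ z → z ℤ.≤ + 0} ws (D N⁻) B⁻ (λ x y p q → ℤₚ.+-mono-<-≤ p q)
      (subst (Supp _ ws) (sym (D-1- g)) (Supp-⊝ ws (D g) (Supp-D ws g g<0)))
      (Supp-inv ws N⁻ ℤₚ.≤-refl (λ x y → ℤₚ.+-mono-≤)
        (Supp-⊕ ws 𝟙 (⊝ g) (Supp-ι ws (+ 1) ℤₚ.≤-refl) (Supp-⊝ ws g (Supp-mono ws g (λ z → ℤₚ.<⇒≤) g<0))))))

  π₀-homogeneous : ∀ a b → Supp (_≡ + 0) ws a → π₀ (a ⊛ b) ≡ a ⊛ π₀ b
  π₀-homogeneous = π-homogeneous (+ 0) (+ 0) ws

  -- `C` and its derivative have weight 0 and can be pulled out of the projection.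
  [C-DC]⊛π₀R : (C ⊕ ⊝ D C) ⊛ π₀ R ≡ 𝟙
  [C-DC]⊛π₀R = begin
    (C ⊕ ⊝ D C) ⊛ π₀ R                                     ≡⟨ π₀-homogeneous _ R (Supp-⊕ ws C _ Supp-C (Supp-⊝ ws _ (Supp-D ws C Supp-C))) ⟨
    π₀ ((C ⊕ ⊝ D C) ⊛ R)                                   ≡⟨ cong π₀ [C-DC]⊛R ⟩
    π₀ (𝟙 ⊕ (⊝ (D N⁺ ⊛ B⁺) ⊕ ⊝ (D N⁻ ⊛ B⁻)))              ≡⟨ trans (π-⊕ (+ 0) ws 𝟙 _) (cong (π₀ 𝟙 ⊕_) (π-⊕ (+ 0) ws (⊝ (D N⁺ ⊛ B⁺)) (⊝ (D N⁻ ⊛ B⁻)))) ⟩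
    π₀ 𝟙 ⊕ (π₀ (⊝ (D N⁺ ⊛ B⁺)) ⊕ π₀ (⊝ (D N⁻ ⊛ B⁻)))      ≡⟨ cong₂ _⊕_ (π-ι ws (+ 1)) (trans (cong₂ _⊕_ π₀-term⁺ π₀-term⁻) (⊕-identityˡ 𝟘)) ⟩
    𝟙 ⊕ 𝟘                                                  ≡⟨ ⊕-identityʳ 𝟙 ⟩
    𝟙                                                      ∎

  us : Vec (K n) n
  us = Vec.map (c ⊛_) (ε n)

  -- The substitution εᵢ ↦ εᵢ / C, compositional inverse of εᵢ ↦ εᵢ exp (π₀ L).
  φ : K n → K n
  φ = ev us

  D-c : D c ≡ c ⊛ q ⊕ ⊝ c
  D-c = begin
    D c                                              ≡⟨ solve 1 (λ x → x := con (+ 1) :* x) refl (D c) ⟩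
    𝟙 ⊛ D c                                          ≡⟨ cong (_⊛ D c) C⊛c ⟨
    C ⊛ c ⊛ D c                                      ≡⟨ solve 4 (λ C c C' c' → C :* c :* c' := c :* (C' :* c :+ C :* c') :- c :* c :* C') refl C c (D C) (D c) ⟩
    c ⊛ (D C ⊛ c ⊕ C ⊛ D c) ⊕ ⊝ (c ⊛ c ⊛ D C)        ≡⟨ cong (λ z → c ⊛ z ⊕ ⊝ (c ⊛ c ⊛ D C)) (trans (sym (D-⊛ C c)) (trans (cong D C⊛c) (D-ι n (+ 1)))) ⟩
    c ⊛ 𝟘 ⊕ ⊝ (c ⊛ c ⊛ D C)                          ≡⟨ solve 2 (λ c C' → c :* con (+ 0) :- c :* c :* C' := c :* (con (+ 1) :- c :* C') :- c) refl c (D C) ⟩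
    c ⊛ q ⊕ ⊝ c                                      ∎

  us-variables : Variables ws q ws us
  us-variables = subst (λ vs → Variables ws q vs us) (Vecₚ.map-id ws) (Pointwise.map⁺ scale (ε-variables ws))
    where
    scale : ∀ {w u} → Variable ws 𝟙 w u → Variable ws q w (c ⊛ u)
    scale {w} {u} v = record
      { square = begin
          (c ⊛ u) ⊛ (c ⊛ u)   ≡⟨ solve 2 (λ c u → (c :* u) :* (c :* u) := c :* c :* (u :* u)) refl c u ⟩
          c ⊛ c ⊛ (u ⊛ u)     ≡⟨ cong (c ⊛ c ⊛_) (square v) ⟩
          c ⊛ c ⊛ 𝟘           ≡⟨ ⊛-zeroʳ (c ⊛ c) ⟩
          𝟘                   ∎
      ; euler = begin
          D (c ⊛ u)                                ≡⟨ D-⊛ c u ⟩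
          D c ⊛ u ⊕ c ⊛ D u                        ≡⟨ cong₂ (λ x y → x ⊛ u ⊕ c ⊛ y) D-c (trans (euler v) (⊛-identityʳ u)) ⟩
          (c ⊛ q ⊕ ⊝ c) ⊛ u ⊕ c ⊛ u                ≡⟨ solve 3 (λ c q u → (c :* q :- c) :* u :+ c :* u := c :* u :* q) refl c q u ⟩
          (c ⊛ u) ⊛ q                              ∎
      ; homogeneous = Supp-⊛ ws c u (λ { x y refl e → trans (ℤₚ.+-identityˡ y) e }) Supp-c (homogeneous v)
      ; c₀-zero = trans (c₀-⊛ c u) (trans (cong (λ z → c₀ c ℤ.* z) (c₀-zero v)) (ℤₚ.*-zeroʳ (c₀ c))) }

  -- `φ` sends 1 / (1 - Σ ε) to 1 / (1 - Σ ε / C), which is C / (C - Σ ε).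
  φ-T₀ : φ (T n 0) ≡ C ⊛ R
  φ-T₀ = begin
    φ (T n 0)                                    ≡⟨ solve 1 (λ x → x := x :* con (+ 1)) refl (φ (T n 0)) ⟩
    φ (T n 0) ⊛ 𝟙                                ≡⟨ cong (φ (T n 0) ⊛_) inverse ⟨
    φ (T n 0) ⊛ ((𝟙 ⊕ ⊝ (c ⊛ εΣ n)) ⊛ (C ⊛ R))   ≡⟨ solve 3 (λ t x y → t :* (x :* y) := (x :* t) :* y) refl (φ (T n 0)) (𝟙 ⊕ ⊝ (c ⊛ εΣ n)) (C ⊛ R) ⟩
    ((𝟙 ⊕ ⊝ (c ⊛ εΣ n)) ⊛ φ (T n 0)) ⊛ (C ⊛ R)   ≡⟨ cong (λ z → (z ⊛ φ (T n 0)) ⊛ (C ⊛ R)) φ-1-εΣ ⟨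
    (φ (1-εΣ n) ⊛ φ (T n 0)) ⊛ (C ⊛ R)           ≡⟨ cong (_⊛ (C ⊛ R)) (ev-⊛ us-variables (1-εΣ n) (T n 0)) ⟨
    φ (1-εΣ n ⊛ T n 0) ⊛ (C ⊛ R)                 ≡⟨ cong (λ z → φ z ⊛ (C ⊛ R)) (1-εΣ⊛T₀ n) ⟩
    φ 𝟙 ⊛ (C ⊛ R)                                ≡⟨ cong (_⊛ (C ⊛ R)) (ev-ι us (+ 1)) ⟩
    𝟙 ⊛ (C ⊛ R)                                  ≡⟨ ⊛-identityˡ (C ⊛ R) ⟩
    C ⊛ R                                        ∎
    where
    φ-εΣ : φ (εΣ n) ≡ c ⊛ εΣ n
    φ-εΣ = trans (ev-scale-εΣ c (ε n)) (cong (c ⊛_) (ev-ε-εΣ n))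
    φ-1-εΣ : φ (1-εΣ n) ≡ 𝟙 ⊕ ⊝ (c ⊛ εΣ n)
    φ-1-εΣ = begin
      φ (𝟙 ⊕ ⊝ εΣ n)                       ≡⟨ cong (λ z → φ (𝟙 ⊕ z)) (solve 1 (λ a → :- a := con (ℤ.- + 1) :* a) refl (εΣ n)) ⟩
      φ (𝟙 ⊕ ι (ℤ.- + 1) ⊛ εΣ n)           ≡⟨ trans (ev-⊕ us 𝟙 _) (cong₂ _⊕_ (ev-ι us (+ 1)) (trans (ev-⊛ us-variables (ι (ℤ.- + 1)) (εΣ n)) (cong₂ _⊛_ (ev-ι us (ℤ.- + 1)) φ-εΣ))) ⟩
      𝟙 ⊕ ι (ℤ.- + 1) ⊛ (c ⊛ εΣ n)         ≡⟨ solve 1 (λ a → con (+ 1) :+ con (ℤ.- + 1) :* a := con (+ 1) :- a) refl (c ⊛ εΣ n) ⟩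
      𝟙 ⊕ ⊝ (c ⊛ εΣ n)                     ∎
    inverse : (𝟙 ⊕ ⊝ (c ⊛ εΣ n)) ⊛ (C ⊛ R) ≡ 𝟙
    inverse = begin
      (𝟙 ⊕ ⊝ (c ⊛ εΣ n)) ⊛ (C ⊛ R)         ≡⟨ solve 4 (λ C c e R → (con (+ 1) :- c :* e) :* (C :* R) := (C :- C :* c :* e) :* R) refl C c (εΣ n) R ⟩
      (C ⊕ ⊝ (C ⊛ c ⊛ εΣ n)) ⊛ R           ≡⟨ cong (λ z → (C ⊕ ⊝ (z ⊛ εΣ n)) ⊛ R) C⊛c ⟩
      (C ⊕ ⊝ (𝟙 ⊛ εΣ n)) ⊛ R               ≡⟨ cong (λ z → (C ⊕ ⊝ z) ⊛ R) (⊛-identityˡ (εΣ n)) ⟩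
      (C ⊕ ⊝ εΣ n) ⊛ R                     ≡⟨ R-inverse ⟩
      𝟙                                    ∎

  B : K n
  B = π₀ (L n)

  𝟙⊕D-B : 𝟙 ⊕ D B ≡ π₀ (T n 0)
  𝟙⊕D-B = begin
    𝟙 ⊕ D B                 ≡⟨ cong₂ _⊕_ (π-ι ws (+ 1)) (π-D (+ 0) ws (L n)) ⟨
    π₀ 𝟙 ⊕ π₀ (D (L n))     ≡⟨ π-⊕ (+ 0) ws 𝟙 (D (L n)) ⟨
    π₀ (𝟙 ⊕ D (L n))        ≡⟨ cong π₀ (𝟙⊕D-L n) ⟩
    π₀ (T n 0)              ∎

  -- By the chain rule the left side is D (φ B), and the right side is D C / C: in differential
  -- form, `φ B` is the logarithm of `C`. The proof computes φ (1 + D B) as `C ⊛ π₀ R` and uses that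
  -- `q ⊛ C` is `C - D C`.
  φ[D-B]⊛q : φ (D B) ⊛ q ≡ 𝟙 ⊕ ⊝ q
  φ[D-B]⊛q = begin
    φ (D B) ⊛ q                          ≡⟨ solve 2 (λ b q → b :* q := q :* (con (+ 1) :+ b) :- q) refl (φ (D B)) q ⟩
    q ⊛ (𝟙 ⊕ φ (D B)) ⊕ ⊝ q              ≡⟨ cong (λ z → q ⊛ (z ⊕ φ (D B)) ⊕ ⊝ q) (ev-ι us (+ 1)) ⟨
    q ⊛ (φ 𝟙 ⊕ φ (D B)) ⊕ ⊝ q            ≡⟨ cong (λ z → q ⊛ z ⊕ ⊝ q) (ev-⊕ us 𝟙 (D B)) ⟨
    q ⊛ φ (𝟙 ⊕ D B) ⊕ ⊝ q                ≡⟨ cong (λ z → q ⊛ φ z ⊕ ⊝ q) 𝟙⊕D-B ⟩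
    q ⊛ φ (π₀ (T n 0)) ⊕ ⊝ q             ≡⟨ cong (λ z → q ⊛ z ⊕ ⊝ q) (π-ev us-variables (+ 0) (T n 0)) ⟨
    q ⊛ π₀ (φ (T n 0)) ⊕ ⊝ q             ≡⟨ cong (λ z → q ⊛ π₀ z ⊕ ⊝ q) φ-T₀ ⟩
    q ⊛ π₀ (C ⊛ R) ⊕ ⊝ q                 ≡⟨ cong (λ z → q ⊛ z ⊕ ⊝ q) (π₀-homogeneous C R Supp-C) ⟩
    q ⊛ (C ⊛ π₀ R) ⊕ ⊝ q                 ≡⟨ cong (_⊕ ⊝ q) (⊛-assoc q C (π₀ R)) ⟨
    q ⊛ C ⊛ π₀ R ⊕ ⊝ q                   ≡⟨ cong (λ z → z ⊛ π₀ R ⊕ ⊝ q) q⊛C ⟩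
    (C ⊕ ⊝ D C) ⊛ π₀ R ⊕ ⊝ q             ≡⟨ cong (_⊕ ⊝ q) [C-DC]⊛π₀R ⟩
    𝟙 ⊕ ⊝ q                              ∎

  D-C^ : ∀ k → D (C ^ᴷ k) ≡ ι (+ k) ⊛ (C ^ᴷ k ⊛ (𝟙 ⊕ ⊝ q))
  D-C^ k = begin
    D (C ^ᴷ k)                              ≡⟨ solve 1 (λ x → x := con (+ 1) :* x) refl (D (C ^ᴷ k)) ⟩
    𝟙 ⊛ D (C ^ᴷ k)                          ≡⟨ cong (_⊛ D (C ^ᴷ k)) C⊛c ⟨
    C ⊛ c ⊛ D (C ^ᴷ k)                      ≡⟨ solve 3 (λ C c d → C :* c :* d := c :* (d :* C)) refl C c (D (C ^ᴷ k)) ⟩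
    c ⊛ (D (C ^ᴷ k) ⊛ C)                    ≡⟨ cong (c ⊛_) (D-^ C k) ⟩
    c ⊛ (ι (+ k) ⊛ (C ^ᴷ k ⊛ D C))          ≡⟨ solve 4 (λ c k p d → c :* (k :* (p :* d)) := k :* (p :* (con (+ 1) :- (con (+ 1) :- c :* d)))) refl c (ι (+ k)) (C ^ᴷ k) (D C) ⟩
    ι (+ k) ⊛ (C ^ᴷ k ⊛ (𝟙 ⊕ ⊝ q))          ∎

  G : ℕ → K n
  G k = exp (ι (ℤ.- + k) ⊛ B)

  D-φG : ∀ k → D (φ (G k)) ≡ ι (ℤ.- + k) ⊛ (φ (G k) ⊛ (𝟙 ⊕ ⊝ q))
  D-φG k = begin
    D (φ (G k))                                    ≡⟨ D-ev us-variables (G k) ⟩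
    φ (D (G k)) ⊛ q                                ≡⟨ cong (λ z → φ z ⊛ q) (trans (D-exp (ι (ℤ.- + k) ⊛ B)) (cong (G k ⊛_) (D-ι⊛ (ℤ.- + k) B))) ⟩
    φ (G k ⊛ (ι (ℤ.- + k) ⊛ D B)) ⊛ q              ≡⟨ cong (_⊛ q) (trans (ev-⊛ us-variables (G k) _) (cong (φ (G k) ⊛_)
                                                       (trans (ev-⊛ us-variables (ι (ℤ.- + k)) (D B)) (cong (_⊛ φ (D B)) (ev-ι us (ℤ.- + k)))))) ⟩
    φ (G k) ⊛ (ι (ℤ.- + k) ⊛ φ (D B)) ⊛ q          ≡⟨ solve 4 (λ g k b q → g :* (k :* b) :* q := k :* (g :* (b :* q))) refl (φ (G k)) (ι (ℤ.- + k)) (φ (D B)) q ⟩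
    ι (ℤ.- + k) ⊛ (φ (G k) ⊛ (φ (D B) ⊛ q))        ≡⟨ cong (λ z → ι (ℤ.- + k) ⊛ (φ (G k) ⊛ z)) φ[D-B]⊛q ⟩
    ι (ℤ.- + k) ⊛ (φ (G k) ⊛ (𝟙 ⊕ ⊝ q))            ∎

  -- `φ` sends exp B to `C`, here raised to the power -k. The two logarithmic derivatives are
  -- opposite, so the product is constant.
  φG⊛C^ : ∀ k → φ (G k) ⊛ C ^ᴷ k ≡ 𝟙
  φG⊛C^ k = trans (D≡𝟘⇒≡ι (φ (G k) ⊛ C ^ᴷ k) D-vanishes) (cong ι (trans (c₀-⊛ (φ (G k)) (C ^ᴷ k))
      (cong₂ ℤ._*_ (trans (c₀-ev us-variables (G k)) (c₀-exp (ι (ℤ.- + k) ⊛ B))) (c₀-^ C k c₀-C))))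
    where
    D-vanishes : D (φ (G k) ⊛ C ^ᴷ k) ≡ 𝟘
    D-vanishes = begin
      D (φ (G k) ⊛ C ^ᴷ k)                               ≡⟨ D-⊛ (φ (G k)) (C ^ᴷ k) ⟩
      D (φ (G k)) ⊛ C ^ᴷ k ⊕ φ (G k) ⊛ D (C ^ᴷ k)        ≡⟨ cong₂ (λ x y → x ⊛ C ^ᴷ k ⊕ φ (G k) ⊛ y) (D-φG k) (D-C^ k) ⟩
      ι (ℤ.- + k) ⊛ (φ (G k) ⊛ (𝟙 ⊕ ⊝ q)) ⊛ C ^ᴷ k ⊕ φ (G k) ⊛ (ι (+ k) ⊛ (C ^ᴷ k ⊛ (𝟙 ⊕ ⊝ q)))
        ≡⟨ cong (λ z → z ⊛ (φ (G k) ⊛ (𝟙 ⊕ ⊝ q)) ⊛ C ^ᴷ k ⊕ φ (G k) ⊛ (ι (+ k) ⊛ (C ^ᴷ k ⊛ (𝟙 ⊕ ⊝ q)))) (ι-neg (+ k)) ⟩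
      ⊝ ι (+ k) ⊛ (φ (G k) ⊛ (𝟙 ⊕ ⊝ q)) ⊛ C ^ᴷ k ⊕ φ (G k) ⊛ (ι (+ k) ⊛ (C ^ᴷ k ⊛ (𝟙 ⊕ ⊝ q)))
        ≡⟨ solve 4 (λ k g r p → (:- k) :* (g :* r) :* p :+ g :* (k :* (p :* r)) := con (+ 0)) refl (ι (+ k)) (φ (G k)) (𝟙 ⊕ ⊝ q) (C ^ᴷ k) ⟩
      𝟘 ∎

  -- Lagrange inversion: the functional H ↦ [V] q Cⁿ φ(H) extracts the top coefficient of H.
  residue : K n → ℤ
  residue H = top (q ⊛ C ^ᴷ n ⊛ φ H)

  residue-linear : Linear residue
  residue-linear = record
    { additive = λ a b → trans (cong top (trans (cong (q ⊛ C ^ᴷ n ⊛_) (ev-⊕ us a b)) (⊛-distribˡ (q ⊛ C ^ᴷ n) (φ a) (φ b)))) (top-⊕ (q ⊛ C ^ᴷ n ⊛ φ a) (q ⊛ C ^ᴷ n ⊛ φ b))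
    ; scalar = λ z a → trans (cong top (begin
        q ⊛ C ^ᴷ n ⊛ φ (ι z ⊛ a)       ≡⟨ cong (q ⊛ C ^ᴷ n ⊛_) (trans (ev-⊛ us-variables (ι z) a) (cong (_⊛ φ a) (ev-ι us z))) ⟩
        q ⊛ C ^ᴷ n ⊛ (ι z ⊛ φ a)       ≡⟨ solve 3 (λ x z a → x :* (z :* a) := z :* (x :* a)) refl (q ⊛ C ^ᴷ n) (ι z) (φ a) ⟩
        ι z ⊛ (q ⊛ C ^ᴷ n ⊛ φ a)       ∎)) (top-ι⊛ z (q ⊛ C ^ᴷ n ⊛ φ a)) }

  -- Compute the top coefficient of the derivative of Cⁿ φ(H) in two ways. On it `D` is
  -- multiplication by n; the product rule gives `residue (D H)`, minus n times `residue H`, plus n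
  -- times the top coefficient of Cⁿ φ(H). The exponent n is chosen so that the last term cancels.
  residue-eigen : ∀ H → residue (D H) ≡ + n ℤ.* residue H
  residue-eigen H = begin
    top (q ⊛ P ⊛ φ (D H))
      ≡⟨ cong top (solve 5 (λ q P h h' k →
           q :* P :* h' := (k :* (P :* (con (+ 1) :- q)) :* h :+ P :* (h' :* q)) :+ ((:- k) :* (P :* h) :+ k :* (q :* P :* h)))
           refl q P (φ H) (φ (D H)) (ι (+ n))) ⟩
    top ((ι (+ n) ⊛ (P ⊛ (𝟙 ⊕ ⊝ q)) ⊛ φ H ⊕ P ⊛ (φ (D H) ⊛ q)) ⊕ (⊝ ι (+ n) ⊛ (P ⊛ φ H) ⊕ ι (+ n) ⊛ (q ⊛ P ⊛ φ H)))
      ≡⟨ cong₂ (λ x y → top ((x ⊛ φ H ⊕ P ⊛ y) ⊕ (⊝ ι (+ n) ⊛ (P ⊛ φ H) ⊕ ι (+ n) ⊛ (q ⊛ P ⊛ φ H)))) (D-C^ n) (D-ev us-variables H) ⟨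
    top ((D P ⊛ φ H ⊕ P ⊛ D (φ H)) ⊕ (⊝ ι (+ n) ⊛ (P ⊛ φ H) ⊕ ι (+ n) ⊛ (q ⊛ P ⊛ φ H)))
      ≡⟨ cong₂ (λ x y → top (x ⊕ (y ⊛ (P ⊛ φ H) ⊕ ι (+ n) ⊛ (q ⊛ P ⊛ φ H)))) (sym (D-⊛ P (φ H))) (sym (ι-neg (+ n))) ⟩
    top (D (P ⊛ φ H) ⊕ (ι (ℤ.- + n) ⊛ (P ⊛ φ H) ⊕ ι (+ n) ⊛ (q ⊛ P ⊛ φ H)))
      ≡⟨ trans (top-⊕ (D (P ⊛ φ H)) _) (cong₂ ℤ._+_ (top-D (P ⊛ φ H)) (trans (top-⊕ (ι (ℤ.- + n) ⊛ (P ⊛ φ H)) _) (cong₂ ℤ._+_ (top-ι⊛ (ℤ.- + n) (P ⊛ φ H)) (top-ι⊛ (+ n) (q ⊛ P ⊛ φ H))))) ⟩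
    + n ℤ.* top (P ⊛ φ H) ℤ.+ ((ℤ.- + n) ℤ.* top (P ⊛ φ H) ℤ.+ + n ℤ.* residue H)
      ≡⟨ cancel (+ n) (top (P ⊛ φ H)) (residue H) ⟩
    + n ℤ.* residue H ∎
    where
    P = C ^ᴷ n
    cancel : ∀ k x y → k ℤ.* x ℤ.+ ((ℤ.- k) ℤ.* x ℤ.+ k ℤ.* y) ≡ k ℤ.* y
    cancel = ℤ-solve-∀

  residue≡top : ∀ H → residue H ≡ top H
  residue≡top H = trans (eigen-top residue residue-linear residue-eigen H)
    (trans (cong (λ z → top H ℤ.* z) (top-⊛-ev-ε∏ (q ⊛ C ^ᴷ n) c c₀-qC^ c₀-c)) (ℤₚ.*-identityʳ (top H)))
    where
    c₀-D : ∀ {m} (a : K m) → c₀ (D a) ≡ + 0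
    c₀-D (const x) = refl
    c₀-D (a +ε b) = c₀-D a
    c₀-qC^ : c₀ (q ⊛ C ^ᴷ n) ≡ + 1
    c₀-qC^ = trans (c₀-⊛ q (C ^ᴷ n)) (cong₂ ℤ._*_
      (c₀-1- (c ⊛ D C) (trans (c₀-⊛ c (D C)) (trans (cong (λ z → c₀ c ℤ.* z) (c₀-D C)) (ℤₚ.*-zeroʳ (c₀ c)))))
      (c₀-^ C n c₀-C))

module _ {N} (ws : Vec ℤ (suc N)) (f g : K (suc N))
  (f>0 : Supp (λ z → + 0 ℤ.< z) ws f) (g<0 : Supp (λ z → z ℤ.< + 0) ws g)
  (factorisation : f ⊕ g ⊕ π (+ 0) ws (f ⊛ g) ≡ εΣ (suc N) ⊕ f ⊛ g) where

  open WienerHopf ws f g f>0 g<0 factorisation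
  open ≡-Reasoning

  -- `φ (G N)` cancels N of the N + 1 factors `C` in the residue. What is left is q C = C - D C, and
  -- on top coefficients `D` is multiplication by N + 1.
  top-exp-B : top (exp (ι (ℤ.- + N) ⊛ π (+ 0) ws (L (suc N)))) ≡ (ℤ.- + N) ℤ.* top (π (+ 0) ws (f ⊛ g))
  top-exp-B = begin
    top (G N)                                   ≡⟨ residue≡top (G N) ⟨
    top (q ⊛ (C ⊛ C ^ᴷ N) ⊛ φ (G N))            ≡⟨ cong top (solve 4 (λ q C P g → q :* (C :* P) :* g := q :* C :* (g :* P)) refl q C (C ^ᴷ N) (φ (G N))) ⟩
    top (q ⊛ C ⊛ (φ (G N) ⊛ C ^ᴷ N))            ≡⟨ cong₂ (λ x y → top (x ⊛ y)) q⊛C (φG⊛C^ N) ⟩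
    top ((C ⊕ ⊝ D C) ⊛ 𝟙)                       ≡⟨ cong top (⊛-identityʳ (C ⊕ ⊝ D C)) ⟩
    top (C ⊕ ⊝ D C)                             ≡⟨ trans (top-⊕ C (⊝ D C)) (cong (λ z → top C ℤ.+ z) (trans (top-⊝ (D C)) (cong ℤ.-_ (top-D C)))) ⟩
    top C ℤ.- + suc N ℤ.* top C                 ≡⟨ factor (+ N) (top C) ⟩
    (ℤ.- + N) ℤ.* top C                         ≡⟨ cong (λ z → (ℤ.- + N) ℤ.* z) (trans (top-⊕ 𝟙 Z) (trans (cong (ℤ._+ top Z) (top-𝟘 N)) (ℤₚ.+-identityˡ (top Z)))) ⟩
    (ℤ.- + N) ℤ.* top Z                         ∎
    where
    factor : ∀ k x → x ℤ.- (+ 1 ℤ.+ k) ℤ.* x ≡ (ℤ.- k) ℤ.* x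
    factor = ℤ-solve-∀

-- Sums over enumerations

private variable
  A B : Set
  𝑃 𝑄 : A → Set

∑ : List A → (A → ℤ) → ℤ
∑ xs f = sumℤ (map f xs)

∑-++ : (xs ys : List A) (f : A → ℤ) → ∑ (xs ++ ys) f ≡ ∑ xs f ℤ.+ ∑ ys f
∑-++ [] ys f = sym (ℤₚ.+-identityˡ _)
∑-++ (x ∷ xs) ys f = trans (cong (λ z → f x ℤ.+ z) (∑-++ xs ys f)) (sym (ℤₚ.+-assoc (f x) _ _))

∑-map : (h : A → B) (xs : List A) (f : B → ℤ) → ∑ (map h xs) f ≡ ∑ xs (f ∘ h)
∑-map h xs f = cong sumℤ (sym (Listₚ.map-∘ xs))

∑-cong-∈ : {f g : A → ℤ} (xs : List A) → (∀ x → x ∈ xs → f x ≡ g x) → ∑ xs f ≡ ∑ xs g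
∑-cong-∈ [] h = refl
∑-cong-∈ (x ∷ xs) h = cong₂ ℤ._+_ (h x (here refl)) (∑-cong-∈ xs (λ y → h y ∘ there))

∑-cong : {f g : A → ℤ} (xs : List A) → (∀ x → f x ≡ g x) → ∑ xs f ≡ ∑ xs g
∑-cong xs h = ∑-cong-∈ xs (λ x _ → h x)

∑-zero : (xs : List A) → ∑ xs (λ _ → + 0) ≡ + 0
∑-zero [] = refl
∑-zero (x ∷ xs) = trans (ℤₚ.+-identityˡ _) (∑-zero xs)

∑-*ˡ : ∀ c (xs : List A) (f : A → ℤ) → ∑ xs (λ x → c ℤ.* f x) ≡ c ℤ.* ∑ xs f
∑-*ˡ c [] f = sym (ℤₚ.*-zeroʳ c)
∑-*ˡ c (x ∷ xs) f = trans (cong (λ z → c ℤ.* f x ℤ.+ z) (∑-*ˡ c xs f)) (sym (ℤₚ.*-distribˡ-+ c (f x) (∑ xs f)))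

∑-*ʳ : ∀ c (xs : List A) (f : A → ℤ) → ∑ xs (λ x → f x ℤ.* c) ≡ ∑ xs f ℤ.* c
∑-*ʳ c xs f = trans (∑-cong xs (λ x → ℤₚ.*-comm (f x) c)) (trans (∑-*ˡ c xs f) (ℤₚ.*-comm c (∑ xs f)))

∑-↭ : {xs ys : List A} (f : A → ℤ) → xs ↭ ys → ∑ xs f ≡ ∑ ys f
∑-↭ f p = foldr-commMonoid (setoid ℤ) ℤₚ.+-0-isCommutativeMonoid (↭⇒↭ₛ (↭ₚ.map⁺ f p))

length≡∑ : (xs : List A) → + length xs ≡ ∑ xs (λ _ → + 1)
length≡∑ [] = refl
length≡∑ (x ∷ xs) = cong (λ z → + 1 ℤ.+ z) (length≡∑ xs)

∑-filter : {D : A → Set} (D? : Decidable D) (f g : A → ℤ) (xs : List A) →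
           (∀ x → x ∈ xs → D x → f x ≡ g x) → (∀ x → x ∈ xs → ¬ D x → g x ≡ + 0) → ∑ (filter D? xs) f ≡ ∑ xs g
∑-filter D? f g [] h k = refl
∑-filter D? f g (x ∷ xs) h k with D? x
... | yes d = cong₂ ℤ._+_ (h x (here refl) d) (∑-filter D? f g xs (λ y → h y ∘ there) (λ y → k y ∘ there))
... | no ¬d = trans (∑-filter D? f g xs (λ y → h y ∘ there) (λ y → k y ∘ there))
  (sym (trans (cong (ℤ._+ ∑ xs g) (k x (here refl) ¬d)) (ℤₚ.+-identityˡ _)))

module _ {A : Set} {B : A → Set} where

  pairs : List A → (∀ x → List (B x)) → List (Σ A B)
  pairs []       ys = []
  pairs (x ∷ xs) ys = map (x ,_) (ys x) ++ pairs xs ys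

  ∑-pairs : (xs : List A) (ys : ∀ x → List (B x)) (f : Σ A B → ℤ) → ∑ (pairs xs ys) f ≡ ∑ xs (λ x → ∑ (ys x) (λ y → f (x , y)))
  ∑-pairs [] ys f = refl
  ∑-pairs (x ∷ xs) ys f = trans (∑-++ (map (x ,_) (ys x)) (pairs xs ys) f) (cong₂ ℤ._+_ (∑-map (x ,_) (ys x) f) (∑-pairs xs ys f))

  ∈-pairs⁺ : (xs : List A) (ys : ∀ x → List (B x)) {x : A} {y : B x} → x ∈ xs → y ∈ ys x → (x , y) ∈ pairs xs ys
  ∈-pairs⁺ (x ∷ xs) ys (here refl) q = ∈-++⁺ˡ (∈-map⁺ (x ,_) q)
  ∈-pairs⁺ (x ∷ xs) ys (there p) q = ∈-++⁺ʳ (map (x ,_) (ys x)) (∈-pairs⁺ xs ys p q)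

  ∈-pairs⁻ : (xs : List A) (ys : ∀ x → List (B x)) {z : Σ A B} → z ∈ pairs xs ys → proj₁ z ∈ xs × proj₂ z ∈ ys (proj₁ z)
  ∈-pairs⁻ (x ∷ xs) ys z∈ with ∈-++⁻ (map (x ,_) (ys x)) z∈
  ... | inj₁ p with ∈-map⁻ (x ,_) p
  ...   | y , y∈ , refl = here refl , y∈
  ∈-pairs⁻ (x ∷ xs) ys z∈ | inj₂ p with ∈-pairs⁻ xs ys p
  ...   | q , r = there q , r

∈⇒P : ∀ {xs : List A} → Enumerates 𝑃 xs → ∀ {x} → x ∈ xs → 𝑃 x
∈⇒P (_ , all , _) = All.lookup all

enum-pairs : {B : A → Set} {𝑄 : ∀ x → B x → Set} {xs : List A} (ys : ∀ x → List (B x)) → Enumerates 𝑃 xs →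
             (∀ x → 𝑃 x → Enumerates (𝑄 x) (ys x)) →
             Enumerates {Σ A B} (λ (x , y) → 𝑃 x × 𝑄 x y) (pairs xs ys)
enum-pairs {𝑃 = 𝑃} {𝑄 = 𝑄} ys (u , ps , complete) h =
  unique u ps , All.tabulate (λ z∈ → let (p , q) = ∈-pairs⁻ _ ys z∈ ; px = All.lookup ps p in px , ∈⇒P (h _ px) q) ,
  λ { (x , y) (p , q) → ∈-pairs⁺ _ ys (complete x p) (proj₂ (proj₂ (h x p)) y q) }
  where
  unique : ∀ {xs} → Unique xs → All 𝑃 xs → Unique (pairs xs ys)
  unique [] [] = []
  unique {x ∷ xs} (x∉ ∷ u) (p ∷ ps) = Uniqueₚ.++⁺ (Uniqueₚ.map⁺ (λ { refl → refl }) (proj₁ (h x p))) (unique u ps)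
    λ (a , b) → disjoint a b
    where
    disjoint : ∀ {z} → z ∈ map (x ,_) (ys x) → ¬ z ∈ pairs xs ys
    disjoint a b with ∈-map⁻ (x ,_) a
    ... | y , _ , refl = All.lookup x∉ (proj₁ (∈-pairs⁻ xs ys b)) refl

enum-⇔ : {xs : List A} → (∀ x → 𝑃 x → 𝑄 x) → (∀ x → 𝑄 x → 𝑃 x) → Enumerates 𝑃 xs → Enumerates 𝑄 xs
enum-⇔ f g (u , ps , c) = u , All.map (f _) ps , λ x q → c x (g x q)

enum-map : {xs : List A} (h : A → B) → (∀ x → 𝑃 x → 𝑄 (h x)) →
           (∀ x y → 𝑃 x → 𝑃 y → h x ≡ h y → x ≡ y) → (∀ y → 𝑄 y → ∃[ x ] 𝑃 x × h x ≡ y) →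
           Enumerates 𝑃 xs → Enumerates 𝑄 (map h xs)
enum-map {𝑃 = 𝑃} h sound inj surj (u , ps , c) =
  unique u ps , Allₚ.map⁺ (All.map (sound _) ps) , λ { y q → let (x , p , e) = surj y q in subst (_∈ _) e (∈-map⁺ h (c x p)) }
  where
  unique : ∀ {xs} → Unique xs → All 𝑃 xs → Unique (map h xs)
  unique [] [] = []
  unique (x∉ ∷ u) (p ∷ ps) = Allₚ.map⁺ (All.zipWith (λ (x≢y , q) e → x≢y (inj _ _ p q e)) (x∉ , ps)) ∷ unique u ps

-- For maps that identify elements, such as forgetting the distinguished edge of a tree; hence the
-- deduplication.
enum-image : DecidableEquality B → {xs : List A} (h : A → B) → (∀ x → 𝑃 x → 𝑄 (h x)) →
             (∀ y → 𝑄 y → ∃[ x ] 𝑃 x × h x ≡ y) → Enumerates 𝑃 xs → ∃ (Enumerates 𝑄)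
enum-image _≟_ {xs} h sound surj (u , ps , c) = deduplicate _≟_ (map h xs) ,
  UniqueDecₚ.deduplicate-! _≟_ (map h xs) ,
  All.tabulate (λ z∈ → All.lookup (Allₚ.map⁺ (All.map (sound _) ps)) (∈-deduplicate⁻ _≟_ (map h xs) z∈)) ,
  λ { y q → let (x , p , e) = surj y q in ∈-deduplicate⁺ _≟_ (subst (_∈ _) e (∈-map⁺ h (c x p))) }

enum-filter : {D : A → Set} {xs : List A} (D? : Decidable D) → Enumerates 𝑃 xs → Enumerates (λ x → 𝑃 x × D x) (filter D? xs)
enum-filter D? (u , ps , c) = Uniqueₚ.filter⁺ D? u ,
  All.tabulate (λ z∈ → let (a , b) = ∈-filter⁻ D? z∈ in All.lookup ps a , b) ,
  λ { x (p , d) → ∈-filter⁺ D? (c x p) d }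

enum-∅ : (∀ x → ¬ 𝑃 x) → Enumerates {A} 𝑃 []
enum-∅ h = [] , [] , λ x p → ⊥-elim (h x p)

enum-singleton : ∀ {a : A} → 𝑃 a → (∀ x → 𝑃 x → x ≡ a) → Enumerates 𝑃 (a ∷ [])
enum-singleton p h = ([] ∷ []) , (p ∷ []) , λ x q → here (h x q)

enum-++ : {xs ys : List A} → (∀ x → 𝑃 x → ¬ 𝑄 x) → Enumerates 𝑃 xs → Enumerates 𝑄 ys → Enumerates (λ x → 𝑃 x ⊎ 𝑄 x) (xs ++ ys)
enum-++ {xs = xs} h (u , ps , c) (v , qs , d) =
  Uniqueₚ.++⁺ u v (λ (a , b) → h _ (All.lookup ps a) (All.lookup qs b)) ,
  Allₚ.++⁺ (All.map inj₁ ps) (All.map inj₂ qs) ,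
  λ { x (inj₁ p) → ∈-++⁺ˡ (c x p) ; x (inj₂ q) → ∈-++⁺ʳ xs (d x q) }

enum-allFin : ∀ n → Enumerates {Fin n} (λ _ → ⊤) (allFin n)
enum-allFin n = Uniqueₚ.allFin⁺ n , All.universal (λ _ → tt) _ , λ x _ → ∈-allFin x

-- It makes sums over an enumeration depend on the enumerated predicate alone.
enum-unique-↭ : {xs ys : List A} → Enumerates 𝑃 xs → Enumerates 𝑃 ys → xs ↭ ys
enum-unique-↭ (u , ps , c) (v , qs , d) =
  ∼bag⇒↭ (unique∧set⇒bag u v (mk⇔ (λ x∈ → d _ (All.lookup ps x∈)) (λ y∈ → c _ (All.lookup qs y∈))))

∑-bijection : {xs : List A} {ys : List B} {f : A → ℤ} {g : B → ℤ} → Enumerates 𝑃 xs → Enumerates 𝑄 ys →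
              (h : A → B) → (∀ x → 𝑃 x → 𝑄 (h x)) → (∀ x y → 𝑃 x → 𝑃 y → h x ≡ h y → x ≡ y) →
              (∀ y → 𝑄 y → ∃[ x ] 𝑃 x × h x ≡ y) → (∀ x → 𝑃 x → f x ≡ g (h x)) → ∑ xs f ≡ ∑ ys g
∑-bijection {xs = xs} {g = g} ex ey h sound inj surj eq =
  trans (∑-cong-∈ xs (λ x x∈ → eq x (∈⇒P ex x∈)))
    (trans (sym (∑-map h xs g)) (∑-↭ g (enum-unique-↭ (enum-map h sound inj surj ex) ey)))

vecs : ∀ {n} → (Fin n → List A) → List (Vec A n)
vecs {n = zero}  xs = [] ∷ []
vecs {n = suc n} xs = map (λ (x , v) → x ∷ v) (pairs (xs zero) (λ _ → vecs (xs ∘ suc)))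

enum-vecs : ∀ {n} {𝑃 : Fin n → A → Set} (xs : Fin n → List A) → (∀ i → Enumerates (𝑃 i) (xs i)) →
            Enumerates (λ v → ∀ i → 𝑃 i (lookup v i)) (vecs xs)
enum-vecs {n = zero} xs h = enum-singleton (λ ()) (λ { [] _ → refl })
enum-vecs {n = suc n} {𝑃} xs h = enum-map (λ (x , v) → x ∷ v)
  (λ { (x , v) (p , q) zero → p ; (x , v) (p , q) (suc i) → q i })
  (λ { _ _ _ _ refl → refl })
  (λ { (x ∷ v) q → (x , v) , (q zero , q ∘ suc) , refl })
  (enum-pairs {𝑄 = λ _ v → ∀ i → 𝑃 (suc i) (lookup v i)} _ (h zero) (λ _ _ → enum-vecs (xs ∘ suc) (h ∘ suc)))

-- Partitions as restricted growth words

lo hi : ∀ {n} → K (suc n) → K n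
lo (a +ε b) = a
hi (a +ε b) = b

lo-⊛ : ∀ {n} (a b : K (suc n)) → lo (a ⊛ b) ≡ lo a ⊛ lo b
lo-⊛ (a +ε b) (c +ε d) = refl

hi-⊛ : ∀ {n} (a b : K (suc n)) → hi (a ⊛ b) ≡ lo a ⊛ hi b ⊕ hi a ⊛ lo b
hi-⊛ (a +ε b) (c +ε d) = refl

top-hi : ∀ {n} (a : K (suc n)) → top a ≡ top (hi a)
top-hi (a +ε b) = refl

-- Divided powers: dp j a = aʲ / j! for a without constant term.
dp : ∀ {n} → ℕ → K n → K n
dp zero    (const x) = 𝟙
dp (suc j) (const x) = 𝟘
dp zero    (a +ε b)  = dp zero a +ε 𝟘
dp (suc j) (a +ε b)  = dp (suc j) a +ε dp j a ⊛ b

dp-0 : ∀ {n} (a : K n) → dp 0 a ≡ 𝟙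
dp-0 (const x) = refl
dp-0 (a +ε b) = cong (_+ε 𝟘) (dp-0 a)

dp-𝟘 : ∀ n j → dp {n} (suc j) 𝟘 ≡ 𝟘
dp-𝟘 zero j = refl
dp-𝟘 (suc n) j = cong₂ _+ε_ (dp-𝟘 n j) (⊛-zeroʳ (dp j 𝟘))

∑K : ∀ {n} → ℕ → (ℕ → K n) → K n
∑K zero    F = 𝟘
∑K (suc M) F = F 0 ⊕ ∑K M (F ∘ suc)

∑K-+ε : ∀ {n} M (F : ℕ → K (suc n)) → ∑K M F ≡ ∑K M (lo ∘ F) +ε ∑K M (hi ∘ F)
∑K-+ε zero F = refl
∑K-+ε (suc M) F = trans (cong (F 0 ⊕_) (∑K-+ε M (F ∘ suc))) (split (F 0) _ _)
  where
  split : ∀ {n} (a : K (suc n)) b c → a ⊕ (b +ε c) ≡ (lo a ⊕ b) +ε (hi a ⊕ c)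
  split (a +ε a') b c = refl

∑K-⊛ : ∀ {n} M (F : ℕ → K n) a → ∑K M F ⊛ a ≡ ∑K M (λ j → F j ⊛ a)
∑K-⊛ zero F a = ⊛-zeroˡ a
∑K-⊛ (suc M) F a = trans (⊛-distribʳ a (F 0) _) (cong (F 0 ⊛ a ⊕_) (∑K-⊛ M (F ∘ suc) a))

∑K-cong : ∀ {n} M {F G : ℕ → K n} → (∀ j → F j ≡ G j) → ∑K M F ≡ ∑K M G
∑K-cong zero h = refl
∑K-cong (suc M) h = cong₂ _⊕_ (h 0) (∑K-cong M (h ∘ suc))

∑K-𝟘 : ∀ {n} M {F : ℕ → K n} → (∀ j → F j ≡ 𝟘) → ∑K M F ≡ 𝟘
∑K-𝟘 zero h = refl
∑K-𝟘 (suc M) h = trans (cong₂ _⊕_ (h 0) (∑K-𝟘 M (h ∘ suc))) (⊕-identityˡ 𝟘)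

-- The exponential series breaks off: in n variables, more than n factors without constant term have
-- product 0.
exp-dp : ∀ {n} M y (a : K n) → n ≤ M → exp (ι y ⊛ a) ≡ ∑K (suc M) (λ j → ι (y ℤ.^ j) ⊛ dp j a)
exp-dp M y (const x) _ = sym (trans (cong (const (+ 1) ⊕_) (∑K-𝟘 M (λ j → ⊛-zeroʳ (const (y ℤ.^ suc j))))) refl)
exp-dp (suc M) y (a +ε b) (s≤s n≤M) = sym (trans (∑K-+ε (suc (suc M)) (λ j → ι (y ℤ.^ j) ⊛ dp j (a +ε b))) (cong₂ _+ε_
  (sym (exp-dp (suc M) y a (ℕₚ.m≤n⇒m≤1+n n≤M)))
  (begin
    (𝟙 ⊛ 𝟘 ⊕ 𝟘 ⊛ dp 0 a) ⊕ ∑K (suc M) (λ j → ι (y ℤ.^ suc j) ⊛ (dp j a ⊛ b) ⊕ 𝟘 ⊛ dp (suc j) a)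
      ≡⟨ cong₂ _⊕_ (solve 1 (λ d → con (+ 1) :* con (+ 0) :+ con (+ 0) :* d := con (+ 0)) refl (dp 0 a))
           (∑K-cong (suc M) (λ j → trans (cong (λ z → z ⊛ (dp j a ⊛ b) ⊕ 𝟘 ⊛ dp (suc j) a) (ι-* y (y ℤ.^ j)))
             (solve 5 (λ y p d b e → y :* p :* (d :* b) :+ con (+ 0) :* e := p :* d :* (y :* b)) refl (ι y) (ι (y ℤ.^ j)) (dp j a) b (dp (suc j) a)))) ⟩
    𝟘 ⊕ ∑K (suc M) (λ j → ι (y ℤ.^ j) ⊛ dp j a ⊛ (ι y ⊛ b))
      ≡⟨ trans (⊕-identityˡ _) (sym (∑K-⊛ (suc M) (λ j → ι (y ℤ.^ j) ⊛ dp j a) (ι y ⊛ b))) ⟩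
    ∑K (suc M) (λ j → ι (y ℤ.^ j) ⊛ dp j a) ⊛ (ι y ⊛ b)
      ≡⟨ cong₂ _⊛_ (sym (exp-dp M y a n≤M)) (solve 2 (λ x a → x := x :+ con (+ 0) :* a) refl (ι y ⊛ b) a) ⟩
    exp (ι y ⊛ a) ⊛ (ι y ⊛ b ⊕ 𝟘 ⊛ a) ∎)))
  where open ≡-Reasoning

sumN : ℕ → (ℕ → ℤ) → ℤ
sumN zero    F = + 0
sumN (suc m) F = sumN m F ℤ.+ F m

sumN-cong : ∀ m {F G : ℕ → ℤ} → (∀ p → p < m → F p ≡ G p) → sumN m F ≡ sumN m G
sumN-cong zero h = refl
sumN-cong (suc m) h = cong₂ ℤ._+_ (sumN-cong m (λ p lt → h p (ℕₚ.m≤n⇒m≤1+n lt))) (h m ℕₚ.≤-refl)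

sumN-front : ∀ m (F : ℕ → ℤ) → sumN (suc m) F ≡ F 0 ℤ.+ sumN m (F ∘ suc)
sumN-front zero F = trans (ℤₚ.+-identityˡ (F 0)) (sym (ℤₚ.+-identityʳ (F 0)))
sumN-front (suc m) F = trans (cong (ℤ._+ F (suc m)) (sumN-front m F)) (ℤₚ.+-assoc (F 0) _ _)

top-∑K : ∀ {n} M (F : ℕ → K n) → top (∑K M F) ≡ sumN M (top ∘ F)
top-∑K {n} zero F = top-𝟘 n
top-∑K (suc M) F = trans (top-⊕ (F 0) _) (trans (cong (λ z → top (F 0) ℤ.+ z) (top-∑K M (F ∘ suc))) (sym (sumN-front M (top ∘ F))))

∑-allFin-suc : ∀ n (F : Fin (suc n) → ℤ) → ∑ (allFin (suc n)) F ≡ F zero ℤ.+ ∑ (allFin n) (F ∘ suc)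
∑-allFin-suc n F = cong (λ z → F zero ℤ.+ sumℤ z)
  (trans (Listₚ.map-tabulate suc F) (sym (Listₚ.map-tabulate (λ i → i) (F ∘ suc))))

∑-allFin : ∀ n (F : ℕ → ℤ) → ∑ (allFin n) (F ∘ toℕ) ≡ sumN n F
∑-allFin zero F = refl
∑-allFin (suc n) F = trans (∑-allFin-suc n (F ∘ toℕ))
  (trans (cong (λ z → F 0 ℤ.+ z) (∑-allFin n (F ∘ suc))) (sym (sumN-front n F)))

prodN : ∀ {r} → ℕ → (ℕ → K r) → K r
prodN zero    h = 𝟙
prodN (suc m) h = prodN m h ⊛ h m

prodN-cong : ∀ {r} m {h k : ℕ → K r} → (∀ p → p < m → h p ≡ k p) → prodN m h ≡ prodN m k
prodN-cong zero e = refl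
prodN-cong (suc m) e = cong₂ _⊛_ (prodN-cong m (λ p lt → e p (ℕₚ.m≤n⇒m≤1+n lt))) (e m ℕₚ.≤-refl)

lo-prodN : ∀ {r} m (h : ℕ → K (suc r)) → lo (prodN m h) ≡ prodN m (lo ∘ h)
lo-prodN zero h = refl
lo-prodN (suc m) h = trans (lo-⊛ (prodN m h) (h m)) (cong (_⊛ lo (h m)) (lo-prodN m h))

-- The decision is an explicit argument, so that lemmas can quantify over it and match on it
-- separately.
pick : {A X : Set} → Dec A → X → X → X
pick (yes _) x y = x
pick (no _)  x y = y

-- Block q receives the first of the remaining vertices.
step : ∀ {r} → ℕ → (ℕ → K (suc r)) → ℕ → K r
step q h p = pick (p ℕ.≟ q) (hi (h p)) (lo (h p))

step-hit : ∀ {r} q (h : ℕ → K (suc r)) → step q h q ≡ hi (h q)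
step-hit q h with q ℕ.≟ q
... | yes _ = refl
... | no q≢q = ⊥-elim (q≢q refl)

step-miss : ∀ {r} q (h : ℕ → K (suc r)) p → p ≢ q → step q h p ≡ lo (h p)
step-miss q h p p≢q with p ℕ.≟ q
... | yes e = ⊥-elim (p≢q e)
... | no _ = refl

-- The next variable is taken from exactly one of the factors, and `step q` records from which. The
-- factor `x` absorbs those factors that the induction has already split off.
leibniz : ∀ {r} m (h : ℕ → K (suc r)) x → top (x ⊛ hi (prodN m h)) ≡ sumN m (λ q → top (x ⊛ prodN m (step q h)))
leibniz {r} zero h x = trans (cong top (⊛-zeroʳ x)) (top-𝟘 r)
leibniz (suc m) h x = begin
  top (x ⊛ hi (prodN m h ⊛ h m))
    ≡⟨ cong (λ z → top (x ⊛ z)) (trans (hi-⊛ (prodN m h) (h m)) (cong (λ z → z ⊛ hi (h m) ⊕ hi (prodN m h) ⊛ lo (h m)) (lo-prodN m h))) ⟩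
  top (x ⊛ (prodN m (lo ∘ h) ⊛ hi (h m) ⊕ hi (prodN m h) ⊛ lo (h m)))
    ≡⟨ cong top (solve 5 (λ x p b q a → x :* (p :* b :+ q :* a) := (x :* a) :* q :+ x :* (p :* b)) refl x (prodN m (lo ∘ h)) (hi (h m)) (hi (prodN m h)) (lo (h m))) ⟩
  top (x ⊛ lo (h m) ⊛ hi (prodN m h) ⊕ x ⊛ (prodN m (lo ∘ h) ⊛ hi (h m)))
    ≡⟨ top-⊕ (x ⊛ lo (h m) ⊛ hi (prodN m h)) _ ⟩
  top (x ⊛ lo (h m) ⊛ hi (prodN m h)) ℤ.+ top (x ⊛ (prodN m (lo ∘ h) ⊛ hi (h m)))
    ≡⟨ cong₂ ℤ._+_ (trans (leibniz m h (x ⊛ lo (h m))) (sumN-cong m earlier))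
         (cong₂ (λ y z → top (x ⊛ (y ⊛ z))) (prodN-cong m (λ p p<m → sym (step-miss m h p (ℕₚ.<⇒≢ p<m)))) (sym (step-hit m h))) ⟩
  sumN m (λ q → top (x ⊛ prodN (suc m) (step q h))) ℤ.+ top (x ⊛ prodN (suc m) (step m h)) ∎
  where
  open ≡-Reasoning
  earlier : ∀ q → q < m → top (x ⊛ lo (h m) ⊛ prodN m (step q h)) ≡ top (x ⊛ prodN (suc m) (step q h))
  earlier q q<m = cong top (trans
    (solve 3 (λ x a p → x :* a :* p := x :* (p :* a)) refl x (lo (h m)) (prodN m (step q h)))
    (cong (λ z → x ⊛ (prodN m (step q h) ⊛ z)) (sym (step-miss q h m (ℕₚ.<⇒≢ q<m ∘ sym)))))

mutual
  -- Restricted growth words with m block labels already in use and all n used in the end.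
  words : ∀ n (m r : ℕ) → List (Vec (Fin n) r)
  words n m zero with m ℕ.≟ n
  ... | yes _ = [] ∷ []
  ... | no _  = []
  words n m (suc r) = map (λ (p , f) → p ∷ f) (pairs (allFin n) (λ p → tails n m r p (ℕₚ.<-cmp (toℕ p) m)))

  -- The comparison of `p` with `m` is an argument in order that proofs about `words` can split on
  -- it.
  tails : ∀ n (m r : ℕ) (p : Fin n) → Tri (toℕ p < m) (toℕ p ≡ m) (m < toℕ p) → List (Vec (Fin n) r)
  tails n m r p (tri< _ _ _) = words n m r
  tails n m r p (tri≈ _ _ _) = words n (suc m) r
  tails n m r p (tri> _ _ _) = []

-- All blocks start from a series in all vertices; reading the word extracts, for every block, the
-- coefficient of the vertices it receives, and sets the vertices of other blocks to 0.
run : ∀ {n r t} → Vec (Fin n) r → (ℕ → K (r + t)) → ℕ → K t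
run []      h = h
run (p ∷ f) h = run f (step (toℕ p) h)

runTop : ∀ {n t} → Vec (Fin n) t → (ℕ → K t) → ℕ → ℤ
runTop []      h = top ∘ h
runTop (p ∷ g) h = runTop g (step (toℕ p) h)

prodℤ : ℕ → (ℕ → ℤ) → ℤ
prodℤ zero    v = + 1
prodℤ (suc m) v = prodℤ m v ℤ.* v m

lower : ∀ r {t} → K (r + t) → K t
lower zero    a = a
lower (suc r) a = lower r (lo a)

∑-runTop : ∀ n {t} (h : ℕ → K t) → ∑ (vecs {n = t} (λ _ → allFin n)) (λ g → prodℤ n (runTop g h)) ≡ top (prodN n h)
∑-runTop n {zero} h = trans (ℤₚ.+-identityʳ _) (base n)
  where
  base : ∀ m → prodℤ m (top ∘ h) ≡ top (prodN m h)
  base zero = refl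
  base (suc m) = trans (cong (ℤ._* top (h m)) (base m)) (top-const (prodN m h) (h m))
    where
    top-const : (a b : K 0) → top a ℤ.* top b ≡ top (a ⊛ b)
    top-const (const x) (const y) = refl
∑-runTop n {suc t} h = begin
  ∑ (vecs {n = suc t} (λ _ → allFin n)) V
    ≡⟨ trans (∑-map _ (pairs (allFin n) _) V) (∑-pairs (allFin n) (λ _ → vecs {n = t} (λ _ → allFin n)) (λ (p , g) → V (p ∷ g))) ⟩
  ∑ (allFin n) (λ p → ∑ (vecs {n = t} (λ _ → allFin n)) (λ g → prodℤ n (runTop g (step (toℕ p) h))))
    ≡⟨ ∑-cong (allFin n) (λ p → ∑-runTop n (step (toℕ p) h)) ⟩
  ∑ (allFin n) (λ p → top (prodN n (step (toℕ p) h)))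
    ≡⟨ ∑-allFin n (λ q → top (prodN n (step q h))) ⟩
  sumN n (λ q → top (prodN n (step q h)))
    ≡⟨ sumN-cong n (λ q _ → cong top (sym (⊛-identityˡ (prodN n (step q h))))) ⟩
  sumN n (λ q → top (𝟙 ⊛ prodN n (step q h)))
    ≡⟨ leibniz n h 𝟙 ⟨
  top (𝟙 ⊛ hi (prodN n h))
    ≡⟨ trans (cong top (⊛-identityˡ (hi (prodN n h)))) (sym (top-hi (prodN n h))) ⟩
  top (prodN n h) ∎
  where
  open ≡-Reasoning
  V : Vec (Fin n) (suc t) → ℤ
  V g = prodℤ n (runTop g h)

sumN-below : ∀ n m {F : ℕ → ℤ} → m ≤ n → (∀ p → m ≤ p → F p ≡ + 0) → sumN n F ≡ sumN m F
sumN-below zero zero m≤n h = refl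
sumN-below (suc n) m m≤n h with m ℕ.≟ suc n
... | yes refl = refl
... | no m≢ = trans (cong₂ ℤ._+_ (sumN-below n m m≤n′ h) (h n m≤n′)) (ℤₚ.+-identityʳ _)
  where m≤n′ = s≤s⁻¹ (ℕₚ.≤∧≢⇒< m≤n m≢)

-- A vertex either joins one of the m open blocks (Leibniz rule for the product) or opens
-- a new one (derivative of the divided power).
∑-words : ∀ n r m {t} (h : ℕ → K (r + t)) y → m ≤ n → (∀ p → m ≤ p → h p ≡ y) → lower r y ≡ 𝟘 →
          ∑ (words n m r) (λ f → top (prodN n (run f h))) ≡ top (dp (n ∸ m) y ⊛ prodN m h)
∑-words n zero m {t} h y m≤n hy y≡𝟘 with m ℕ.≟ n
... | yes refl = trans (ℤₚ.+-identityʳ _) (sym (trans (cong (λ z → top (dp z y ⊛ prodN m h)) (ℕₚ.n∸n≡0 m))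
  (cong top (trans (cong (_⊛ prodN m h) (dp-0 y)) (⊛-identityˡ _)))))
... | no m≢n with n ∸ m in eq
...   | zero  = ⊥-elim (m≢n (ℕₚ.≤-antisym m≤n (ℕₚ.m∸n≡0⇒m≤n eq)))
-- Some blocks have not been opened and no letters remain. The divided power vanishes as well, since
-- `y` has been reduced to 0.
...   | suc d = sym (trans (cong (λ z → top (dp (suc d) z ⊛ prodN m h)) y≡𝟘)
  (trans (cong top (trans (cong (_⊛ prodN m h) (dp-𝟘 t d)) (⊛-zeroˡ _))) (top-𝟘 t)))
∑-words n (suc r) m {t} h y m≤n hy y≡𝟘 = begin
  ∑ (words n m (suc r)) V
    ≡⟨ trans (∑-map _ (pairs (allFin n) _) V) (∑-pairs (allFin n) (λ p → tails n m r p (ℕₚ.<-cmp (toℕ p) m)) (λ (p , f) → V (p ∷ f))) ⟩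
  ∑ (allFin n) (λ p → ∑ (tails n m r p (ℕₚ.<-cmp (toℕ p) m)) (λ f → V (p ∷ f)))
    ≡⟨ ∑-cong (allFin n) (λ p → branch p (ℕₚ.<-cmp (toℕ p) m)) ⟩
  ∑ (allFin n) (λ p → F (toℕ p))
    ≡⟨ ∑-allFin n F ⟩
  sumN n F
    ≡⟨ total (ℕₚ.<-cmp m n) ⟩
  top (hi (dp (n ∸ m) y ⊛ prodN m h))
    ≡⟨ top-hi (dp (n ∸ m) y ⊛ prodN m h) ⟨
  top (dp (n ∸ m) y ⊛ prodN m h) ∎
  where
  open ≡-Reasoning
  V : Vec (Fin n) (suc r) → ℤ
  V f = top (prodN n (run f h))
  old new : ℕ → ℤ
  old p = top (dp (n ∸ m) (lo y) ⊛ prodN m (step p h))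
  new p = top (dp (n ∸ suc m) (lo y) ⊛ prodN (suc m) (step p h))
  G : ∀ p → Tri (p < m) (p ≡ m) (m < p) → ℤ
  G p (tri< _ _ _) = old p
  G p (tri≈ _ _ _) = new p
  G p (tri> _ _ _) = + 0
  F : ℕ → ℤ
  F p = G p (ℕₚ.<-cmp p m)
  branch : ∀ p c → ∑ (tails n m r p c) (λ f → V (p ∷ f)) ≡ G (toℕ p) c
  branch p (tri< p<m _ _) = ∑-words n r m (step (toℕ p) h) (lo y) m≤n
    (λ q m≤q → trans (step-miss (toℕ p) h q (λ { refl → ℕₚ.<⇒≱ p<m m≤q })) (cong lo (hy q m≤q))) y≡𝟘
  branch p (tri≈ _ p≡m _) = ∑-words n r (suc m) (step (toℕ p) h) (lo y) (subst (ℕ._< n) p≡m (Finₚ.toℕ<n p))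
    (λ q m<q → trans (step-miss (toℕ p) h q (λ { refl → ℕₚ.<-irrefl (sym p≡m) m<q })) (cong lo (hy q (ℕₚ.<⇒≤ m<q)))) y≡𝟘
  branch p (tri> _ _ _) = refl
  F-< : ∀ p → p < m → F p ≡ old p
  F-< p p<m with ℕₚ.<-cmp p m
  ... | tri< _ _ _ = refl
  ... | tri≈ ¬lt _ _ = ⊥-elim (¬lt p<m)
  ... | tri> ¬lt _ _ = ⊥-elim (¬lt p<m)
  F-≡ : F m ≡ new m
  F-≡ with ℕₚ.<-cmp m m
  ... | tri< _ m≢m _ = ⊥-elim (m≢m refl)
  ... | tri≈ _ _ _ = refl
  ... | tri> _ m≢m _ = ⊥-elim (m≢m refl)
  F-> : ∀ p → m < p → F p ≡ + 0
  F-> p m<p with ℕₚ.<-cmp p m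
  ... | tri< _ _ ¬gt = ⊥-elim (¬gt m<p)
  ... | tri≈ _ _ ¬gt = ⊥-elim (¬gt m<p)
  ... | tri> _ _ _ = refl
  lo-dp : ∀ j {n} (a : K (suc n)) → lo (dp j a) ≡ dp j (lo a)
  lo-dp zero (a +ε b) = refl
  lo-dp (suc j) (a +ε b) = refl
  hi-dp-0 : ∀ {n} (a : K (suc n)) → hi (dp 0 a) ≡ 𝟘
  hi-dp-0 (a +ε b) = refl
  hi-dp-suc : ∀ j {n} (a : K (suc n)) → hi (dp (suc j) a) ≡ dp j (lo a) ⊛ hi a
  hi-dp-suc j (a +ε b) = refl
  expand : top (hi (dp (n ∸ m) y ⊛ prodN m h)) ≡ sumN m F ℤ.+ top (hi (dp (n ∸ m) y) ⊛ prodN m (lo ∘ h))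
  expand = begin
    top (hi (dp (n ∸ m) y ⊛ prodN m h))
      ≡⟨ cong top (hi-⊛ (dp (n ∸ m) y) (prodN m h)) ⟩
    top (lo (dp (n ∸ m) y) ⊛ hi (prodN m h) ⊕ hi (dp (n ∸ m) y) ⊛ lo (prodN m h))
      ≡⟨ top-⊕ (lo (dp (n ∸ m) y) ⊛ hi (prodN m h)) _ ⟩
    top (lo (dp (n ∸ m) y) ⊛ hi (prodN m h)) ℤ.+ top (hi (dp (n ∸ m) y) ⊛ lo (prodN m h))
      ≡⟨ cong₂ (λ u v → top (u ⊛ hi (prodN m h)) ℤ.+ top (hi (dp (n ∸ m) y) ⊛ v)) (lo-dp (n ∸ m) y) (lo-prodN m h) ⟩
    top (dp (n ∸ m) (lo y) ⊛ hi (prodN m h)) ℤ.+ top (hi (dp (n ∸ m) y) ⊛ prodN m (lo ∘ h))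
      ≡⟨ cong (ℤ._+ top (hi (dp (n ∸ m) y) ⊛ prodN m (lo ∘ h)))
           (trans (leibniz m h (dp (n ∸ m) (lo y))) (sumN-cong m (λ p p<m → sym (F-< p p<m)))) ⟩
    sumN m F ℤ.+ top (hi (dp (n ∸ m) y) ⊛ prodN m (lo ∘ h)) ∎
  total : Tri (m < n) (m ≡ n) (n < m) → sumN n F ≡ top (hi (dp (n ∸ m) y ⊛ prodN m h))
  total (tri> _ _ n<m) = ⊥-elim (ℕₚ.<⇒≱ n<m m≤n)
  total (tri≈ _ refl _) = sym (trans expand (trans (cong (λ z → sumN m F ℤ.+ z) (begin
    top (hi (dp (m ∸ m) y) ⊛ prodN m (lo ∘ h))   ≡⟨ cong (λ z → top (hi (dp z y) ⊛ prodN m (lo ∘ h))) (ℕₚ.n∸n≡0 m) ⟩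
    top (hi (dp 0 y) ⊛ prodN m (lo ∘ h))           ≡⟨ cong (λ z → top (z ⊛ prodN m (lo ∘ h))) (hi-dp-0 y) ⟩
    top (𝟘 ⊛ prodN m (lo ∘ h))                     ≡⟨ trans (cong top (⊛-zeroˡ (prodN m (lo ∘ h)))) (top-𝟘 (r + t)) ⟩
    + 0 ∎)) (ℤₚ.+-identityʳ _)))
  total (tri< m<n _ _) = begin
    sumN n F                   ≡⟨ sumN-below n (suc m) m<n F-> ⟩
    sumN m F ℤ.+ F m           ≡⟨ cong (λ z → sumN m F ℤ.+ z) (trans F-≡ (cong top (begin
      dp (n ∸ suc m) (lo y) ⊛ (prodN m (step m h) ⊛ step m h m)
        ≡⟨ cong₂ (λ u v → dp (n ∸ suc m) (lo y) ⊛ (u ⊛ v))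
             (prodN-cong m (λ p p<m → step-miss m h p (ℕₚ.<⇒≢ p<m))) (trans (step-hit m h) (cong hi (hy m ℕₚ.≤-refl))) ⟩
      dp (n ∸ suc m) (lo y) ⊛ (prodN m (lo ∘ h) ⊛ hi y)
        ≡⟨ solve 3 (λ d p y → d :* (p :* y) := d :* y :* p) refl (dp (n ∸ suc m) (lo y)) (prodN m (lo ∘ h)) (hi y) ⟩
      dp (n ∸ suc m) (lo y) ⊛ hi y ⊛ prodN m (lo ∘ h)
        ≡⟨ cong (_⊛ prodN m (lo ∘ h)) (trans (sym (hi-dp-suc (n ∸ suc m) y)) (cong (λ z → hi (dp z y)) (sym (∸-suc m<n)))) ⟩
      hi (dp (n ∸ m) y) ⊛ prodN m (lo ∘ h) ∎))) ⟩
    sumN m F ℤ.+ top (hi (dp (n ∸ m) y) ⊛ prodN m (lo ∘ h)) ≡⟨ expand ⟨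
    top (hi (dp (n ∸ m) y ⊛ prodN m h)) ∎
    where
    ∸-suc : ∀ {m n} → m < n → n ∸ m ≡ suc (n ∸ suc m)
    ∸-suc {zero} {suc n} _ = refl
    ∸-suc {suc m} {suc n} (s≤s lt) = ∸-suc lt

-- Finite sums and products, block weights

Σᶠ-suc : ∀ {n} (f : Fin (suc n) → ℕ) → Σᶠ f ≡ f zero + Σᶠ (f ∘ suc)
Σᶠ-suc f = cong (λ z → f zero + ℕ-List.sum z) (trans (Listₚ.map-tabulate suc f) (sym (Listₚ.map-tabulate (λ i → i) (f ∘ suc))))

Πᶠ-suc : ∀ {n} (f : Fin (suc n) → ℕ) → Πᶠ f ≡ f zero * Πᶠ (f ∘ suc)
Πᶠ-suc f = cong (λ z → f zero * ℕ-List.product z) (trans (Listₚ.map-tabulate suc f) (sym (Listₚ.map-tabulate (λ i → i) (f ∘ suc))))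

Σᶠ-cong : ∀ {n} {f g : Fin n → ℕ} → (∀ i → f i ≡ g i) → Σᶠ f ≡ Σᶠ g
Σᶠ-cong {zero} h = refl
Σᶠ-cong {suc n} {f} {g} h = trans (Σᶠ-suc f) (trans (cong₂ ℕ._+_ (h zero) (Σᶠ-cong (h ∘ suc))) (sym (Σᶠ-suc g)))

Πᶠ-cong : ∀ {n} {f g : Fin n → ℕ} → (∀ i → f i ≡ g i) → Πᶠ f ≡ Πᶠ g
Πᶠ-cong {zero} h = refl
Πᶠ-cong {suc n} {f} {g} h = trans (Πᶠ-suc f) (trans (cong₂ ℕ._*_ (h zero) (Πᶠ-cong (h ∘ suc))) (sym (Πᶠ-suc g)))

Σᶠ-positive : ∀ {n} (f : Fin n → ℕ) i → 1 ≤ f i → 1 ≤ Σᶠ f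
Σᶠ-positive f zero h = subst (1 ℕ.≤_) (sym (Σᶠ-suc f)) (ℕₚ.≤-trans h (ℕₚ.m≤m+n _ _))
Σᶠ-positive f (suc i) h = subst (1 ℕ.≤_) (sym (Σᶠ-suc f)) (ℕₚ.≤-trans (Σᶠ-positive (f ∘ suc) i h) (ℕₚ.m≤n+m _ _))

Σᶠ-positive⁻ : ∀ {n} (f : Fin n → ℕ) → 1 ≤ Σᶠ f → ∃[ i ] 1 ≤ f i
Σᶠ-positive⁻ {suc n} f h = go (f zero) refl
  where
  go : ∀ x → f zero ≡ x → ∃[ i ] 1 ≤ f i
  go (suc x) e = zero , subst (1 ℕ.≤_) (sym e) (s≤s z≤n)
  go zero    e = let (i , p) = Σᶠ-positive⁻ (f ∘ suc) (subst (1 ℕ.≤_) (trans (Σᶠ-suc f) (cong (ℕ._+ Σᶠ (f ∘ suc)) e)) h) in suc i , p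

sel-hit : ∀ {n} (p : Fin n) x → sel p p x ≡ x
sel-hit p x with p Fin.≟ p
... | yes _ = refl
... | no p≢p = ⊥-elim (p≢p refl)

blockWeight-positive : ∀ {m n} (w : Fin m → ℕ) → (∀ i → 1 ≤ w i) → (f : Vec (Fin n) m) (p : Fin n) (i : Fin m) → lookup f i ≡ p → 1 ≤ blockWeight w f p
blockWeight-positive w w≥1 f p i refl = Σᶠ-positive _ i (subst (1 ℕ.≤_) (sym (sel-hit p (w i))) (w≥1 i))

blockWeight-positive⁻ : ∀ {m n} (w : Fin m → ℕ) (f : Vec (Fin n) m) (p : Fin n) → 1 ≤ blockWeight w f p → ∃[ i ] lookup f i ≡ p
blockWeight-positive⁻ w f p h with Σᶠ-positive⁻ _ h
... | i , q with lookup f i Fin.≟ p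
...   | yes e = i , e

-- Restricted growth and the canonical numbering of blocks

Growth : ∀ n (m : ℕ) {r} → Vec (Fin n) r → Set
Growth n m []      = m ≡ n
Growth n m (p ∷ f) = (toℕ p < m × Growth n m f) ⊎ (toℕ p ≡ m × Growth n (suc m) f)

enum-words : ∀ n r m → Enumerates (Growth n m) (words n m r)
enum-words n zero m with m ℕ.≟ n
... | yes e = enum-singleton e (λ { [] _ → refl })
... | no m≢n = enum-∅ λ { [] e → m≢n e }
enum-words n (suc r) m = enum-map (λ (p , f) → p ∷ f) (λ _ → proj₂) (λ { _ _ _ _ refl → refl })
  (λ { (p ∷ f) g → (p , f) , (tt , g) , refl })
  (enum-pairs _ (enum-allFin n) (λ p _ → enum-tails p (ℕₚ.<-cmp (toℕ p) m)))
  where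
  enum-tails : ∀ p c → Enumerates (λ f → Growth n m (p ∷ f)) (tails n m r p c)
  enum-tails p (tri< p<m p≢m _) = enum-⇔ (λ f g → inj₁ (p<m , g)) (λ { f (inj₁ (_ , g)) → g ; f (inj₂ (e , _)) → ⊥-elim (p≢m e) }) (enum-words n r m)
  enum-tails p (tri≈ p≮m p≡m _) = enum-⇔ (λ f g → inj₂ (p≡m , g)) (λ { f (inj₁ (lt , _)) → ⊥-elim (p≮m lt) ; f (inj₂ (_ , g)) → g }) (enum-words n r (suc m))
  enum-tails p (tri> p≮m p≢m _) = enum-∅ λ { f (inj₁ (lt , _)) → p≮m lt ; f (inj₂ (e , _)) → p≢m e }

-- The conditions of `IsPartition` on white labels, relaxed by `m` labels that have occurred before
-- the word starts; they are recovered for m = 0.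
Canonical : ∀ {n r} → ℕ → Vec (Fin n) r → Set
Canonical {n} {r} m f = (∀ (p : Fin n) → m ≤ toℕ p → ∃[ i ] lookup f i ≡ p) ×
  (∀ (i : Fin r) (p : Fin n) → toℕ p < toℕ (lookup f i) → toℕ p < m ⊎ ∃[ i' ] (toℕ i' < toℕ i × lookup f i' ≡ p))

growth⇒canonical : ∀ {n r} m (f : Vec (Fin n) r) → Growth n m f → Canonical m f
growth⇒canonical m [] refl = (λ p m≤p → ⊥-elim (ℕₚ.<⇒≱ (Finₚ.toℕ<n p) m≤p)) , λ ()
growth⇒canonical {n} m (q ∷ f) (inj₁ (q<m , g)) with growth⇒canonical m f g
... | onto , least = (λ p m≤p → let (i , e) = onto p m≤p in suc i , e) , ordered
  where
  ordered : ∀ i (p : Fin n) → toℕ p < toℕ (lookup (q ∷ f) i) → _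
  ordered zero p p<q = inj₁ (ℕₚ.<-trans p<q q<m)
  ordered (suc i) p lt with least i p lt
  ... | inj₁ p<m = inj₁ p<m
  ... | inj₂ (i' , i'<i , e) = inj₂ (suc i' , s≤s i'<i , e)
growth⇒canonical {n} m (q ∷ f) (inj₂ (q≡m , g)) with growth⇒canonical (suc m) f g
... | onto , least = onto′ , ordered
  where
  onto′ : ∀ p → m ≤ toℕ p → _
  onto′ p m≤p with toℕ p ℕ.≟ m
  ... | yes p≡m = zero , Finₚ.toℕ-injective (trans q≡m (sym p≡m))
  ... | no p≢m = let (i , e) = onto p (ℕₚ.≤∧≢⇒< m≤p (p≢m ∘ sym)) in suc i , e
  ordered : ∀ i (p : Fin n) → toℕ p < toℕ (lookup (q ∷ f) i) → _
  ordered zero p p<q = inj₁ (subst (toℕ p ℕ.<_) q≡m p<q)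
  ordered (suc i) p lt with least i p lt
  ... | inj₂ (i' , i'<i , e) = inj₂ (suc i' , s≤s i'<i , e)
  ... | inj₁ p<1+m with toℕ p ℕ.≟ m
  ...   | yes p≡m = inj₂ (zero , s≤s z≤n , Finₚ.toℕ-injective (trans q≡m (sym p≡m)))
  ...   | no p≢m = inj₁ (ℕₚ.≤∧≢⇒< (s≤s⁻¹ p<1+m) p≢m)

canonical⇒growth : ∀ {n r} m (f : Vec (Fin n) r) → m ≤ n → Canonical m f → Growth n m f
canonical⇒growth {n} m [] m≤n (onto , _) with ℕₚ.<-cmp m n
... | tri≈ _ e _ = e
... | tri> _ _ n<m = ⊥-elim (ℕₚ.<⇒≱ n<m m≤n)
... | tri< m<n _ _ with onto (Fin.fromℕ< m<n) (ℕₚ.≤-reflexive (sym (Finₚ.toℕ-fromℕ< m<n)))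
...   | () , _
canonical⇒growth {n} m (q ∷ f) m≤n (onto , least) with ℕₚ.<-cmp (toℕ q) m
... | tri< q<m _ _ = inj₁ (q<m , canonical⇒growth m f m≤n (onto′ , ordered))
  where
  onto′ : ∀ p → m ≤ toℕ p → _
  onto′ p m≤p with onto p m≤p
  ... | zero , refl = ⊥-elim (ℕₚ.<⇒≱ q<m m≤p)
  ... | suc i , e = i , e
  ordered : ∀ i (p : Fin n) → toℕ p < toℕ (lookup f i) → _
  ordered i p lt with least (suc i) p lt
  ... | inj₁ p<m = inj₁ p<m
  ... | inj₂ (zero , _ , refl) = inj₁ q<m
  ... | inj₂ (suc i' , s≤s i'<i , e) = inj₂ (i' , i'<i , e)
... | tri≈ _ q≡m _ = inj₂ (q≡m , canonical⇒growth (suc m) f (subst (ℕ._< n) q≡m (Finₚ.toℕ<n q)) (onto′ , ordered))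
  where
  onto′ : ∀ p → m < toℕ p → _
  onto′ p m<p with onto p (ℕₚ.<⇒≤ m<p)
  ... | zero , refl = ⊥-elim (ℕₚ.<-irrefl (sym q≡m) m<p)
  ... | suc i , e = i , e
  ordered : ∀ i (p : Fin n) → toℕ p < toℕ (lookup f i) → _
  ordered i p lt with least (suc i) p lt
  ... | inj₁ p<m = inj₁ (ℕₚ.m≤n⇒m≤1+n p<m)
  ... | inj₂ (zero , _ , refl) = inj₁ (s≤s (ℕₚ.≤-reflexive q≡m))
  ... | inj₂ (suc i' , s≤s i'<i , e) = inj₂ (i' , i'<i , e)
-- A first letter beyond `m` skips the label `m`, which would have to occur earlier.
... | tri> _ _ m<q = ⊥-elim (absurd (least zero p (subst (ℕ._< toℕ q) (sym (Finₚ.toℕ-fromℕ< m<n)) m<q)))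
  where
  m<n = ℕₚ.<-trans m<q (Finₚ.toℕ<n q)
  p = Fin.fromℕ< m<n
  absurd : ¬ (toℕ p < m ⊎ ∃[ i' ] (toℕ i' < 0 × lookup (q ∷ f) i' ≡ p))
  absurd (inj₁ p<m) = ℕₚ.<-irrefl (Finₚ.toℕ-fromℕ< m<n) p<m

-- Each new label uses up a letter. The bound makes the range of block numbers finite.
growth-bound : ∀ {n r} m (f : Vec (Fin n) r) → Growth n m f → n ≤ m + r
growth-bound m [] refl = ℕₚ.m≤m+n m 0
growth-bound m (p ∷ f) (inj₁ (_ , g)) = ℕₚ.≤-trans (growth-bound m f g) (ℕₚ.+-monoʳ-≤ m (ℕₚ.n≤1+n _))
growth-bound {n} {suc r} m (p ∷ f) (inj₂ (_ , g)) = subst (n ℕ.≤_) (sym (ℕₚ.+-suc m r)) (growth-bound (suc m) f g)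

-- The coefficients of L that remain once a block has received c vertices.
H : ℕ → ∀ r → K r
H zero    r = L r
H (suc c) r = T r c

blockSum : ∀ {n r} → Vec ℤ r → Vec (Fin n) r → ℕ → ℤ → ℤ
blockSum []       []      p z = z
blockSum (w ∷ ws) (q ∷ f) p z = blockSum ws f p (pick (p ℕ.≟ toℕ q) (z ℤ.+ w) z)

blockCount : ∀ {n r} → Vec (Fin n) r → ℕ → ℕ → ℕ
blockCount []      p c = c
blockCount (q ∷ f) p c = blockCount f p (pick (p ℕ.≟ toℕ q) (suc c) c)

step-π : ∀ {r} q (h : ℕ → K (suc r)) (z : ℕ → ℤ) (c : ℕ → ℕ) w (ws : Vec ℤ r) →
         (∀ p → h p ≡ π (z p) (w ∷ ws) (H (c p) (suc r))) →
         ∀ p → step q h p ≡ π (pick (p ℕ.≟ q) (z p ℤ.+ w) (z p)) ws (H (pick (p ℕ.≟ q) (suc (c p)) (c p)) r)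
step-π q h z c w ws e p with p ℕ.≟ q | c p | e p
... | yes _ | zero  | e = cong hi e
... | yes _ | suc _ | e = cong hi e
... | no _  | zero  | e = cong lo e
... | no _  | suc _ | e = cong lo e

-- Of the vertices that a block has received, its series remembers only their number and their total
-- weight.
run-π : ∀ {n r t} (f : Vec (Fin n) r) (ws : Vec ℤ r) (ws' : Vec ℤ t) (h : ℕ → K (r + t)) (z : ℕ → ℤ) (c : ℕ → ℕ) →
        (∀ p → h p ≡ π (z p) (ws Vec.++ ws') (H (c p) (r + t))) →
        ∀ p → run f h p ≡ π (blockSum ws f p (z p)) ws' (H (blockCount f p (c p)) t)
run-π [] [] ws' h z c e p = e p
run-π (q ∷ f) (w ∷ ws) ws' h z c e p = run-π f ws ws' (step (toℕ q) h) _ (λ p → pick (p ℕ.≟ toℕ q) (suc (c p)) (c p)) (step-π (toℕ q) h z c w (ws Vec.++ ws') e) p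

runTop-π : ∀ {n t} (g : Vec (Fin n) t) (ws : Vec ℤ t) (h : ℕ → K t) (z : ℕ → ℤ) (c : ℕ → ℕ) →
           (∀ p → h p ≡ π (z p) ws (H (c p) t)) →
           ∀ p → runTop g h p ≡ top (π (blockSum ws g p (z p)) [] (H (blockCount g p (c p)) 0))
runTop-π [] [] h z c e p = cong top (e p)
runTop-π (q ∷ g) (w ∷ ws) h z c e p = runTop-π g ws (step (toℕ q) h) _ (λ p → pick (p ℕ.≟ toℕ q) (suc (c p)) (c p)) (step-π (toℕ q) h z c w ws e) p

blockSum-tabulate : (σ : ℕ → ℤ) → σ 0 ≡ + 0 → (∀ x y → σ (x + y) ≡ σ x ℤ.+ σ y) →
  ∀ {n r} (w : Fin r → ℕ) (f : Vec (Fin n) r) (p : Fin n) z →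
  blockSum (Vec.tabulate (σ ∘ w)) f (toℕ p) z ≡ z ℤ.+ σ (blockWeight w f p)
blockSum-tabulate σ σ0 σ+ w [] p z = sym (trans (cong (λ x → z ℤ.+ x) σ0) (ℤₚ.+-identityʳ z))
blockSum-tabulate σ σ0 σ+ w (q ∷ f) p z = trans (blockSum-tabulate σ σ0 σ+ (w ∘ suc) f p _) (trans (head (toℕ p ℕ.≟ toℕ q)) (cong (λ x → z ℤ.+ σ x) (sym (Σᶠ-suc (λ i → sel (lookup (q ∷ f) i) p (w i))))))
  where
  b = blockWeight (w ∘ suc) f p
  head : (d : Dec (toℕ p ≡ toℕ q)) → pick d (z ℤ.+ σ (w zero)) z ℤ.+ σ b ≡ z ℤ.+ σ (sel q p (w zero) + b)
  head d with q Fin.≟ p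
  head (yes _) | yes _ = trans (ℤₚ.+-assoc z _ _) (cong (λ x → z ℤ.+ x) (sym (σ+ (w zero) b)))
  head (yes e) | no q≢p = ⊥-elim (q≢p (Finₚ.toℕ-injective (sym e)))
  head (no ¬e) | yes e = ⊥-elim (¬e (cong toℕ (sym e)))
  head (no _) | no _ = refl

blockCount-count : ∀ {n r} (f : Vec (Fin n) r) (p : Fin n) c → blockCount f (toℕ p) c ≡ c + count (Fin._≟ p) f
blockCount-count [] p c = sym (ℕₚ.+-identityʳ c)
blockCount-count (q ∷ f) p c = trans (blockCount-count f p _) (head (toℕ p ℕ.≟ toℕ q))
  where
  head : (d : Dec (toℕ p ≡ toℕ q)) → pick d (suc c) c + count (Fin._≟ p) f ≡ c + count (Fin._≟ p) (q ∷ f)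
  head d with q Fin.≟ p
  head (yes _) | yes _ = sym (ℕₚ.+-suc c _)
  head (yes e) | no q≢p = ⊥-elim (q≢p (Finₚ.toℕ-injective (sym e)))
  head (no ¬e) | yes e = ⊥-elim (¬e (cong toℕ (sym e)))
  head (no _) | no _ = refl

prodℤ-cong : ∀ m {v w : ℕ → ℤ} → (∀ p → v p ≡ w p) → prodℤ m v ≡ prodℤ m w
prodℤ-cong zero h = refl
prodℤ-cong (suc m) h = cong₂ ℤ._*_ (prodℤ-cong m h) (h m)

prodℤ-front : ∀ m (v : ℕ → ℤ) → prodℤ (suc m) v ≡ v 0 ℤ.* prodℤ m (v ∘ suc)
prodℤ-front zero v = trans (ℤₚ.*-identityˡ (v 0)) (sym (ℤₚ.*-identityʳ (v 0)))
prodℤ-front (suc m) v = trans (cong (ℤ._* v (suc m)) (prodℤ-front m v)) (ℤₚ.*-assoc (v 0) _ _)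

prodℤ-Πᶠ : ∀ n (v : ℕ → ℤ) (F : Fin n → ℕ) → (∀ p → v (toℕ p) ≡ + F p) → prodℤ n v ≡ + Πᶠ F
prodℤ-Πᶠ zero v F h = refl
prodℤ-Πᶠ (suc n) v F h = trans (prodℤ-front n v) (trans (cong₂ ℤ._*_ (h zero) (prodℤ-Πᶠ n (v ∘ suc) (F ∘ suc) (h ∘ suc)))
  (trans (sym (ℤₚ.pos-* (F zero) _)) (cong +_ (sym (Πᶠ-suc F)))))

prodℤ-zero : ∀ n (v : ℕ → ℤ) (p : Fin n) → v (toℕ p) ≡ + 0 → prodℤ n v ≡ + 0
prodℤ-zero (suc n) v zero h = trans (prodℤ-front n v) (trans (cong (ℤ._* prodℤ n (v ∘ suc)) h) (ℤₚ.*-zeroˡ (prodℤ n (v ∘ suc))))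
prodℤ-zero (suc n) v (suc p) h = trans (prodℤ-front n v)
  (trans (cong (λ z → v 0 ℤ.* z) (prodℤ-zero n (v ∘ suc) p h)) (ℤₚ.*-zeroʳ (v 0)))

π-negative : ∀ {t} (l : Fin t → ℕ) → (∀ j → 1 ≤ l j) → ∀ z → z ℤ.< + 0 → (a : K t) →
             π z (Vec.tabulate (λ j → ℤ.- + l j)) a ≡ 𝟘
π-negative {zero} l l≥1 z z<0 (const x) with z ℤ.≟ + 0
... | yes z≡0 = ⊥-elim (ℤₚ.<-irrefl z≡0 z<0)
... | no _ = refl
π-negative {suc t} l l≥1 z z<0 (a +ε b) = cong₂ _+ε_ (π-negative (l ∘ suc) (l≥1 ∘ suc) z z<0 a)
  (π-negative (l ∘ suc) (l≥1 ∘ suc) (z ℤ.- + l zero) (ℤₚ.+-mono-<-≤ z<0 (ℤₚ.neg-≤-pos {l zero} {0})) b)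

-- A nonempty set of black vertices has negative weight, and `L` has no constant term. So each block
-- contains a white vertex, and the white word sees all blocks.
π-L-negative : ∀ {t} (l : Fin t → ℕ) → (∀ j → 1 ≤ l j) → π (+ 0) (Vec.tabulate (λ j → ℤ.- + l j)) (L t) ≡ 𝟘
π-L-negative {zero} l l≥1 = refl
π-L-negative {suc t} l l≥1 = cong₂ _+ε_ (π-L-negative (l ∘ suc) (l≥1 ∘ suc))
  (π-negative (l ∘ suc) (l≥1 ∘ suc) _ (subst (ℤ._< + 0) (sym (ℤₚ.+-identityˡ _)) (ℤₚ.neg-mono-< (ℤ.+<+ (l≥1 zero)))) (T t 0))

lower-π-L : ∀ {r t} z (ws : Vec ℤ r) (ws' : Vec ℤ t) → lower r (π z (ws Vec.++ ws') (L (r + t))) ≡ π z ws' (L t)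
lower-π-L z [] ws' = refl
lower-π-L z (w ∷ ws) ws' = lower-π-L z ws ws'

count-positive : ∀ {n r} (f : Vec (Fin n) r) (p : Fin n) i → lookup f i ≡ p → 1 ≤ count (Fin._≟ p) f
count-positive (q ∷ f) p zero refl with q Fin.≟ p
... | yes _ = s≤s z≤n
... | no q≢q = ⊥-elim (q≢q refl)
count-positive (q ∷ f) p (suc i) e with q Fin.≟ p
... | yes _ = s≤s z≤n
... | no _ = count-positive f p i e

count-Fin1 : ∀ {r} (f : Vec (Fin 1) r) p → count (Fin._≟ p) f ≡ r
count-Fin1 [] p = refl
count-Fin1 (zero ∷ f) zero = cong suc (count-Fin1 f zero)

vertexWeights : ∀ {s t} → (Fin s → ℕ) → (Fin t → ℕ) → Vec ℤ (s + t)
vertexWeights k l = Vec.tabulate (λ i → + k i) Vec.++ Vec.tabulate (λ j → ℤ.- + l j)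

module Partitions {s t} (k : Fin s → ℕ) (l : Fin t → ℕ) (k≥1 : ∀ i → 1 ≤ k i) (l≥1 : ∀ j → 1 ≤ l j) where

  open ≡-Reasoning

  ws⁺ : Vec ℤ s
  ws⁺ = Vec.tabulate (λ i → + k i)

  ws⁻ : Vec ℤ t
  ws⁻ = Vec.tabulate (λ j → ℤ.- + l j)

  𝓑 : K (s + t)
  𝓑 = π (+ 0) (vertexWeights k l) (L (s + t))

  Balanced : ∀ {n} → Vec (Fin n) s × Vec (Fin n) t → Set
  Balanced {n} (f , g) = ∀ p → blockWeight k f p ≡ blockWeight l g p

  balanced? : ∀ {n} (fg : Vec (Fin n) s × Vec (Fin n) t) → Dec (Balanced fg)
  balanced? (f , g) = Finₚ.all? (λ p → blockWeight k f p ℕ.≟ blockWeight l g p)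

  wordPairs : ∀ n → List (Vec (Fin n) s × Vec (Fin n) t)
  wordPairs n = pairs (words n 0 s) (λ _ → vecs (λ _ → allFin n))

  parts : ∀ n → List (Vec (Fin n) s × Vec (Fin n) t)
  parts n = filter balanced? (wordPairs n)

  enum-wordPairs : ∀ n → Enumerates (λ (f , g) → Growth n 0 f × ∀ (j : Fin t) → ⊤) (wordPairs n)
  enum-wordPairs n = enum-pairs _ (enum-words n s 0) (λ _ _ → enum-vecs _ (λ _ → enum-allFin n))

  -- When all vertices are distributed, a block is left with a constant: (size - 1)! if it is
  -- balanced, 0 otherwise.
  blockValue : ∀ {n} (f : Vec (Fin n) s) (g : Vec (Fin n) t) (p : Fin n) →
    runTop g (run f (λ _ → 𝓑)) (toℕ p) ≡ top (π (+ blockWeight k f p ℤ.- + blockWeight l g p) [] (H (blockSize f g p) 0))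
  blockValue f g p = trans
    (runTop-π g ws⁻ _ (λ q → blockSum ws⁺ f q (+ 0)) (λ q → blockCount f q 0)
      (run-π f ws⁺ ws⁻ (λ _ → 𝓑) (λ _ → + 0) (λ _ → 0) (λ _ → refl)) (toℕ p))
    (cong₂ (λ z c → top (π z [] (H c 0)))
      (trans (blockSum-tabulate (λ x → ℤ.- + x) refl (λ x y → ℤₚ.neg-distrib-+ (+ x) (+ y)) l g p (blockSum ws⁺ f (toℕ p) (+ 0)))
        (cong (ℤ._- + blockWeight l g p) (trans (blockSum-tabulate +_ refl (λ _ _ → refl) k f p (+ 0)) (ℤₚ.+-identityˡ (+ blockWeight k f p)))))
      (trans (blockCount-count g p _) (cong (ℕ._+ count (Fin._≟ p) g) (blockCount-count f p 0))))

  value : ∀ {n} → Vec (Fin n) s × Vec (Fin n) t → ℤ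
  value {n} (f , g) = prodℤ n (runTop g (run f (λ _ → 𝓑)))

  blockProduct : ∀ {n} → Vec (Fin n) s × Vec (Fin n) t → ℤ
  blockProduct (f , g) = + Πᶠ (λ p → (blockSize f g p ∸ 1) !)

  value-balanced : ∀ {n} (fg : Vec (Fin n) s × Vec (Fin n) t) → fg ∈ wordPairs n → Balanced fg → blockProduct fg ≡ value fg
  value-balanced {n} (f , g) fg∈ bal = sym (prodℤ-Πᶠ n _ _ λ p → trans (blockValue f g p)
    (trans (cong (λ z → top (π (z ℤ.- + blockWeight l g p) [] (H (blockSize f g p) 0))) (cong +_ (bal p)))
      (trans (cong (λ z → top (π z [] (H (blockSize f g p) 0))) (ℤₚ.+-inverseʳ (+ blockWeight l g p)))
        (factor (blockSize f g p) (ℕₚ.≤-trans (nonempty p) (ℕₚ.m≤m+n _ _))))))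
    where
    nonempty : ∀ p → 1 ≤ count (Fin._≟ p) f
    nonempty p = let (i , e) = proj₁ (growth⇒canonical 0 f (proj₁ (∈⇒P (enum-wordPairs n) fg∈))) p z≤n in count-positive f p i e
    factor : ∀ c → 1 ≤ c → top (π (+ 0) [] (H c 0)) ≡ + ((c ∸ 1) !)
    factor (suc c) _ = refl

  value-unbalanced : ∀ {n} (fg : Vec (Fin n) s × Vec (Fin n) t) → fg ∈ wordPairs n → ¬ Balanced fg → value fg ≡ + 0
  value-unbalanced {n} (f , g) _ ¬bal with Finₚ.¬∀⟶∃¬ n _ (λ p → blockWeight k f p ℕ.≟ blockWeight l g p) ¬bal
  ... | p , ¬eq = prodℤ-zero n _ p (trans (blockValue f g p) (vanish (+ blockWeight k f p ℤ.- + blockWeight l g p) (blockSize f g p)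
      (λ e → ¬eq (ℤₚ.+-injective (ℤₚ.i-j≡0⇒i≡j _ _ e)))))
    where
    vanish : ∀ z c → z ≢ + 0 → top (π z [] (H c 0)) ≡ + 0
    vanish z zero z≢0 with z ℤ.≟ + 0
    ... | yes e = ⊥-elim (z≢0 e)
    ... | no _ = refl
    vanish z (suc c) z≢0 with z ℤ.≟ + 0
    ... | yes e = ⊥-elim (z≢0 e)
    ... | no _ = refl

  -- The n! in the divided power accounts for the blocks being unordered: a growth word numbers them
  -- in just one way. Unbalanced distributions contribute 0 and may be added to the sum.
  ∑-parts : ∀ n → ∑ (parts n) blockProduct ≡ top (dp n 𝓑)
  ∑-parts n = begin
    ∑ (parts n) blockProduct                       ≡⟨ ∑-filter balanced? blockProduct value (wordPairs n) value-balanced value-unbalanced ⟩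
    ∑ (wordPairs n) value                          ≡⟨ ∑-pairs (words n 0 s) _ value ⟩
    ∑ (words n 0 s) (λ f → ∑ (vecs {n = t} (λ _ → allFin n)) (λ g → value (f , g)))
                                                   ≡⟨ ∑-cong (words n 0 s) (λ f → ∑-runTop n (run f (λ _ → 𝓑))) ⟩
    ∑ (words n 0 s) (λ f → top (prodN n (run {t = t} f (λ _ → 𝓑))))
      ≡⟨ ∑-words n s 0 (λ _ → 𝓑) 𝓑 z≤n (λ _ _ → refl) (trans (lower-π-L (+ 0) ws⁺ ws⁻) (π-L-negative l l≥1)) ⟩
    top (dp n 𝓑 ⊛ 𝟙)                               ≡⟨ cong top (⊛-identityʳ (dp n 𝓑)) ⟩
    top (dp n 𝓑)                                   ∎

  blockNumbers : List ℕ
  blockNumbers = map suc (upTo (s + t))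

  allParts : List (PData s t)
  allParts = pairs blockNumbers parts

  enum-allParts : Enumerates (IsPartition k l) allParts
  enum-allParts = enum-⇔ sound complete
      (enum-pairs {𝑃 = λ n → 1 ≤ n × n ≤ s + t} {𝑄 = λ n (f , g) → (Growth n 0 f × (∀ (j : Fin t) → ⊤)) × Balanced (f , g)}
        parts enum-blockNumbers (λ n _ → enum-filter balanced? (enum-wordPairs n)))
    where
    enum-blockNumbers : Enumerates (λ n → 1 ≤ n × n ≤ s + t) blockNumbers
    enum-blockNumbers = Uniqueₚ.map⁺ ℕₚ.suc-injective (Uniqueₚ.upTo⁺ _) ,
      All.tabulate (λ n∈ → bound n∈) ,
      λ { (suc n) (_ , le) → ∈-map⁺ suc (∈-upTo⁺ le) }
      where
      bound : ∀ {n} → n ∈ blockNumbers → 1 ≤ n × n ≤ s + t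
      bound n∈ with ∈-map⁻ suc n∈
      ... | m , m∈ , refl = s≤s z≤n , ∈-upTo⁻ m∈
    sound : ∀ x → _ → IsPartition k l x
    sound (n , f , g) ((n≥1 , _) , (growth , _) , bal) = n≥1 , onto , onto-g , bal , ordered
      where
      onto : ∀ p → ∃[ i ] lookup f i ≡ p
      onto p = proj₁ (growth⇒canonical 0 f growth) p z≤n
      onto-g : ∀ p → ∃[ j ] lookup g j ≡ p
      -- The white weight of a block is positive, and balance carries this over to the black side.
      onto-g p = blockWeight-positive⁻ l g p (subst (1 ℕ.≤_) (bal p) (blockWeight-positive k k≥1 f p (proj₁ (onto p)) (proj₂ (onto p))))
      ordered : ∀ i (p : Fin n) → toℕ p < toℕ (lookup f i) → _
      ordered i p lt with proj₂ (growth⇒canonical 0 f growth) i p lt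
      ... | inj₂ e = e
    complete : ∀ x → IsPartition k l x → _
    complete (n , f , g) (n≥1 , onto , _ , bal , ordered) = (n≥1 , ℕₚ.≤-trans (growth-bound 0 f growth) (ℕₚ.m≤m+n s t)) , (growth , λ _ → tt) , bal
      where
      growth = canonical⇒growth 0 f z≤n ((λ p _ → onto p) , λ i p lt → inj₂ (ordered i p lt))

  module _ {N} (s+t≡1+N : s + t ≡ suc N) (N≥1 : 1 ≤ N) where

    N² : ℤ
    N² = + N ℤ.* + N

    -- After multiplication by N², with N = v - 1, the exceptional summand (v - 2)! of the trivial
    -- partition fits the formula of the others, because N² (N - 1)! = N N!.
    summand-scaled : ∀ n (fg : Vec (Fin (suc n)) s × Vec (Fin (suc n)) t) →
      N² ℤ.* summand (s + t) (suc n , fg) ≡ (ℤ.- ((ℤ.- + N) ℤ.^ suc n)) ℤ.* blockProduct fg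
    summand-scaled zero (f , g) = begin
      N² ℤ.* + ((s + t ∸ 2) !)               ≡⟨ cong (λ v → N² ℤ.* + ((v ∸ 2) !)) s+t≡1+N ⟩
      N² ℤ.* + ((N ∸ 1) !)                     ≡⟨ ℤₚ.*-assoc (+ N) (+ N) _ ⟩
      + N ℤ.* (+ N ℤ.* + ((N ∸ 1) !))          ≡⟨ cong (λ z → + N ℤ.* z) (trans (sym (ℤₚ.pos-* N _)) (cong +_ (factorial N N≥1))) ⟩
      + N ℤ.* + (N !)                            ≡⟨ cong (ℤ._* + (N !)) (sign (+ N)) ⟨
      (ℤ.- ((ℤ.- + N) ℤ.^ 1)) ℤ.* + (N !)        ≡⟨ cong (λ z → (ℤ.- ((ℤ.- + N) ℤ.^ 1)) ℤ.* + z)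
        (trans (cong (λ c → (c ∸ 1) !) (sym (trans (cong₂ ℕ._+_ (count-Fin1 f zero) (count-Fin1 g zero)) s+t≡1+N)))
          (sym (ℕₚ.*-identityʳ ((blockSize f g zero ∸ 1) !)))) ⟩
      (ℤ.- ((ℤ.- + N) ℤ.^ 1)) ℤ.* blockProduct (f , g) ∎
      where
      factorial : ∀ n → 1 ≤ n → n * (n ∸ 1) ! ≡ n !
      factorial (suc n) _ = refl
      sign : ∀ x → ℤ.- ((ℤ.- x) ℤ.* + 1) ≡ x
      sign = ℤ-solve-∀
    summand-scaled (suc m) (f , g) = begin
      N² ℤ.* (-1ℤ ℤ.^ suc m ℤ.* (+ ((s + t ∸ 1) ℕ.^ m) ℤ.* P))
        ≡⟨ cong (λ v → N² ℤ.* (-1ℤ ℤ.^ suc m ℤ.* (v ℤ.* P))) (trans (cong (λ v → + ((v ∸ 1) ℕ.^ m)) s+t≡1+N) (pos-^ N m)) ⟩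
      N² ℤ.* (-1ℤ ℤ.^ suc m ℤ.* ((+ N) ℤ.^ m ℤ.* P))
        ≡⟨ regroup (+ N) (-1ℤ ℤ.^ m) ((+ N) ℤ.^ m) P ⟩
      (ℤ.- (((ℤ.- + N) ℤ.* (ℤ.- + N)) ℤ.* (-1ℤ ℤ.^ m ℤ.* (+ N) ℤ.^ m))) ℤ.* P
        ≡⟨ cong (λ z → (ℤ.- (((ℤ.- + N) ℤ.* (ℤ.- + N)) ℤ.* z)) ℤ.* P) (neg-^ (+ N) m) ⟩
      (ℤ.- (((ℤ.- + N) ℤ.* (ℤ.- + N)) ℤ.* (ℤ.- + N) ℤ.^ m)) ℤ.* P
        ≡⟨ cong (λ z → (ℤ.- z) ℤ.* P) (ℤₚ.*-assoc (ℤ.- + N) (ℤ.- + N) ((ℤ.- + N) ℤ.^ m)) ⟩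
      (ℤ.- ((ℤ.- + N) ℤ.^ suc (suc m))) ℤ.* P ∎
      where
      P = blockProduct (f , g)
      pos-^ : ∀ a m → + (a ℕ.^ m) ≡ (+ a) ℤ.^ m
      pos-^ a zero = refl
      pos-^ a (suc m) = trans (ℤₚ.pos-* a (a ℕ.^ m)) (cong (λ z → + a ℤ.* z) (pos-^ a m))
      neg-^ : ∀ a m → -1ℤ ℤ.^ m ℤ.* a ℤ.^ m ≡ (ℤ.- a) ℤ.^ m
      neg-^ a zero = refl
      neg-^ a (suc m) = trans (pull a (-1ℤ ℤ.^ m) (a ℤ.^ m)) (cong (λ z → (ℤ.- a) ℤ.* z) (neg-^ a m))
        where
        pull : ∀ a x y → (-1ℤ ℤ.* x) ℤ.* (a ℤ.* y) ≡ (ℤ.- a) ℤ.* (x ℤ.* y)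
        pull a x y = trans (cong (ℤ._* (a ℤ.* y)) (ℤₚ.-1*i≡-i x)) (swap a x y)
          where
          swap : ∀ a x y → (ℤ.- x) ℤ.* (a ℤ.* y) ≡ (ℤ.- a) ℤ.* (x ℤ.* y)
          swap = ℤ-solve-∀
      regroup : ∀ n x y p → (n ℤ.* n) ℤ.* ((-1ℤ ℤ.* x) ℤ.* (y ℤ.* p)) ≡ (ℤ.- (((ℤ.- n) ℤ.* (ℤ.- n)) ℤ.* (x ℤ.* y))) ℤ.* p
      regroup n x y p = trans (cong (λ z → (n ℤ.* n) ℤ.* (z ℤ.* (y ℤ.* p))) (ℤₚ.-1*i≡-i x)) (swap n x y p)
        where
        swap : ∀ n x y p → (n ℤ.* n) ℤ.* ((ℤ.- x) ℤ.* (y ℤ.* p)) ≡ (ℤ.- (((ℤ.- n) ℤ.* (ℤ.- n)) ℤ.* (x ℤ.* y))) ℤ.* p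
        swap = ℤ-solve-∀

    ∑-allParts : N² ℤ.* sumℤ (map (summand (s + t)) allParts) ≡ ℤ.- top (exp (ι (ℤ.- + N) ⊛ 𝓑))
    ∑-allParts = begin
      N² ℤ.* ∑ allParts (summand (s + t))
        ≡⟨ ∑-*ˡ N² allParts (summand (s + t)) ⟨
      ∑ allParts (λ x → N² ℤ.* summand (s + t) x)
        ≡⟨ trans (∑-pairs blockNumbers parts _) (∑-map suc (upTo (s + t)) _) ⟩
      ∑ (upTo (s + t)) (λ n → ∑ (parts (suc n)) (λ fg → N² ℤ.* summand (s + t) (suc n , fg)))
        ≡⟨ ∑-cong (upTo (s + t)) (λ n → trans (∑-cong (parts (suc n)) (summand-scaled n))
             (trans (∑-*ˡ (ℤ.- ((ℤ.- + N) ℤ.^ suc n)) (parts (suc n)) blockProduct)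
               (trans (cong (λ z → (ℤ.- ((ℤ.- + N) ℤ.^ suc n)) ℤ.* z) (∑-parts (suc n))) (negate ((ℤ.- + N) ℤ.^ suc n) (top (dp (suc n) 𝓑)))))) ⟩
      ∑ (upTo (s + t)) (λ n → -1ℤ ℤ.* term (suc n))
        ≡⟨ ∑-*ˡ -1ℤ (upTo (s + t)) (term ∘ suc) ⟩
      -1ℤ ℤ.* ∑ (upTo (s + t)) (term ∘ suc)
        ≡⟨ trans (ℤₚ.-1*i≡-i _) (cong ℤ.-_ (∑-upTo (s + t) (term ∘ suc))) ⟩
      ℤ.- sumN (s + t) (term ∘ suc)
        ≡⟨ cong ℤ.-_ (trans (sumN-front (s + t) term) (trans (cong (ℤ._+ sumN (s + t) (term ∘ suc)) term-0) (ℤₚ.+-identityˡ _))) ⟨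
      ℤ.- sumN (suc (s + t)) term
        ≡⟨ cong ℤ.-_ (trans (cong top (exp-dp (s + t) (ℤ.- + N) 𝓑 ℕₚ.≤-refl))
             (trans (top-∑K (suc (s + t)) (λ j → ι ((ℤ.- + N) ℤ.^ j) ⊛ dp j 𝓑)) (sumN-cong (suc (s + t)) (λ j _ → top-ι⊛ ((ℤ.- + N) ℤ.^ j) (dp j 𝓑))))) ⟨
      ℤ.- top (exp (ι (ℤ.- + N) ⊛ 𝓑)) ∎
      where
      term : ℕ → ℤ
      term j = (ℤ.- + N) ℤ.^ j ℤ.* top (dp j 𝓑)
      negate : ∀ x y → (ℤ.- x) ℤ.* y ≡ -1ℤ ℤ.* (x ℤ.* y)
      negate x y = trans (sym (ℤₚ.neg-distribˡ-* x y)) (sym (ℤₚ.-1*i≡-i (x ℤ.* y)))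
      -- The exponential also has a term without blocks; its top coefficient is 0 since there is at
      -- least one vertex.
      term-0 : term 0 ≡ + 0
      term-0 = trans (ℤₚ.*-identityˡ _) (trans (cong top (dp-0 𝓑)) (top-𝟙 s+t≡1+N))
        where
        top-𝟙 : ∀ {n m} → n ≡ suc m → top {n} 𝟙 ≡ + 0
        top-𝟙 {m = m} refl = top-𝟘 m
      ∑-upTo : ∀ m (F : ℕ → ℤ) → ∑ (upTo m) F ≡ sumN m F
      ∑-upTo zero F = refl
      ∑-upTo (suc m) F = trans (cong (λ z → F 0 ℤ.+ sumℤ z) (trans (Listₚ.map-applyUpTo suc F m) (sym (Listₚ.map-upTo (F ∘ suc) m))))
        (trans (cong (λ z → F 0 ℤ.+ z) (∑-upTo m (F ∘ suc))) (sym (sumN-front m F)))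

-- Cutting and joining trees

Minus : {V : Set} → (V → V → Set) → V → V → V → V → Set
Minus E a b u v = E u v × ¬ (u ≡ a × v ≡ b) × ¬ (u ≡ b × v ≡ a)

-- The form of acyclicity used for cutting and joining: it speaks of walks only, so it can be
-- restricted and transported without handling lists of vertices.
Bridges : {V : Set} → (V → V → Set) → Set
Bridges E = ∀ a b → E a b → ¬ Star (Minus E a b) a b

Minus-sym : {V : Set} {E : V → V → Set} {a b : V} → Symmetric E → Symmetric (Minus E a b)
Minus-sym s (e , p , q) = s e , (λ (x , y) → q (y , x)) , (λ (x , y) → p (y , x))

Minus-mono : {V : Set} {E F : V → V → Set} {a b u v : V} → (E u v → F u v) → Minus E a b u v → Minus F a b u v
Minus-mono f (e , p , q) = f e , p , q

module Cycles {V : Set} (_≟_ : DecidableEquality V) {E : V → V → Set} (E-sym : Symmetric E) (E-irrefl : ∀ a → ¬ E a a) where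

  infixr 5 _∷_

  data Path (F : V → V → Set) : V → V → List V → Set where
    end : ∀ u → Path F u u (u ∷ [])
    _∷_ : ∀ {u w v ps} → F u w → Path F w v ps → Path F u v (u ∷ ps)

  module _ {F : V → V → Set} where

    suffix : ∀ {u w v ps} → u ∈ ps → Path F w v ps → Unique ps → ∃[ qs ] Path F u v qs × Unique qs
    suffix (here refl) (end _) unique = _ , end _ , unique
    suffix (here refl) (f ∷ p) unique = _ , f ∷ p , unique
    suffix (there u∈) (f ∷ p) (_ ∷ unique) = suffix u∈ p unique

    simplePath : ∀ {u v} → Star F u v → ∃[ ps ] Path F u v ps × Unique ps
    simplePath {u} nil = _ , end u , ([] ∷ [])
    simplePath {u} (f ◅ star) with simplePath star
    ... | ps , p , unique with _∈?_ _≟_ u ps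
    ...   | yes u∈ = suffix u∈ p unique
    ...   | no u∉ = u ∷ ps , f ∷ p , Allₚ.¬Any⇒All¬ ps u∉ ∷ unique

  closePath : ∀ {F : V → V → Set} {u v w ps} → (∀ {x y} → F x y → E x y) → Path F u v ps → E v w → Linked E (ps ++ w ∷ [])
  closePath h (end u) e = e ∷ [-]
  closePath h (f ∷ p@(end _)) e = h f ∷ closePath h p e
  closePath h (f ∷ p@(_ ∷ _)) e = h f ∷ closePath h p e

  -- Shorten a walk around the edge to a simple path. It is neither empty nor the edge itself, so it
  -- has at least three vertices and closes to a cycle.
  acyclic⇒bridges : (∀ v vs → 2 ≤ length vs → Unique (v ∷ vs) → ¬ Linked E ((v ∷ vs) ++ v ∷ [])) → Bridges E
  acyclic⇒bridges acyclic a b e star with simplePath star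
  ... | _ , end _ , _ = E-irrefl a e
  ... | _ , (_ , p , _) ∷ end _ , _ = p (refl , refl)
  ... | _ , path@(_ ∷ (_ ∷ end _)) , unique = acyclic _ _ (s≤s (s≤s z≤n)) unique (closePath proj₁ path (E-sym e))
  ... | _ , path@(_ ∷ (_ ∷ (_ ∷ _))) , unique = acyclic _ _ (s≤s (s≤s z≤n)) unique (closePath proj₁ path (E-sym e))

  walk : ∀ {v x} y zs → Linked E ((y ∷ zs) ++ v ∷ []) → All (v ≢_) (y ∷ zs) → All (x ≢_) (y ∷ zs) → Star (Minus E x v) y v
  walk y [] (e ∷ _) (v≢y ∷ _) (x≢y ∷ _) = (e , (λ (p , _) → x≢y (sym p)) , (λ (p , _) → v≢y (sym p))) ◅ nil
  walk y (z ∷ zs) (e ∷ l) (v≢y ∷ vs) (x≢y ∷ xs) = (e , (λ (p , _) → x≢y (sym p)) , (λ (p , _) → v≢y (sym p))) ◅ walk z zs l vs xs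

  -- The edges of a cycle other than its first one form a walk between the ends of the first.
  bridges⇒acyclic : Bridges E → ∀ v vs → 2 ≤ length vs → Unique (v ∷ vs) → ¬ Linked E ((v ∷ vs) ++ v ∷ [])
  bridges⇒acyclic bridges v (x ∷ []) (s≤s ()) _ _
  bridges⇒acyclic bridges v (x ∷ y ∷ zs) _ ((v≢x ∷ v≢y ∷ v≢zs) ∷ ((x≢y ∷ x≢zs) ∷ _)) (e ∷ (e' ∷ l)) =
    bridges x v (E-sym e) ((e' , (λ (_ , p) → v≢y (sym p)) , (λ (p , _) → v≢x (sym p))) ◅ walk y zs l (v≢y ∷ v≢zs) (x≢y ∷ x≢zs))

-- Pushes a walk of a joined tree into one of its two parts: the edges of that part are kept, all
-- others are contracted by `p`.
collapse : {V : Set} {E F : V → V → Set} {u v : V} (p : V → V) →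
           (∀ x y → E x y → (F x y × p x ≡ x × p y ≡ y) ⊎ p x ≡ p y) →
           ∀ {x y} → Star (Minus E u v) x y → Star (Minus F u v) (p x) (p y)
collapse p h nil = nil
collapse {F = F} {u} {v} p h {x} {y} ((e , q , r) ◅ star) with h _ _ e
... | inj₁ (f , px , py) = subst₂ (Minus F u v) (sym px) (sym py) (f , q , r) ◅ collapse p h star
... | inj₂ eq = subst (λ z → Star (Minus F u v) z (p y)) (sym eq) (collapse p h star)

-- Trees on vertex subsets, given by weight matrices

Mat : ℕ → ℕ → Set
Mat s t = Vec (Vec ℕ t) s

Sub : ℕ → ℕ → Set
Sub s t = Vec Bool (s + t)

-- The admissible rows in the membership table of a disjoint union: first part, second part, whole.
data Part : Bool → Bool → Bool → Set where
  outside : Part false false false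
  left    : Part true  false true
  right   : Part false true  true

part-⊆ˡ : ∀ {a b c} → Part a b c → a ≡ true → c ≡ true
part-⊆ˡ left refl = refl

part-⊆ʳ : ∀ {a b c} → Part a b c → b ≡ true → c ≡ true
part-⊆ʳ right refl = refl

part-outsideˡ : ∀ {a b c} → Part a b c → b ≡ true → a ≡ false
part-outsideˡ right refl = refl

part-outsideʳ : ∀ {a b c} → Part a b c → a ≡ true → b ≡ false
part-outsideʳ left refl = refl

part-disjoint : ∀ {a b c} → Part a b c → a ≡ true → b ≡ true → ⊥
part-disjoint left refl ()

part-cover : ∀ {a b c} → Part a b c → c ≡ true → a ≡ true ⊎ b ≡ true
part-cover left _ = inj₁ refl
part-cover right _ = inj₂ refl

nonPositive : ∀ {n} → ¬ 0 < n → n ≡ 0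
nonPositive {zero} _ = refl
nonPositive {suc n} h = ⊥-elim (h (s≤s z≤n))

module _ {s t : ℕ} where

  _≟ⱽ_ : DecidableEquality (Vertex s t)
  _≟ⱽ_ = Sumₚ.≡-dec Fin._≟_ Fin._≟_

  mem : Sub s t → Vertex s t → Bool
  mem S (inj₁ i) = lookup S (i ↑ˡ t)
  mem S (inj₂ j) = lookup S (s ↑ʳ j)

  infix 4 _∈ₛ_
  _∈ₛ_ : Vertex s t → Sub s t → Set
  v ∈ₛ S = mem S v ≡ true

  subset : (Vertex s t → Bool) → Sub s t
  subset f = Vec.tabulate (f ∘ inj₁) Vec.++ Vec.tabulate (f ∘ inj₂)

  mem-subset : ∀ f v → mem (subset f) v ≡ f v
  mem-subset f (inj₁ i) = trans (Vecₚ.lookup-++ˡ (Vec.tabulate (f ∘ inj₁)) _ i) (Vecₚ.lookup∘tabulate (f ∘ inj₁) i)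
  mem-subset f (inj₂ j) = trans (Vecₚ.lookup-++ʳ (Vec.tabulate (f ∘ inj₁)) _ j) (Vecₚ.lookup∘tabulate (f ∘ inj₂) j)

  lookup-mem : ∀ (S : Sub s t) x → ∃[ v ] (∀ S' → lookup S' x ≡ mem S' v)
  lookup-mem S x with Fin.splitAt s x in eq
  ... | inj₁ i = inj₁ i , λ S' → cong (lookup S') (sym (trans (cong (Fin.join s t) (sym eq)) (Finₚ.join-splitAt s t x)))
  ... | inj₂ j = inj₂ j , λ S' → cong (lookup S') (sym (trans (cong (Fin.join s t) (sym eq)) (Finₚ.join-splitAt s t x)))

  mem-ext : ∀ {S S'} → (∀ v → mem S v ≡ mem S' v) → S ≡ S'
  mem-ext {S} {S'} h = trans (sym (Vecₚ.tabulate∘lookup S)) (trans (Vecₚ.tabulate-cong pointwise) (Vecₚ.tabulate∘lookup S'))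
    where
    pointwise : ∀ x → lookup S x ≡ lookup S' x
    pointwise x = let (v , e) = lookup-mem S x in trans (e S) (trans (h v) (sym (e S')))

  ent : Mat s t → Fin s → Fin t → ℕ
  ent W i j = lookup (lookup W i) j

  mat : (Fin s → Fin t → ℕ) → Mat s t
  mat f = Vec.tabulate (λ i → Vec.tabulate (f i))

  ent-mat : ∀ f i j → ent (mat f) i j ≡ f i j
  ent-mat f i j = trans (cong (λ r → lookup r j) (Vecₚ.lookup∘tabulate (λ i → Vec.tabulate (f i)) i)) (Vecₚ.lookup∘tabulate (f i) j)

  mat-ext : ∀ {W W'} → (∀ i j → ent W i j ≡ ent W' i j) → W ≡ W'
  mat-ext {W} {W'} h = trans (sym (rebuild W)) (trans (Vecₚ.tabulate-cong (λ i → Vecₚ.tabulate-cong (h i))) (rebuild W'))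
    where
    rebuild : ∀ W → mat (ent W) ≡ W
    rebuild W = trans (Vecₚ.tabulate-cong (λ i → Vecₚ.tabulate∘lookup (lookup W i))) (Vecₚ.tabulate∘lookup W)

  Adj-sym : (W : Mat s t) → Symmetric (Adj W)
  Adj-sym W {inj₁ _} {inj₂ _} e = e
  Adj-sym W {inj₂ _} {inj₁ _} e = e

  Adj-irrefl : (W : Mat s t) → ∀ u → ¬ Adj W u u
  Adj-irrefl W (inj₁ _) ()
  Adj-irrefl W (inj₂ _) ()

  acyclic⇒bridges : (W : Mat s t) → Acyclic W → Bridges (Adj W)
  acyclic⇒bridges W acyclic = Cycles.acyclic⇒bridges _≟ⱽ_ (Adj-sym W) (Adj-irrefl W) (λ v vs a b c → acyclic (v ∷ vs) (a , b , c))

  bridges⇒acyclic : (W : Mat s t) → Bridges (Adj W) → Acyclic W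
  bridges⇒acyclic W bridges (v ∷ vs) (a , b , c) = Cycles.bridges⇒acyclic _≟ⱽ_ (Adj-sym W) (Adj-irrefl W) bridges v vs a b c

  -- The matrix keeps its full size and the vertices outside `S` are isolated, so subtrees are never
  -- reindexed.
  record TreeOn (S : Sub s t) (W : Mat s t) : Set where
    constructor treeOn
    field
      supp    : ∀ u v → Adj W u v → u ∈ₛ S
      conn    : ∀ u v → u ∈ₛ S → v ∈ₛ S → Star (Adj W) u v
      bridges : Bridges (Adj W)

  open TreeOn public

  supp₂ : ∀ {S W} → TreeOn S W → ∀ u v → Adj W u v → v ∈ₛ S
  supp₂ {W = W} T u v e = supp T v u (Adj-sym W e)

  Splits : Sub s t → Sub s t → Sub s t → Set
  Splits S S₁ S₂ = ∀ v → Part (mem S₁ v) (mem S₂ v) (mem S v)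

  module _ {X Y : Set} where

    -- A vertex is assigned to a side by a proof that exists for members only, hence the guard `m`.
    leftOf rightOf : ∀ m → (m ≡ true → X ⊎ Y) → Bool
    leftOf false h = false
    leftOf true  h = Sum.[ (λ _ → true) , (λ _ → false) ]′ (h refl)
    rightOf false h = false
    rightOf true  h = Sum.[ (λ _ → false) , (λ _ → true) ]′ (h refl)

    part-sides : ∀ m h → Part (leftOf m h) (rightOf m h) m
    part-sides false h = outside
    part-sides true h with h refl
    ... | inj₁ _ = left
    ... | inj₂ _ = right

    leftOf-true : ∀ m h → leftOf m h ≡ true → X
    leftOf-true true h e with h refl
    ... | inj₁ x = x

    rightOf-true : ∀ m h → rightOf m h ≡ true → Y
    rightOf-true true h e with h refl
    ... | inj₂ y = y

  restrictEntry : Bool → Bool → ℕ → ℕ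
  restrictEntry true true x = x
  restrictEntry _    _    x = 0

  restrict : Mat s t → Sub s t → Mat s t
  restrict W S = mat (λ i j → restrictEntry (mem S (inj₁ i)) (mem S (inj₂ j)) (ent W i j))

  restrictEntry-positive : ∀ a b x → 0 < restrictEntry a b x → a ≡ true × b ≡ true × 0 < x
  restrictEntry-positive true true x p = refl , refl , p

  restrictEntry-select : ∀ p q n m → (0 < n → p ≡ true × q ≡ true) → (p ≡ true → q ≡ true → m ≡ 0) → restrictEntry p q (n + m) ≡ n
  restrictEntry-select true true n m _ g = trans (cong (n ℕ.+_) (g refl refl)) (ℕₚ.+-identityʳ n)
  restrictEntry-select true false zero m h _ = refl
  restrictEntry-select true false (suc n) m h _ with proj₂ (h (s≤s z≤n))
  ... | ()
  restrictEntry-select false q zero m h _ = refl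
  restrictEntry-select false q (suc n) m h _ with proj₁ (h (s≤s z≤n))
  ... | ()

  Adj-restrict⁻ : ∀ W S u v → Adj (restrict W S) u v → u ∈ₛ S × v ∈ₛ S × Adj W u v
  Adj-restrict⁻ W S (inj₁ i) (inj₂ j) e = restrictEntry-positive _ _ _ (subst (0 <_) (ent-mat _ i j) e)
  Adj-restrict⁻ W S (inj₂ j) (inj₁ i) e with restrictEntry-positive _ _ _ (subst (0 <_) (ent-mat _ i j) e)
  ... | p , q , r = q , p , r

  Adj-restrict⁺ : ∀ W S u v → u ∈ₛ S → v ∈ₛ S → Adj W u v → Adj (restrict W S) u v
  Adj-restrict⁺ W S (inj₁ i) (inj₂ j) p q e = subst (0 <_) (sym (trans (ent-mat _ i j) (cong₂ (λ a b → restrictEntry a b (ent W i j)) p q))) e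
  Adj-restrict⁺ W S (inj₂ j) (inj₁ i) p q e = subst (0 <_) (sym (trans (ent-mat _ i j) (cong₂ (λ a b → restrictEntry a b (ent W i j)) q p))) e

  δ : Fin s → Fin t → ℕ → Fin s → Fin t → ℕ
  δ i j c x y with x Fin.≟ i | y Fin.≟ j
  ... | yes _ | yes _ = c
  ... | _     | _     = 0

  δ-hit : ∀ i j c → δ i j c i j ≡ c
  δ-hit i j c with i Fin.≟ i | j Fin.≟ j
  ... | yes _ | yes _ = refl
  ... | no ¬p | _ = ⊥-elim (¬p refl)
  ... | yes _ | no ¬p = ⊥-elim (¬p refl)

  δ-miss : ∀ i j c x y → ¬ (x ≡ i × y ≡ j) → δ i j c x y ≡ 0
  δ-miss i j c x y h with x Fin.≟ i | y Fin.≟ j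
  ... | yes p | yes q = ⊥-elim (h (p , q))
  ... | yes _ | no _ = refl
  ... | no _ | yes _ = refl
  ... | no _ | no _ = refl

  Joined : Mat s t → Mat s t → Fin s → Fin t → ℕ → Mat s t → Set
  Joined W₁ W₂ i j c W = ∀ x y → ent W x y ≡ ent W₁ x y + ent W₂ x y + δ i j c x y

  module _ {S : Sub s t} {W : Mat s t} (T : TreeOn S W) (i : Fin s) (j : Fin t) (edge : 0 < ent W i j) where

    private
      a b : Vertex s t
      a = inj₁ i
      b = inj₂ j
      E' : Vertex s t → Vertex s t → Set
      E' = Minus (Adj W) a b
      E'-sym : Symmetric E'
      E'-sym = Minus-sym (Adj-sym W)

    -- Follow a walk of the tree and keep track of the end of the deleted edge from which the
    -- current vertex is reached; crossing that edge restarts at its other end.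
    reach : ∀ {u v} → Star (Adj W) u v → Star E' a u ⊎ Star E' b u → Star E' a v ⊎ Star E' b v
    reach nil r = r
    reach {u} (_◅_ {j = w} e star) r with (u ≟ⱽ a) ×-dec (w ≟ⱽ b) | (u ≟ⱽ b) ×-dec (w ≟ⱽ a)
    ... | yes (refl , refl) | _ = reach star (inj₂ nil)
    ... | no _ | yes (refl , refl) = reach star (inj₁ nil)
    ... | no p | no q = reach star (Sum.map (_◅◅ (e , p , q) ◅ nil) (_◅◅ (e , p , q) ◅ nil) r)

    side : ∀ v → v ∈ₛ S → Star E' a v ⊎ Star E' b v
    side v v∈ = reach (conn T a v (supp T a b edge) v∈) (inj₁ nil)

    apart : ∀ {v} → Star E' a v → ¬ Star E' b v
    apart p q = bridges T a b edge (p ◅◅ Star.reverse E'-sym q)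

    isLeft isRight : Vertex s t → Bool
    isLeft v = leftOf (mem S v) (side v)
    isRight v = rightOf (mem S v) (side v)

    -- Membership is computed from the walks that connectedness supplies, by reading off the end
    -- assigned by `side`.
    leftPart rightPart : Sub s t
    leftPart = subset isLeft
    rightPart = subset isRight

    splits-cut : Splits S leftPart rightPart
    splits-cut v = subst₂ (λ x y → Part x y (mem S v)) (sym (mem-subset isLeft v)) (sym (mem-subset isRight v)) (part-sides (mem S v) (side v))

    left⇒reach : ∀ v → v ∈ₛ leftPart → Star E' a v
    left⇒reach v p = leftOf-true (mem S v) (side v) (trans (sym (mem-subset isLeft v)) p)

    right⇒reach : ∀ v → v ∈ₛ rightPart → Star E' b v
    right⇒reach v p = rightOf-true (mem S v) (side v) (trans (sym (mem-subset isRight v)) p)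

    reach⇒left : ∀ v → v ∈ₛ S → Star E' a v → v ∈ₛ leftPart
    reach⇒left v v∈ star with part-cover (splits-cut v) v∈
    ... | inj₁ p = p
    ... | inj₂ p = ⊥-elim (apart star (right⇒reach v p))

    reach⇒right : ∀ v → v ∈ₛ S → Star E' b v → v ∈ₛ rightPart
    reach⇒right v v∈ star with part-cover (splits-cut v) v∈
    ... | inj₁ p = ⊥-elim (apart (left⇒reach v p) star)
    ... | inj₂ p = p

    -- Walks that avoid the deleted edge stay inside the component of `r`, so connectedness survives
    -- the restriction; an edge that is a bridge remains one when edges are removed.
    restrict-tree : ∀ S' r → (∀ v → v ∈ₛ S' → Star E' r v) → (∀ v → v ∈ₛ S → Star E' r v → v ∈ₛ S') → TreeOn S' (restrict W S')
    restrict-tree S' r from to = treeOn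
      (λ u v e → proj₁ (Adj-restrict⁻ W S' u v e))
      (λ u v u∈ v∈ → stay (Star.reverse E'-sym (from u u∈) ◅◅ from v v∈) u∈)
      (λ u v e star → bridges T u v (proj₂ (proj₂ (Adj-restrict⁻ W S' u v e)))
        (Star.map (λ {x} {y} → Minus-mono {E = Adj (restrict W S')} {F = Adj W} (λ f → proj₂ (proj₂ (Adj-restrict⁻ W S' x y f)))) star))
      where
      stay : ∀ {u v} → Star E' u v → u ∈ₛ S' → Star (Adj (restrict W S')) u v
      stay nil u∈ = nil
      stay {u} (_◅_ {j = w} e star) u∈ = Adj-restrict⁺ W S' u w u∈ w∈ (proj₁ e) ◅ stay star w∈
        where w∈ = to w (supp₂ T u w (proj₁ e)) (from u u∈ ◅◅ e ◅ nil)

    left-tree : TreeOn leftPart (restrict W leftPart)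
    left-tree = restrict-tree leftPart a left⇒reach reach⇒left

    right-tree : TreeOn rightPart (restrict W rightPart)
    right-tree = restrict-tree rightPart b right⇒reach reach⇒right

    i∈left : inj₁ i ∈ₛ leftPart
    i∈left = reach⇒left a (supp T a b edge) nil

    j∈right : inj₂ j ∈ₛ rightPart
    j∈right = reach⇒right b (supp₂ T a b edge) nil

    -- Every edge other than ij has both ends in the same part and survives in exactly one
    -- restriction. The ends of ij lie in different parts, so both restrictions are 0 there and `δ`
    -- supplies the entry.
    restrict-joined : ∀ {S₁ S₂} → Splits S S₁ S₂ → inj₁ i ∈ₛ S₁ → inj₂ j ∈ₛ S₂ →
      (∀ u v → E' u v → u ∈ₛ S₁ → v ∈ₛ S₁) →
      Joined (restrict W S₁) (restrict W S₂) i j (ent W i j) W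
    restrict-joined {S₁} {S₂} splits i∈ j∈ closed x y =
      trans (entry ((x Fin.≟ i) ×-dec (y Fin.≟ j)))
        (sym (cong₂ (λ p q → p + q + δ i j (ent W i j) x y) (ent-mat _ x y) (ent-mat _ x y)))
      where
      corner : ∀ {a₁ a₂ a b₁ b₂ b} n → a₁ ≡ true → b₂ ≡ true → Part a₁ a₂ a → Part b₁ b₂ b →
               n ≡ restrictEntry a₁ b₁ n + restrictEntry a₂ b₂ n + n
      corner n _ _ left right = refl
      inside : ∀ {a₁ a₂ a b₁ b₂ b} n → Part a₁ a₂ a → Part b₁ b₂ b →
               (0 < n → a ≡ true × b ≡ true × (a₁ ≡ true → b₁ ≡ true) × (b₁ ≡ true → a₁ ≡ true)) →
               n ≡ restrictEntry a₁ b₁ n + restrictEntry a₂ b₂ n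
      inside n left left h = sym (ℕₚ.+-identityʳ n)
      inside n right right h = refl
      inside zero left right h = refl
      inside zero right left h = refl
      inside zero outside left h = refl
      inside zero outside right h = refl
      inside zero outside outside h = refl
      inside zero left outside h = refl
      inside zero right outside h = refl
      inside (suc n) left right h with proj₁ (proj₂ (proj₂ (h (s≤s z≤n)))) refl
      ... | ()
      inside (suc n) right left h with proj₂ (proj₂ (proj₂ (h (s≤s z≤n)))) refl
      ... | ()
      inside (suc n) outside _ h with proj₁ (h (s≤s z≤n))
      ... | ()
      inside (suc n) left outside h with proj₁ (proj₂ (h (s≤s z≤n)))
      ... | ()
      inside (suc n) right outside h with proj₁ (proj₂ (h (s≤s z≤n)))
      ... | ()
      entry : Dec (x ≡ i × y ≡ j) → ent W x y ≡
        restrictEntry (mem S₁ (inj₁ x)) (mem S₁ (inj₂ y)) (ent W x y) + restrictEntry (mem S₂ (inj₁ x)) (mem S₂ (inj₂ y)) (ent W x y) + δ i j (ent W i j) x y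
      entry (yes (refl , refl)) = trans (corner (ent W i j) i∈ j∈ (splits (inj₁ i)) (splits (inj₂ j)))
        (cong (λ z → restrictEntry (mem S₁ a) (mem S₁ b) (ent W i j) + restrictEntry (mem S₂ a) (mem S₂ b) (ent W i j) + z) (sym (δ-hit i j (ent W i j))))
      entry (no ne) = trans (inside (ent W x y) (splits (inj₁ x)) (splits (inj₂ y)) λ e →
          supp T (inj₁ x) (inj₂ y) e , supp₂ T (inj₁ x) (inj₂ y) e ,
          closed (inj₁ x) (inj₂ y) (minus e) , closed (inj₂ y) (inj₁ x) (E'-sym (minus e)))
        (sym (trans (cong (λ z → _ + z) (δ-miss i j (ent W i j) x y ne)) (ℕₚ.+-identityʳ _)))
        where
        minus : 0 < ent W x y → E' (inj₁ x) (inj₂ y)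
        minus e = e , (λ { (refl , refl) → ne (refl , refl) }) , λ ()

    left-closed : ∀ u v → E' u v → u ∈ₛ leftPart → v ∈ₛ leftPart
    left-closed u v e u∈ = reach⇒left v (supp₂ T u v (proj₁ e)) (left⇒reach u u∈ ◅◅ e ◅ nil)

    -- The component of i after deleting the edge ij is the only possible left part.
    left-unique : ∀ {S₁ S₂} → Splits S S₁ S₂ → inj₁ i ∈ₛ S₁ → inj₂ j ∈ₛ S₂ →
      (∀ u v → E' u v → u ∈ₛ S₁ → v ∈ₛ S₁) → ∀ v → mem S₁ v ≡ mem leftPart v
    left-unique {S₁} {S₂} splits i∈ j∈ closed v = agree (splits v) (splits-cut v)
      (λ p → along closed (left⇒reach v p) i∈)
      (λ p q → part-disjoint (splits b) (along closed (Star.reverse E'-sym (right⇒reach v q)) p) j∈)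
      where
      along : ∀ {S'} → (∀ u v → E' u v → u ∈ₛ S' → v ∈ₛ S') → ∀ {u v} → Star E' u v → u ∈ₛ S' → v ∈ₛ S'
      along h nil p = p
      along h (e ◅ star) p = along h star (h _ _ e p)
      agree : ∀ {a₁ a₂ b₁ b₂ c} → Part a₁ a₂ c → Part b₁ b₂ c → (b₁ ≡ true → a₁ ≡ true) → (a₁ ≡ true → b₂ ≡ true → ⊥) → a₁ ≡ b₁
      agree outside outside h k = refl
      agree left left h k = refl
      agree right right h k = refl
      agree left right h k = ⊥-elim (k refl refl)
      agree right left h k = h refl

  module _ {S S₁ S₂ : Sub s t} {W W₁ W₂ : Mat s t} (splits : Splits S S₁ S₂)
           (T₁ : TreeOn S₁ W₁) (T₂ : TreeOn S₂ W₂) (i : Fin s) (j : Fin t) (c : ℕ)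
           (i∈ : inj₁ i ∈ₛ S₁) (j∈ : inj₂ j ∈ₛ S₂) (c>0 : 0 < c) (joined : Joined W₁ W₂ i j c W) where

    private
      a b : Vertex s t
      a = inj₁ i
      b = inj₂ j

    joined-edge : 0 < ent W i j
    joined-edge = subst (0 <_) (sym (trans (joined i j) (cong (ent W₁ i j + ent W₂ i j ℕ.+_) (δ-hit i j c)))) (ℕₚ.≤-trans c>0 (ℕₚ.m≤n+m c _))

    data JoinEdge : Vertex s t → Vertex s t → Set where
      edge₁ : ∀ {u v} → Adj W₁ u v → JoinEdge u v
      edge₂ : ∀ {u v} → Adj W₂ u v → JoinEdge u v
      cross : JoinEdge a b
      crossˢ : JoinEdge b a

    classify : ∀ u v → Adj W u v → JoinEdge u v
    classify (inj₁ x) (inj₂ y) e with (x Fin.≟ i) ×-dec (y Fin.≟ j)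
    ... | yes (refl , refl) = cross
    ... | no ne with ent W₁ x y in eq₁ | ent W₂ x y in eq₂
    ...   | suc _ | _ = edge₁ (subst (0 <_) (sym eq₁) (s≤s z≤n))
    ...   | zero | suc _ = edge₂ (subst (0 <_) (sym eq₂) (s≤s z≤n))
    ...   | zero | zero = ⊥-elim (ℕₚ.<-irrefl (sym (trans (joined x y) (trans (cong₂ (λ p q → p + q + δ i j c x y) eq₁ eq₂) (δ-miss i j c x y ne)))) e)
    classify (inj₂ y) (inj₁ x) e with classify (inj₁ x) (inj₂ y) e
    ... | edge₁ f = edge₁ f
    ... | edge₂ f = edge₂ f
    ... | cross = crossˢ

    lift₁ : ∀ u v → Adj W₁ u v → Adj W u v
    lift₁ (inj₁ x) (inj₂ y) e = subst (0 <_) (sym (joined x y)) (ℕₚ.≤-trans e (ℕₚ.≤-trans (ℕₚ.m≤m+n _ _) (ℕₚ.m≤m+n _ _)))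
    lift₁ (inj₂ y) (inj₁ x) e = lift₁ (inj₁ x) (inj₂ y) e

    lift₂ : ∀ u v → Adj W₂ u v → Adj W u v
    lift₂ (inj₁ x) (inj₂ y) e = subst (0 <_) (sym (joined x y)) (ℕₚ.≤-trans e (ℕₚ.≤-trans (ℕₚ.m≤n+m (ent W₂ x y) (ent W₁ x y)) (ℕₚ.m≤m+n _ _)))
    lift₂ (inj₂ y) (inj₁ x) e = lift₂ (inj₁ x) (inj₂ y) e

    disjoint : ∀ v → v ∈ₛ S₁ → v ∈ₛ S₂ → ⊥
    disjoint v = part-disjoint (splits v)

    join-closed₁ : ∀ u v → Minus (Adj W) a b u v → u ∈ₛ S₁ → v ∈ₛ S₁
    join-closed₁ u v (e , p , q) u∈ with classify u v e
    ... | edge₁ f = supp₂ T₁ u v f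
    ... | edge₂ f = ⊥-elim (disjoint u u∈ (supp T₂ u v f))
    ... | cross = ⊥-elim (p (refl , refl))
    ... | crossˢ = ⊥-elim (q (refl , refl))

    join-restrict₁ : restrict W S₁ ≡ W₁
    join-restrict₁ = mat-ext λ x y → trans (ent-mat _ x y) (trans (cong (restrictEntry _ _) (trans (joined x y) (ℕₚ.+-assoc (ent W₁ x y) _ _)))
      (restrictEntry-select _ _ _ _ (λ e → supp T₁ (inj₁ x) (inj₂ y) e , supp₂ T₁ (inj₁ x) (inj₂ y) e)
        (λ p q → cong₂ ℕ._+_ (nonPositive (λ e → disjoint (inj₁ x) p (supp T₂ (inj₁ x) (inj₂ y) e)))
          (δ-miss i j c x y (λ { (_ , refl) → disjoint b q j∈ })))))

    join-restrict₂ : restrict W S₂ ≡ W₂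
    join-restrict₂ = mat-ext λ x y → trans (ent-mat _ x y) (trans (cong (restrictEntry _ _) (trans (joined x y)
        (trans (cong (ℕ._+ δ i j c x y) (ℕₚ.+-comm (ent W₁ x y) _)) (ℕₚ.+-assoc (ent W₂ x y) _ _))))
      (restrictEntry-select _ _ _ _ (λ e → supp T₂ (inj₁ x) (inj₂ y) e , supp₂ T₂ (inj₁ x) (inj₂ y) e)
        (λ p q → cong₂ ℕ._+_ (nonPositive (λ e → disjoint (inj₁ x) (supp T₁ (inj₁ x) (inj₂ y) e) p))
          (δ-miss i j c x y (λ { (refl , _) → disjoint a i∈ p })))))

    -- To see that an edge of one part remains a bridge, contract the other part to the root of this
    -- one: a walk around the edge would become a walk inside its part. The new edge is a bridge
    -- because no other edge leaves `S₁`.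
    join-tree : TreeOn S W
    join-tree = treeOn support connected bridging
      where
      support : ∀ u v → Adj W u v → u ∈ₛ S
      support u v e with classify u v e
      ... | edge₁ f = part-⊆ˡ (splits u) (supp T₁ u v f)
      ... | edge₂ f = part-⊆ʳ (splits u) (supp T₂ u v f)
      ... | cross = part-⊆ˡ (splits u) i∈
      ... | crossˢ = part-⊆ʳ (splits u) j∈

      toRoot : ∀ u → u ∈ₛ S → Star (Adj W) u a
      toRoot u u∈ with part-cover (splits u) u∈
      ... | inj₁ p = Star.map (λ {x} {y} → lift₁ x y) (conn T₁ u a p i∈)
      ... | inj₂ p = Star.map (λ {x} {y} → lift₂ x y) (conn T₂ u b p j∈) ◅◅ joined-edge ◅ nil

      connected : ∀ u v → u ∈ₛ S → v ∈ₛ S → Star (Adj W) u v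
      connected u v u∈ v∈ = toRoot u u∈ ◅◅ Star.reverse (Adj-sym W) (toRoot v v∈)

      stay₁ : ∀ {u v} → Star (Minus (Adj W) a b) u v → u ∈ₛ S₁ → v ∈ₛ S₁
      stay₁ nil p = p
      stay₁ {u} (_◅_ {j = w} e star) p = stay₁ star (join-closed₁ u w e p)

      p₁ p₂ : Vertex s t → Vertex s t
      p₁ v = if mem S₁ v then v else a
      p₂ v = if mem S₂ v then v else b

      p₁-in : ∀ v → v ∈ₛ S₁ → p₁ v ≡ v
      p₁-in v e = cong (λ z → if z then v else a) e

      p₁-out : ∀ v → v ∈ₛ S₂ → p₁ v ≡ a
      p₁-out v e with mem S₁ v in eq
      ... | true = ⊥-elim (disjoint v eq e)
      ... | false = refl

      p₂-in : ∀ v → v ∈ₛ S₂ → p₂ v ≡ v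
      p₂-in v e = cong (λ z → if z then v else b) e

      p₂-out : ∀ v → v ∈ₛ S₁ → p₂ v ≡ b
      p₂-out v e with mem S₂ v in eq
      ... | true = ⊥-elim (disjoint v e eq)
      ... | false = refl

      collapse₁ : ∀ x y → Adj W x y → (Adj W₁ x y × p₁ x ≡ x × p₁ y ≡ y) ⊎ p₁ x ≡ p₁ y
      collapse₁ x y e with classify x y e
      ... | edge₁ f = inj₁ (f , p₁-in x (supp T₁ x y f) , p₁-in y (supp₂ T₁ x y f))
      ... | edge₂ f = inj₂ (trans (p₁-out x (supp T₂ x y f)) (sym (p₁-out y (supp₂ T₂ x y f))))
      ... | cross = inj₂ (trans (p₁-in a i∈) (sym (p₁-out b j∈)))
      ... | crossˢ = inj₂ (trans (p₁-out b j∈) (sym (p₁-in a i∈)))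

      collapse₂ : ∀ x y → Adj W x y → (Adj W₂ x y × p₂ x ≡ x × p₂ y ≡ y) ⊎ p₂ x ≡ p₂ y
      collapse₂ x y e with classify x y e
      ... | edge₁ f = inj₂ (trans (p₂-out x (supp T₁ x y f)) (sym (p₂-out y (supp₂ T₁ x y f))))
      ... | edge₂ f = inj₁ (f , p₂-in x (supp T₂ x y f) , p₂-in y (supp₂ T₂ x y f))
      ... | cross = inj₂ (trans (p₂-out a i∈) (sym (p₂-in b j∈)))
      ... | crossˢ = inj₂ (trans (p₂-in b j∈) (sym (p₂-out a i∈)))

      bridging : Bridges (Adj W)
      bridging u v e star with classify u v e
      ... | edge₁ f = bridges T₁ u v f (subst₂ (Star (Minus (Adj W₁) u v)) (p₁-in u (supp T₁ u v f)) (p₁-in v (supp₂ T₁ u v f)) (collapse p₁ collapse₁ star))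
      ... | edge₂ f = bridges T₂ u v f (subst₂ (Star (Minus (Adj W₂) u v)) (p₂-in u (supp T₂ u v f)) (p₂-in v (supp₂ T₂ u v f)) (collapse p₂ collapse₂ star))
      ... | cross = disjoint b (stay₁ star i∈) j∈
      ... | crossˢ = disjoint b (stay₁ (Star.map (λ (e , p , q) → e , q , p) (Star.reverse (Minus-sym (Adj-sym W)) star)) i∈) j∈

-- Coefficients

_≟ˢ_ : ∀ {n} → DecidableEquality (Vec Bool n)
_≟ˢ_ = Vecₚ.≡-dec Boolₚ._≟_

tab : ∀ {n} → (Vec Bool n → ℤ) → K n
tab {zero}  F = const (F [])
tab {suc n} F = tab (F ∘ (false ∷_)) +ε tab (F ∘ (true ∷_))

coef-tab : ∀ {n} (F : Vec Bool n → ℤ) S → coef (tab F) S ≡ F S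
coef-tab F [] = refl
coef-tab F (false ∷ S) = coef-tab (F ∘ (false ∷_)) S
coef-tab F (true ∷ S) = coef-tab (F ∘ (true ∷_)) S

coef-ext : ∀ {n} (a b : K n) → (∀ S → coef a S ≡ coef b S) → a ≡ b
coef-ext (const x) (const y) h = cong const (h [])
coef-ext (a +ε b) (c +ε d) h = cong₂ _+ε_ (coef-ext a c (h ∘ (false ∷_))) (coef-ext b d (h ∘ (true ∷_)))

coef-⊕ : ∀ {n} (a b : K n) S → coef (a ⊕ b) S ≡ coef a S ℤ.+ coef b S
coef-⊕ (const x) (const y) [] = refl
coef-⊕ (a +ε b) (c +ε d) (false ∷ S) = coef-⊕ a c S
coef-⊕ (a +ε b) (c +ε d) (true ∷ S) = coef-⊕ b d S

coef-𝟘 : ∀ {n} (S : Vec Bool n) → coef 𝟘 S ≡ + 0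
coef-𝟘 [] = refl
coef-𝟘 (false ∷ S) = coef-𝟘 S
coef-𝟘 (true ∷ S) = coef-𝟘 S

full : ∀ {n} → Vec Bool n
full = Vec.replicate _ true

top-coef : ∀ {n} (a : K n) → top a ≡ coef a full
top-coef (const x) = refl
top-coef (a +ε b) = top-coef b

-- The inductive counterpart of `Splits`; it can be enumerated and follows the recursion of `_⊛_`.
data Split : ∀ {n} → Vec Bool n → Vec Bool n → Vec Bool n → Set where
  []    : Split [] [] []
  skip  : ∀ {n} {S A B : Vec Bool n} → Split S A B → Split (false ∷ S) (false ∷ A) (false ∷ B)
  left  : ∀ {n} {S A B : Vec Bool n} → Split S A B → Split (true ∷ S) (true ∷ A) (false ∷ B)
  right : ∀ {n} {S A B : Vec Bool n} → Split S A B → Split (true ∷ S) (false ∷ A) (true ∷ B)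

splitList : ∀ {n} → Vec Bool n → List (Vec Bool n × Vec Bool n)
splitList []          = ([] , []) ∷ []
splitList (false ∷ S) = map (λ (A , B) → false ∷ A , false ∷ B) (splitList S)
splitList (true ∷ S)  = map (λ (A , B) → true ∷ A , false ∷ B) (splitList S) ++ map (λ (A , B) → false ∷ A , true ∷ B) (splitList S)

enum-splitList : ∀ {n} (S : Vec Bool n) → Enumerates (λ (A , B) → Split S A B) (splitList S)
enum-splitList [] = enum-singleton [] (λ { ([] , []) _ → refl })
enum-splitList (false ∷ S) = enum-map _ (λ _ → skip) (λ { _ _ _ _ refl → refl }) (λ { _ (skip p) → _ , p , refl }) (enum-splitList S)
enum-splitList (true ∷ S) = enum-⇔ {𝑃 = λ z → InLeft z ⊎ InRight z} (λ { _ (inj₁ (_ , p , refl)) → left p ; _ (inj₂ (_ , p , refl)) → right p })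
  (λ { _ (left p) → inj₁ (_ , p , refl) ; _ (right p) → inj₂ (_ , p , refl) })
  (enum-++ (λ { _ (_ , _ , refl) (_ , _ , ()) })
    (enum-map _ (λ z p → z , p , refl) (λ { _ _ _ _ refl → refl }) (λ _ q → q) (enum-splitList S))
    (enum-map _ (λ z p → z , p , refl) (λ { _ _ _ _ refl → refl }) (λ _ q → q) (enum-splitList S)))
  where
  InLeft InRight : Vec Bool _ × Vec Bool _ → Set
  InLeft z = ∃[ y ] Split S (proj₁ y) (proj₂ y) × (true ∷ proj₁ y , false ∷ proj₂ y) ≡ z
  InRight z = ∃[ y ] Split S (proj₁ y) (proj₂ y) × (false ∷ proj₁ y , true ∷ proj₂ y) ≡ z

coef-⊛ : ∀ {n} (a b : K n) S → coef (a ⊛ b) S ≡ ∑ (splitList S) (λ (A , B) → coef a A ℤ.* coef b B)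
coef-⊛ (const x) (const y) [] = sym (ℤₚ.+-identityʳ _)
coef-⊛ (a +ε b) (c +ε d) (false ∷ S) = trans (coef-⊛ a c S) (sym (∑-map _ (splitList S) _))
coef-⊛ (a +ε b) (c +ε d) (true ∷ S) = trans (coef-⊕ (a ⊛ d) (b ⊛ c) S) (trans (cong₂ ℤ._+_ (coef-⊛ a d S) (coef-⊛ b c S))
  (trans (ℤₚ.+-comm (∑ (splitList S) (λ (A , B) → coef a A ℤ.* coef d B)) _)
    (sym (trans (∑-++ (map _ (splitList S)) _ _) (cong₂ ℤ._+_ (∑-map _ (splitList S) _) (∑-map _ (splitList S) _))))))

weigh : ∀ {n} → ℤ → Vec ℤ n → Vec Bool n → ℤ
weigh z []       []          = z
weigh z (w ∷ ws) (false ∷ S) = weigh z ws S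
weigh z (w ∷ ws) (true ∷ S)  = weigh (z ℤ.+ w) ws S

coef-π : ∀ {n} z (ws : Vec ℤ n) a S → coef (π z ws a) S ≡ pick (weigh z ws S ℤ.≟ + 0) (coef a S) (+ 0)
coef-π z [] (const x) [] with z ℤ.≟ + 0
... | yes _ = refl
... | no _ = refl
coef-π z (w ∷ ws) (a +ε b) (false ∷ S) = coef-π z ws a S
coef-π z (w ∷ ws) (a +ε b) (true ∷ S) = coef-π (z ℤ.+ w) ws b S

Supp-coef : ∀ {n} {P : ℤ → Set} z (ws : Vec ℤ n) a → (∀ S → coef a S ≡ + 0 ⊎ P (weigh z ws S)) → Supp (λ x → P (z ℤ.+ x)) ws a
Supp-coef {P = P} z [] (const x) h = Sum.map₂ (subst P (sym (ℤₚ.+-identityʳ z))) (h [])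
Supp-coef {P = P} z (w ∷ ws) (a +ε b) h = Supp-coef {P = P} z ws a (h ∘ (false ∷_)) ,
  Supp-mono ws b (λ x → subst P (ℤₚ.+-assoc z w x)) (Supp-coef {P = P} (z ℤ.+ w) ws b (h ∘ (true ∷_)))

single : ∀ {n} → Fin n → Vec Bool n
single zero    = true ∷ Vec.replicate _ false
single (suc i) = false ∷ single i

indicator : {A : Set} → Dec A → ℤ
indicator d = pick d (+ 1) (+ 0)

indicator-⇔ : {A B : Set} (d : Dec A) (e : Dec B) → (A → B) → (B → A) → indicator d ≡ indicator e
indicator-⇔ (yes _) (yes _) f g = refl
indicator-⇔ (yes a) (no ¬b) f g = ⊥-elim (¬b (f a))
indicator-⇔ (no ¬a) (yes b) f g = ⊥-elim (¬a (g b))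
indicator-⇔ (no _) (no _) f g = refl

coef-𝟙 : ∀ {n} (S : Vec Bool n) → coef 𝟙 S ≡ indicator (S ≟ˢ Vec.replicate n false)
coef-𝟙 [] = refl
coef-𝟙 (false ∷ S) = trans (coef-𝟙 S) (indicator-⇔ (S ≟ˢ _) ((false ∷ S) ≟ˢ _) (cong (false ∷_)) Vecₚ.∷-injectiveʳ)
coef-𝟙 (true ∷ S) = trans (coef-𝟘 S) (none ((true ∷ S) ≟ˢ _))
  where
  none : (d : Dec (true ∷ S ≡ Vec.replicate _ false)) → + 0 ≡ indicator d
  none (no _) = refl
  none (yes ())

coef-εΣ : ∀ n (S : Vec Bool n) → coef (εΣ n) S ≡ ∑ (allFin n) (λ x → indicator (S ≟ˢ single x))
coef-εΣ zero [] = refl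
coef-εΣ (suc n) (false ∷ S) = trans (coef-εΣ n S) (sym (trans (∑-allFin-suc n (λ x → indicator ((false ∷ S) ≟ˢ single x))) (trans (cong₂ ℤ._+_
  (none ((false ∷ S) ≟ˢ single zero)) (∑-cong (allFin n) (λ x → indicator-⇔ ((false ∷ S) ≟ˢ single (suc x)) (S ≟ˢ single x) Vecₚ.∷-injectiveʳ (cong (false ∷_)))))
  (ℤₚ.+-identityˡ _))))
  where
  none : (d : Dec (false ∷ S ≡ single zero)) → indicator d ≡ + 0
  none (no _) = refl
  none (yes ())
coef-εΣ (suc n) (true ∷ S) = trans (coef-𝟙 S) (sym (trans (∑-allFin-suc n (λ x → indicator ((true ∷ S) ≟ˢ single x))) (trans (cong₂ ℤ._+_
  (indicator-⇔ ((true ∷ S) ≟ˢ single zero) (S ≟ˢ _) Vecₚ.∷-injectiveʳ (cong (true ∷_)))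
  (trans (∑-cong (allFin n) (λ x → none x ((true ∷ S) ≟ˢ single (suc x)))) (∑-zero (allFin n))))
  (ℤₚ.+-identityʳ _))))
  where
  none : ∀ x → (d : Dec (true ∷ S ≡ single (suc x))) → indicator d ≡ + 0
  none x (no _) = refl
  none x (yes ())

∑-allFin-+ : ∀ s {t} (F : Fin (s + t) → ℤ) → ∑ (allFin (s + t)) F ≡ ∑ (allFin s) (λ i → F (i ↑ˡ t)) ℤ.+ ∑ (allFin t) (λ j → F (s ↑ʳ j))
∑-allFin-+ zero F = sym (ℤₚ.+-identityˡ _)
∑-allFin-+ (suc s) {t} F = trans (∑-allFin-suc (s + t) F) (trans (cong (λ z → F zero ℤ.+ z) (∑-allFin-+ s (F ∘ suc)))
  (trans (sym (ℤₚ.+-assoc (F zero) _ _)) (cong (ℤ._+ ∑ (allFin t) (λ j → F (suc (s ↑ʳ j)))) (sym (∑-allFin-suc s (λ i → F (i ↑ˡ t)))))))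

size : ∀ {n} → Vec Bool n → ℕ
size []          = 0
size (false ∷ S) = size S
size (true ∷ S)  = suc (size S)

size-split : ∀ {n} {S A B : Vec Bool n} → Split S A B → size S ≡ size A + size B
size-split [] = refl
size-split (skip p) = size-split p
size-split (left p) = cong suc (size-split p)
size-split {A = _ ∷ A} {B = _ ∷ B} (right p) = trans (cong suc (size-split p)) (sym (ℕₚ.+-suc (size A) (size B)))

size-positive : ∀ {n} (S : Vec Bool n) x → lookup S x ≡ true → 1 ≤ size S
size-positive (true ∷ S) zero e = s≤s z≤n
size-positive (true ∷ S) (suc x) e = s≤s z≤n
size-positive (false ∷ S) (suc x) e = size-positive S x e

size-replicate-false : ∀ n → size (Vec.replicate n false) ≡ 0
size-replicate-false zero = refl
size-replicate-false (suc n) = size-replicate-false n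

size-single : ∀ {n} (x : Fin n) → size (single x) ≡ 1
size-single {suc n} zero = cong suc (size-replicate-false n)
size-single (suc x) = size-single x

size-full : ∀ n → size (full {n}) ≡ n
size-full zero = refl
size-full (suc n) = cong suc (size-full n)

lookup-single : ∀ {n} (x : Fin n) → lookup (single x) x ≡ true
lookup-single zero = refl
lookup-single (suc x) = lookup-single x

lookup-single⁻ : ∀ {n} (x y : Fin n) → lookup (single x) y ≡ true → x ≡ y
lookup-single⁻ zero zero e = refl
lookup-single⁻ zero (suc y) e with trans (sym (Vecₚ.lookup-replicate y false)) e
... | ()
lookup-single⁻ (suc x) (suc y) e = cong suc (lookup-single⁻ x y e)

split⇒parts : ∀ {n} {S A B : Vec Bool n} → Split S A B → ∀ x → Part (lookup A x) (lookup B x) (lookup S x)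
split⇒parts (skip p) zero = outside
split⇒parts (left p) zero = left
split⇒parts (right p) zero = right
split⇒parts (skip p) (suc x) = split⇒parts p x
split⇒parts (left p) (suc x) = split⇒parts p x
split⇒parts (right p) (suc x) = split⇒parts p x

parts⇒split : ∀ {n} (S A B : Vec Bool n) → (∀ x → Part (lookup A x) (lookup B x) (lookup S x)) → Split S A B
parts⇒split [] [] [] h = []
parts⇒split (c ∷ S) (a ∷ A) (b ∷ B) h with a | b | c | h zero
... | _ | _ | _ | outside = skip (parts⇒split S A B (h ∘ suc))
... | _ | _ | _ | left = left (parts⇒split S A B (h ∘ suc))
... | _ | _ | _ | right = right (parts⇒split S A B (h ∘ suc))

-- Marginals and degrees

Σᶠ-zero : ∀ {n} {f : Fin n → ℕ} → (∀ i → f i ≡ 0) → Σᶠ f ≡ 0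
Σᶠ-zero {zero} h = refl
Σᶠ-zero {suc n} {f} h = trans (Σᶠ-suc f) (cong₂ ℕ._+_ (h zero) (Σᶠ-zero (h ∘ suc)))

Σᶠ-+ : ∀ {n} (f g : Fin n → ℕ) → Σᶠ (λ i → f i + g i) ≡ Σᶠ f + Σᶠ g
Σᶠ-+ {zero} f g = refl
Σᶠ-+ {suc n} f g = trans (Σᶠ-suc (λ i → f i + g i)) (trans (cong (f zero + g zero ℕ.+_) (Σᶠ-+ (f ∘ suc) (g ∘ suc)))
  (trans (interchange (f zero) (g zero) (Σᶠ (f ∘ suc)) (Σᶠ (g ∘ suc))) (sym (cong₂ ℕ._+_ (Σᶠ-suc f) (Σᶠ-suc g)))))
  where
  interchange : ∀ a b c d → a + b + (c + d) ≡ a + c + (b + d)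
  interchange = ℕ-solve-∀

Σᶠ-swap : ∀ {m n} (f : Fin m → Fin n → ℕ) → Σᶠ (λ i → Σᶠ (f i)) ≡ Σᶠ (λ j → Σᶠ (λ i → f i j))
Σᶠ-swap {zero} {n} f = sym (Σᶠ-zero {n} (λ j → refl))
Σᶠ-swap {suc m} f = trans (Σᶠ-suc (λ i → Σᶠ (f i))) (trans (cong (Σᶠ (f zero) ℕ.+_) (Σᶠ-swap (f ∘ suc)))
  (trans (sym (Σᶠ-+ (f zero) (λ j → Σᶠ (λ i → f (suc i) j)))) (Σᶠ-cong (λ j → sym (Σᶠ-suc (λ i → f i j))))))

spike : ∀ {n} → Fin n → ℕ → Fin n → ℕ
spike x c y = pick (y Fin.≟ x) c 0

spike-hit : ∀ {n} (x : Fin n) c → spike x c x ≡ c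
spike-hit x c with x Fin.≟ x
... | yes _ = refl
... | no x≢x = ⊥-elim (x≢x refl)

spike-miss : ∀ {n} (x : Fin n) c y → y ≢ x → spike x c y ≡ 0
spike-miss x c y y≢x with y Fin.≟ x
... | yes y≡x = ⊥-elim (y≢x y≡x)
... | no _ = refl

Σᶠ-spike : ∀ {n} (x : Fin n) c → Σᶠ (spike x c) ≡ c
Σᶠ-spike {suc n} zero c = trans (Σᶠ-suc {n} (spike zero c)) (trans (cong₂ ℕ._+_ (spike-hit {suc n} zero c) (Σᶠ-zero {n} (λ i → spike-miss {suc n} zero c (suc i) λ ()))) (ℕₚ.+-identityʳ c))
Σᶠ-spike {suc n} (suc x) c = trans (Σᶠ-suc (spike (suc x) c)) (trans (Σᶠ-cong shift) (Σᶠ-spike x c))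
  where
  shift : ∀ y → spike (suc x) c (suc y) ≡ spike x c y
  shift y with y Fin.≟ x
  ... | yes _ = refl
  ... | no _ = refl

Πᶠ-* : ∀ {n} (f g : Fin n → ℕ) → Πᶠ (λ i → f i * g i) ≡ Πᶠ f * Πᶠ g
Πᶠ-* {zero} f g = refl
Πᶠ-* {suc n} f g = trans (Πᶠ-suc (λ i → f i * g i)) (trans (cong (f zero * g zero ℕ.*_) (Πᶠ-* (f ∘ suc) (g ∘ suc)))
  (trans (interchange (f zero) (g zero) (Πᶠ (f ∘ suc)) (Πᶠ (g ∘ suc))) (sym (cong₂ ℕ._*_ (Πᶠ-suc f) (Πᶠ-suc g)))))
  where
  interchange : ∀ a b c d → a * b * (c * d) ≡ a * c * (b * d)
  interchange = ℕ-solve-∀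

Πᶠ-one : ∀ {n} {f : Fin n → ℕ} → (∀ i → f i ≡ 1) → Πᶠ f ≡ 1
Πᶠ-one {zero} h = refl
Πᶠ-one {suc n} {f} h = trans (Πᶠ-suc f) (cong₂ ℕ._*_ (h zero) (Πᶠ-one (h ∘ suc)))

Πᶠ-peak : ∀ {n} (x : Fin n) (f : Fin n → ℕ) → (∀ y → y ≢ x → f y ≡ 1) → Πᶠ f ≡ f x
Πᶠ-peak zero f h = trans (Πᶠ-suc f) (trans (cong (f zero ℕ.*_) (Πᶠ-one (λ i → h (suc i) λ ()))) (ℕₚ.*-identityʳ (f zero)))
Πᶠ-peak (suc x) f h = trans (Πᶠ-suc f) (trans (cong₂ ℕ._*_ (h zero λ ()) (Πᶠ-peak x (f ∘ suc) (λ y y≢x → h (suc y) (λ { refl → y≢x refl })))) (ℕₚ.+-identityʳ _))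

false≢true : ∀ {x} → x ≡ false → x ≡ true → ⊥
false≢true refl ()

sg : ℕ → ℕ
sg zero    = 0
sg (suc _) = 1

module _ {s t : ℕ} where

  mg : Mat s t → Vertex s t → ℕ
  mg W (inj₁ i) = Σᶠ (λ j → lookup (lookup W i) j)
  mg W (inj₂ j) = Σᶠ (λ i → lookup (lookup W i) j)

  -- A point mass: the contribution to the marginals of a half-edge of weight `c` at `r`, or of one
  -- end of an edge.
  pt : Vertex s t → ℕ → Vertex s t → ℕ
  pt (inj₁ i) c (inj₁ x) = spike i c x
  pt (inj₁ i) c (inj₂ y) = 0
  pt (inj₂ j) c (inj₁ x) = 0
  pt (inj₂ j) c (inj₂ y) = spike j c y

  pt-hit : ∀ r c → pt r c r ≡ c
  pt-hit (inj₁ i) c = spike-hit i c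
  pt-hit (inj₂ j) c = spike-hit j c

  pt-miss : ∀ r c v → v ≢ r → pt r c v ≡ 0
  pt-miss (inj₁ i) c (inj₁ x) h = spike-miss i c x (h ∘ cong inj₁)
  pt-miss (inj₁ i) c (inj₂ y) h = refl
  pt-miss (inj₂ j) c (inj₁ x) h = refl
  pt-miss (inj₂ j) c (inj₂ y) h = spike-miss j c y (h ∘ cong inj₂)

  pt-+ : ∀ r c d v → pt r (c + d) v ≡ pt r c v + pt r d v
  pt-+ r c d v with v ≟ⱽ r
  ... | yes refl = trans (pt-hit v (c + d)) (sym (cong₂ ℕ._+_ (pt-hit v c) (pt-hit v d)))
  ... | no v≢r = trans (pt-miss r (c + d) v v≢r) (sym (cong₂ ℕ._+_ (pt-miss r c v v≢r) (pt-miss r d v v≢r)))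

  pt-0 : ∀ r v → pt r 0 v ≡ 0
  pt-0 r v with v ≟ⱽ r
  ... | yes refl = pt-hit r 0
  ... | no ne = pt-miss r 0 v ne

  mg-zero : ∀ W v → (∀ u → ¬ Adj W v u) → mg W v ≡ 0
  mg-zero W (inj₁ i) h = Σᶠ-zero (λ j → nonPositive (h (inj₂ j)))
  mg-zero W (inj₂ j) h = Σᶠ-zero (λ i → nonPositive (h (inj₁ i)))

  mg-positive⁻ : ∀ W v → 0 < mg W v → ∃[ u ] Adj W v u
  mg-positive⁻ W (inj₁ i) p = let (j , q) = Σᶠ-positive⁻ _ p in inj₂ j , q
  mg-positive⁻ W (inj₂ j) p = let (i , q) = Σᶠ-positive⁻ _ p in inj₁ i , q

  mg-positive : ∀ W v u → Adj W v u → 0 < mg W v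
  mg-positive W (inj₁ i) (inj₂ j) e = Σᶠ-positive _ j e
  mg-positive W (inj₂ j) (inj₁ i) e = Σᶠ-positive _ i e

  mg-outside : ∀ {S W} → TreeOn S W → ∀ v → mem S v ≡ false → mg W v ≡ 0
  mg-outside {W = W} T v e = mg-zero W v λ u a → false≢true e (supp T v u a)

  mg-joined : ∀ {W₁ W₂ i j c W} → Joined W₁ W₂ i j c W → ∀ v → mg W v ≡ mg W₁ v + mg W₂ v + (pt (inj₁ i) c v + pt (inj₂ j) c v)
  mg-joined {W₁} {W₂} {i} {j} {c} {W} joined (inj₁ x) = trans (Σᶠ-cong (joined x)) (trans (Σᶠ-+ (λ y → ent W₁ x y + ent W₂ x y) (δ i j c x))
    (cong₂ ℕ._+_ (Σᶠ-+ (ent W₁ x) (ent W₂ x)) (trans row (sym (ℕₚ.+-identityʳ (spike i c x))))))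
    where
    row : Σᶠ (δ i j c x) ≡ spike i c x
    row = trans (Σᶠ-cong entry) (Σᶠ-spike j (spike i c x))
      where
      entry : ∀ y → δ i j c x y ≡ spike j (spike i c x) y
      entry y with x Fin.≟ i | y Fin.≟ j
      ... | yes _ | yes _ = refl
      ... | yes _ | no _ = refl
      ... | no _ | yes _ = refl
      ... | no _ | no _ = refl
  mg-joined {W₁} {W₂} {i} {j} {c} {W} joined (inj₂ y) = trans (Σᶠ-cong (λ x → joined x y)) (trans (Σᶠ-+ (λ x → ent W₁ x y + ent W₂ x y) (λ x → δ i j c x y))
    (cong₂ ℕ._+_ (Σᶠ-+ (λ x → ent W₁ x y) (λ x → ent W₂ x y)) column))
    where
    entry : ∀ x → δ i j c x y ≡ spike i (spike j c y) x
    entry x with x Fin.≟ i | y Fin.≟ j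
    ... | yes _ | yes _ = refl
    ... | yes _ | no _ = refl
    ... | no _ | yes _ = refl
    ... | no _ | no _ = refl
    column : Σᶠ (λ x → δ i j c x y) ≡ spike j c y
    column = trans (Σᶠ-cong entry) (Σᶠ-spike i (spike j c y))

  -- With all edge weights replaced by 1 the marginals are the degrees, so the lemmas about `mg`
  -- yield those about `deg`.
  support : Mat s t → Mat s t
  support W = mat (λ i j → sg (ent W i j))

  deg : Mat s t → Vertex s t → ℕ
  deg W = mg (support W)

  Adj-support⁺ : ∀ W u v → Adj W u v → Adj (support W) u v
  Adj-support⁺ W (inj₁ i) (inj₂ j) e = subst (0 <_) (sym (ent-mat _ i j)) (sg-positive _ e)
    where
    sg-positive : ∀ n → 0 < n → 0 < sg n
    sg-positive (suc n) _ = s≤s z≤n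
  Adj-support⁺ W (inj₂ j) (inj₁ i) e = Adj-support⁺ W (inj₁ i) (inj₂ j) e

  Adj-support⁻ : ∀ W u v → Adj (support W) u v → Adj W u v
  Adj-support⁻ W (inj₁ i) (inj₂ j) e = sg-positive⁻ _ (subst (0 <_) (ent-mat _ i j) e)
    where
    sg-positive⁻ : ∀ n → 0 < sg n → 0 < n
    sg-positive⁻ (suc n) _ = s≤s z≤n
  Adj-support⁻ W (inj₂ j) (inj₁ i) e = Adj-support⁻ W (inj₁ i) (inj₂ j) e

  deg-outside : ∀ {S W} → TreeOn S W → ∀ v → mem S v ≡ false → deg W v ≡ 0
  deg-outside {W = W} T v e = mg-zero (support W) v λ u a → false≢true e (supp T v u (Adj-support⁻ W v u a))

  edges : Mat s t → ℕ
  edges W = Σᶠ (λ i → deg W (inj₁ i))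

  module _ {S S₁ S₂ : Sub s t} {W W₁ W₂ : Mat s t} (splits : Splits {s} {t} S S₁ S₂)
           (T₁ : TreeOn S₁ W₁) (T₂ : TreeOn S₂ W₂) (i : Fin s) (j : Fin t) (c : ℕ)
           (i∈ : inj₁ i ∈ₛ S₁) (j∈ : inj₂ j ∈ₛ S₂) (c>0 : 0 < c) (joined : Joined W₁ W₂ i j c W) where

    -- At every entry at most one of the three summands is positive, and under this condition `sg`
    -- is additive.
    support-joined : Joined (support W₁) (support W₂) i j 1 (support W)
    support-joined x y = trans (ent-mat _ x y) (trans (cong sg (joined x y)) (trans (entry (ent W₁ x y) (ent W₂ x y) together inside)
        (sym (cong₂ (λ p q → p + q + δ i j 1 x y) (ent-mat _ x y) (ent-mat _ x y)))))
      where
      together : 0 < ent W₁ x y → 0 < ent W₂ x y → ⊥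
      together p q = part-disjoint (splits (inj₁ x)) (supp T₁ (inj₁ x) (inj₂ y) p) (supp T₂ (inj₁ x) (inj₂ y) q)
      inside : x ≡ i → y ≡ j → ent W₁ x y ≡ 0 × ent W₂ x y ≡ 0
      inside refl refl = nonPositive (λ p → part-disjoint (splits (inj₂ j)) (supp₂ T₁ (inj₁ i) (inj₂ j) p) j∈) ,
                         nonPositive (λ p → part-disjoint (splits (inj₁ i)) i∈ (supp T₂ (inj₁ i) (inj₂ j) p))
      off : ∀ n m → (0 < n → 0 < m → ⊥) → sg (n + m + 0) ≡ sg n + sg m + 0
      off zero zero h = refl
      off zero (suc m) h = refl
      off (suc n) zero h = refl
      off (suc n) (suc m) h = ⊥-elim (h (s≤s z≤n) (s≤s z≤n))
      entry : ∀ n m → (0 < n → 0 < m → ⊥) → (x ≡ i → y ≡ j → n ≡ 0 × m ≡ 0) → sg (n + m + δ i j c x y) ≡ sg n + sg m + δ i j 1 x y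
      entry n m h k with x Fin.≟ i | y Fin.≟ j
      entry n m h k | yes p | yes q with k p q
      ... | refl , refl = sg-c c c>0
        where
        sg-c : ∀ c → 0 < c → sg c ≡ 1
        sg-c (suc c) _ = refl
      entry n m h k | yes _ | no _ = off n m h
      entry n m h k | no _ | _ = off n m h

    deg-joined : ∀ v → deg W v ≡ deg W₁ v + deg W₂ v + (pt (inj₁ i) 1 v + pt (inj₂ j) 1 v)
    deg-joined = mg-joined {W = support W} support-joined

    edges-joined : edges W ≡ edges W₁ + edges W₂ + 1
    edges-joined = trans (Σᶠ-cong (λ x → deg-joined (inj₁ x)))
      (trans (Σᶠ-+ (λ x → deg W₁ (inj₁ x) + deg W₂ (inj₁ x)) (λ x → spike i 1 x + 0))
        (cong₂ ℕ._+_ (Σᶠ-+ (λ x → deg W₁ (inj₁ x)) (λ x → deg W₂ (inj₁ x)))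
          (trans (Σᶠ-cong (λ x → ℕₚ.+-identityʳ (spike i 1 x))) (Σᶠ-spike i 1))))

  ∏ⱽ : (Vertex s t → ℕ) → ℕ
  ∏ⱽ F = Πᶠ (F ∘ inj₁) * Πᶠ (F ∘ inj₂)

  ∏ⱽ-cong : {F G : Vertex s t → ℕ} → (∀ v → F v ≡ G v) → ∏ⱽ F ≡ ∏ⱽ G
  ∏ⱽ-cong h = cong₂ ℕ._*_ (Πᶠ-cong (h ∘ inj₁)) (Πᶠ-cong (h ∘ inj₂))

  ∏ⱽ-* : (F G : Vertex s t → ℕ) → ∏ⱽ (λ v → F v * G v) ≡ ∏ⱽ F * ∏ⱽ G
  ∏ⱽ-* F G = trans (cong₂ ℕ._*_ (Πᶠ-* (F ∘ inj₁) (G ∘ inj₁)) (Πᶠ-* (F ∘ inj₂) (G ∘ inj₂)))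
    (interchange (Πᶠ (F ∘ inj₁)) (Πᶠ (G ∘ inj₁)) (Πᶠ (F ∘ inj₂)) (Πᶠ (G ∘ inj₂)))
    where
    interchange : ∀ a b c d → a * b * (c * d) ≡ a * c * (b * d)
    interchange = ℕ-solve-∀

  ∏ⱽ-peak : ∀ r (F : Vertex s t → ℕ) → (∀ v → v ≢ r → F v ≡ 1) → ∏ⱽ F ≡ F r
  ∏ⱽ-peak (inj₁ i) F h = trans (cong₂ ℕ._*_ (Πᶠ-peak i (F ∘ inj₁) (λ y ne → h (inj₁ y) (λ { refl → ne refl }))) (Πᶠ-one (λ y → h (inj₂ y) λ ()))) (ℕₚ.*-identityʳ _)
  ∏ⱽ-peak (inj₂ j) F h = trans (cong₂ ℕ._*_ (Πᶠ-one (λ y → h (inj₁ y) λ ())) (Πᶠ-peak j (F ∘ inj₂) (λ y ne → h (inj₂ y) (λ { refl → ne refl })))) (ℕₚ.+-identityʳ _)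

  -- The numbers of rotation systems of a tree and of a tree planted at r.
  ω : Mat s t → ℕ
  ω W = ∏ⱽ (λ v → (deg W v ∸ 1) !)

  ωₚ : Vertex s t → Mat s t → ℕ
  ωₚ r W = ∏ⱽ (λ v → (pick (v ≟ⱽ r) (deg W v) (deg W v ∸ 1)) !)

  -- The half-edge can be inserted behind any of the edges at `r`. So planting at `r` amounts to
  -- distinguishing an edge at `r`, namely the last one before the half-edge.
  ωₚ-deg : ∀ r W → 0 < deg W r → ωₚ r W ≡ deg W r * ω W
  ωₚ-deg r W pos = trans (∏ⱽ-cong factor) (trans (∏ⱽ-* (λ v → pick (v ≟ⱽ r) (deg W r) 1) (λ v → (deg W v ∸ 1) !))
      (cong (ℕ._* ω W) (trans (∏ⱽ-peak r _ off) on)))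
    where
    factorial : ∀ n → 0 < n → n ! ≡ n * (n ∸ 1) !
    factorial (suc n) _ = refl
    factor : ∀ (v : Vertex s t) → (pick (v ≟ⱽ r) (deg W v) (deg W v ∸ 1)) ! ≡ pick (v ≟ⱽ r) (deg W r) 1 * (deg W v ∸ 1) !
    factor v with v ≟ⱽ r
    ... | yes refl = factorial (deg W v) pos
    ... | no _ = sym (ℕₚ.+-identityʳ _)
    off : ∀ v → v ≢ r → pick (v ≟ⱽ r) (deg W r) 1 ≡ 1
    off v ne with v ≟ⱽ r
    ... | yes e = ⊥-elim (ne e)
    ... | no _ = refl
    on : pick (r ≟ⱽ r) (deg W r) 1 ≡ deg W r
    on with r ≟ⱽ r
    ... | yes _ = refl
    ... | no ne = ⊥-elim (ne refl)

  ωₚ-isolated : ∀ r W → (∀ v → deg W v ≡ 0) → ωₚ r W ≡ 1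
  ωₚ-isolated r W h = trans (∏ⱽ-cong {G = λ _ → 1} one) (cong₂ ℕ._*_ (Πᶠ-one {s} (λ _ → refl)) (Πᶠ-one {t} (λ _ → refl)))
    where
    one : ∀ v → (pick (v ≟ⱽ r) (deg W v) (deg W v ∸ 1)) ! ≡ 1
    one v rewrite h v with v ≟ⱽ r
    ... | yes _ = refl
    ... | no _ = refl

  -- The new edge takes the place of the half-edges in the rotations at both roots. At each vertex
  -- at least one of the two factors is 0! = 1.
  ω-joined : ∀ {S S₁ S₂ : Sub s t} {W W₁ W₂ : Mat s t} → Splits S S₁ S₂ →
             TreeOn S₁ W₁ → TreeOn S₂ W₂ → ∀ i j c → inj₁ i ∈ₛ S₁ → inj₂ j ∈ₛ S₂ → 0 < c → Joined W₁ W₂ i j c W →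
             ω W ≡ ωₚ (inj₁ i) W₁ * ωₚ (inj₂ j) W₂
  ω-joined {S} {S₁} {S₂} {W} {W₁} {W₂} splits T₁ T₂ i j c i∈ j∈ c>0 joined =
    trans (∏ⱽ-cong factor) (∏ⱽ-* (λ v → (pick (v ≟ⱽ a) (deg W₁ v) (deg W₁ v ∸ 1)) !) (λ v → (pick (v ≟ⱽ b) (deg W₂ v) (deg W₂ v ∸ 1)) !))
    where
    a b : Vertex s t
    a = inj₁ i
    b = inj₂ j
    b∉ : mem S₁ b ≡ true → ⊥
    b∉ p = part-disjoint (splits b) p j∈
    outside₂ : ∀ (v : Vertex s t) → mem S₁ v ≡ true → mem S₂ v ≡ false
    outside₂ v = part-outsideʳ (splits v)
    isolated₁ : ∀ (v : Vertex s t) → mem S₁ v ≡ false → ∀ r → v ≢ r → pick (v ≟ⱽ r) (deg W₁ v) (deg W₁ v ∸ 1) ≡ 0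
    isolated₁ v e r ne rewrite deg-outside T₁ v e with v ≟ⱽ r
    ... | yes _ = refl
    ... | no _ = refl
    isolated₂ : ∀ (v : Vertex s t) → mem S₂ v ≡ false → ∀ r → v ≢ r → pick (v ≟ⱽ r) (deg W₂ v) (deg W₂ v ∸ 1) ≡ 0
    isolated₂ v e r ne rewrite deg-outside T₂ v e with v ≟ⱽ r
    ... | yes _ = refl
    ... | no _ = refl
    root : ∀ d r (v : Vertex s t) → (d + pt r 1 v) ∸ 1 ≡ pick (v ≟ⱽ r) d (d ∸ 1)
    root d r v with v ≟ⱽ r
    ... | yes refl = trans (cong (λ z → (d + z) ∸ 1) (pt-hit v 1)) (trans (cong (_∸ 1) (ℕₚ.+-comm d 1)) refl)
    ... | no ne = trans (cong (λ z → (d + z) ∸ 1) (pt-miss r 1 v ne)) (cong (_∸ 1) (ℕₚ.+-identityʳ d))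
    factor : ∀ (v : Vertex s t) → (deg W v ∸ 1) ! ≡ (pick (v ≟ⱽ a) (deg W₁ v) (deg W₁ v ∸ 1)) ! * (pick (v ≟ⱽ b) (deg W₂ v) (deg W₂ v ∸ 1)) !
    factor v with mem S₁ v in eq
    ... | true = trans (cong (λ z → (z ∸ 1) !) (trans (deg-joined {W = W} splits T₁ T₂ i j c i∈ j∈ c>0 joined v)
            (trans (cong₂ (λ x y → deg W₁ v + x + (pt a 1 v + y)) (deg-outside T₂ v (outside₂ v eq)) (pt-miss b 1 v v≢b))
              (cong₂ ℕ._+_ (ℕₚ.+-identityʳ (deg W₁ v)) (ℕₚ.+-identityʳ (pt a 1 v))))))
          (trans (cong _! (root (deg W₁ v) a v)) (sym (trans (cong (λ z → (pick (v ≟ⱽ a) (deg W₁ v) (deg W₁ v ∸ 1)) ! * z !) (isolated₂ v (outside₂ v eq) b v≢b)) (ℕₚ.*-identityʳ _))))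
      where
      v≢b : v ≢ b
      v≢b e = b∉ (trans (cong (mem S₁) (sym e)) eq)
    ... | false = trans (cong (λ z → (z ∸ 1) !) (trans (deg-joined {W = W} splits T₁ T₂ i j c i∈ j∈ c>0 joined v)
            (cong₂ (λ x y → x + deg W₂ v + (y + pt b 1 v)) (deg-outside T₁ v eq) (pt-miss a 1 v v≢a))))
          (trans (cong _! (root (deg W₂ v) b v)) (sym (trans (cong (λ z → z ! * (pick (v ≟ⱽ b) (deg W₂ v) (deg W₂ v ∸ 1)) !) (isolated₁ v eq a v≢a)) (ℕₚ.+-identityʳ _))))
      where
      v≢a : v ≢ a
      v≢a e = false≢true eq (trans (cong (mem S₁) e) i∈)

-- Planted trees

module _ {s t : ℕ} where

  index : Vertex s t → Fin (s + t)
  index (inj₁ i) = i ↑ˡ t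
  index (inj₂ j) = s ↑ʳ j

  mem-index : ∀ S v → lookup S (index v) ≡ mem S v
  mem-index S (inj₁ _) = refl
  mem-index S (inj₂ _) = refl

  index-injective : ∀ u v → index u ≡ index v → u ≡ v
  index-injective u v e with trans (sym (splitAt-index u)) (trans (cong (Fin.splitAt s) e) (splitAt-index v))
    where
    splitAt-index : ∀ v → Fin.splitAt s (index v) ≡ v
    splitAt-index (inj₁ i) = Finₚ.splitAt-↑ˡ s i t
    splitAt-index (inj₂ j) = Finₚ.splitAt-↑ʳ s t j
  ... | refl = refl

  ∈-single : ∀ r → r ∈ₛ single (index r)
  ∈-single r = trans (sym (mem-index _ r)) (lookup-single (index r))

  ∈-single⁻ : ∀ r v → v ∈ₛ single (index r) → v ≡ r
  ∈-single⁻ r v e = sym (index-injective r v (lookup-single⁻ (index r) (index v) (trans (mem-index _ v) e)))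

  split⇒splits : ∀ {S S₁ S₂ : Sub s t} → Split S S₁ S₂ → Splits {s} {t} S S₁ S₂
  split⇒splits p (inj₁ i) = split⇒parts p (i ↑ˡ t)
  split⇒splits p (inj₂ j) = split⇒parts p (s ↑ʳ j)

  splits⇒split : ∀ {S S₁ S₂ : Sub s t} → Splits {s} {t} S S₁ S₂ → Split S S₁ S₂
  splits⇒split {S} {S₁} {S₂} h = parts⇒split S S₁ S₂ part
    where
    part : ∀ x → Part (lookup S₁ x) (lookup S₂ x) (lookup S x)
    part x with lookup-mem {s} {t} S x
    ... | v , e rewrite e S | e S₁ | e S₂ = h v

  Adj? : ∀ W (u v : Vertex s t) → Dec (Adj W u v)
  Adj? W (inj₁ i) (inj₂ j) = 0 <? ent W i j
  Adj? W (inj₂ j) (inj₁ i) = 0 <? ent W i j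
  Adj? W (inj₁ _) (inj₁ _) = no λ ()
  Adj? W (inj₂ _) (inj₂ _) = no λ ()

  noEdges : Mat s t
  noEdges = mat (λ _ _ → 0)

  Adj-noEdges : ∀ u v → ¬ Adj noEdges u v
  Adj-noEdges (inj₁ i) (inj₂ j) e = ℕₚ.<-irrefl (sym (ent-mat _ i j)) e
  Adj-noEdges (inj₂ j) (inj₁ i) e = ℕₚ.<-irrefl (sym (ent-mat _ i j)) e

  isolated⇒single : ∀ {S W} → TreeOn S W → ∀ r → r ∈ₛ S → (∀ u → ¬ Adj W r u) → S ≡ single (index r) × W ≡ noEdges
  isolated⇒single {S} {W} T r r∈ isolated = mem-ext same , mat-ext λ i j → trans (nonPositive (none i j)) (sym (ent-mat _ i j))
    where
    only : ∀ v → v ∈ₛ S → v ≡ r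
    only v v∈ with conn T r v r∈ v∈
    ... | nil = refl
    ... | e ◅ _ = ⊥-elim (isolated _ e)
    none : ∀ i j → ¬ 0 < ent W i j
    none i j e = isolated (inj₂ j) (subst (λ u → Adj W u (inj₂ j)) (only (inj₁ i) (supp T (inj₁ i) (inj₂ j) e)) e)
    agree : ∀ x y → (x ≡ true → y ≡ true) → (y ≡ true → x ≡ true) → x ≡ y
    agree true  y     f g = sym (f refl)
    agree false true  f g = g refl
    agree false false f g = refl
    same : ∀ v → mem S v ≡ mem (single (index r)) v
    same v = agree (mem S v) (mem (single (index r)) v)
      (λ p → subst (_∈ₛ single (index r)) (sym (only v p)) (∈-single r))
      (λ q → subst (_∈ₛ S) (sym (∈-single⁻ r v q)) r∈)

  single-tree : ∀ r → TreeOn (single (index r)) noEdges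
  single-tree r = treeOn (λ u v e → ⊥-elim (Adj-noEdges u v e))
    (λ u v u∈ v∈ → subst (λ z → Star (Adj noEdges) z v) (trans (∈-single⁻ r v v∈) (sym (∈-single⁻ r u u∈))) nil)
    (λ u v e → ⊥-elim (Adj-noEdges u v e))

  _≟ᴹ_ : DecidableEquality (Mat s t)
  _≟ᴹ_ = Vecₚ.≡-dec (Vecₚ.≡-dec ℕ._≟_)

module Weighted {s t} (k : Fin s → ℕ) (l : Fin t → ℕ) (k≥1 : ∀ i → 1 ≤ k i) (l≥1 : ∀ j → 1 ≤ l j) where

  wt : Vertex s t → ℕ
  wt (inj₁ i) = k i
  wt (inj₂ j) = l j

  wt≥1 : ∀ v → 1 ≤ wt v
  wt≥1 (inj₁ i) = k≥1 i
  wt≥1 (inj₂ j) = l≥1 j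

  -- The value 0 outside `S` lets the balance equations be stated for all vertices.
  wS : Sub s t → Vertex s t → ℕ
  wS S v = if mem S v then wt v else 0

  wS-in : ∀ {S} v → v ∈ₛ S → wS S v ≡ wt v
  wS-in v e = cong (λ b → if b then wt v else 0) e

  wS-out : ∀ {S} v → mem S v ≡ false → wS S v ≡ 0
  wS-out v e = cong (λ b → if b then wt v else 0) e

  wS-split : ∀ {S S₁ S₂} → Splits {s} {t} S S₁ S₂ → ∀ v → wS S v ≡ wS S₁ v + wS S₂ v
  wS-split splits v = part (splits v)
    where
    part : ∀ {a b c} → Part a b c → (if c then wt v else 0) ≡ (if a then wt v else 0) + (if b then wt v else 0)
    part outside = refl
    part left = sym (ℕₚ.+-identityʳ (wt v))
    part right = refl

  -- A tree with a half-edge of positive weight x attached to the root r.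
  PlantedWith : ℕ → Sub s t → Vertex s t → Mat s t → Set
  PlantedWith x S r W = r ∈ₛ S × TreeOn S W × 1 ≤ x × (∀ v → mg W v + pt r x v ≡ wS S v)

  Planted : Sub s t → Vertex s t → Mat s t → Set
  Planted S r W = ∃[ x ] PlantedWith x S r W

  -- A tree with a distinguished edge whose ends still lack the weights `x` and `y`, at most one of
  -- them positive. The cases x > 0, y > 0 and x = y = 0 belong to trees planted at `r`, planted at
  -- `r'`, and without half-edge.
  Marked : Sub s t → Vertex s t → Vertex s t → Mat s t → Set
  Marked S r r' W = TreeOn S W × Adj W r r' × ∃[ x ] ∃[ y ] ((x ≡ 0 ⊎ y ≡ 0) × (∀ v → mg W v + (pt r x v + pt r' y v) ≡ wS S v))

  Marked-sym : ∀ {S r r' W} → Marked S r r' W → Marked S r' r W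
  Marked-sym {S} {r} {r'} {W} (T , e , x , y , z , h) = T , Adj-sym W e , y , x , Sum.swap z , λ v → trans (cong (mg W v ℕ.+_) (ℕₚ.+-comm (pt r' y v) (pt r x v))) (h v)

  -- Reads the weight of the half-edge off the matrix, so that `join` depends on no proofs.
  gap : Vertex s t → Mat s t → ℕ
  gap r W = wt r ∸ mg W r

  gap-planted : ∀ {x S} r W → PlantedWith x S r W → gap r W ≡ x
  gap-planted {x} {S} r W (r∈ , _ , _ , h) = trans (cong (_∸ mg W r) (trans (sym (wS-in r r∈)) (trans (sym (h r)) (cong (mg W r ℕ.+_) (pt-hit r x)))))
    (ℕₚ.m+n∸m≡n (mg W r) x)

  adj-≢ : ∀ {W} (u v : Vertex s t) → Adj W u v → u ≢ v
  adj-≢ (inj₁ _) (inj₂ _) _ ()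
  adj-≢ (inj₂ _) (inj₁ _) _ ()

  gap-marked : ∀ {S r r' W} ((T , e , x , y , z , h) : Marked S r r' W) → gap r W ≡ x
  gap-marked {S} {r} {r'} {W} (T , e , x , y , z , h) = trans (cong (_∸ mg W r) (trans (sym (wS-in r (supp T r r' e)))
      (trans (sym (h r)) (cong (mg W r ℕ.+_) (trans (cong₂ ℕ._+_ (pt-hit r x) (pt-miss r' y r (adj-≢ r r' e))) (ℕₚ.+-identityʳ x))))))
    (ℕₚ.m+n∸m≡n (mg W r) x)

  joinMat : Mat s t → Mat s t → Fin s → Fin t → ℕ → Mat s t
  joinMat W₁ W₂ i j c = mat (λ x y → ent W₁ x y + ent W₂ x y + δ i j c x y)

  joinMat-joined : ∀ W₁ W₂ i j c → Joined W₁ W₂ i j c (joinMat W₁ W₂ i j c)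
  joinMat-joined W₁ W₂ i j c = ent-mat _

  Fragments Edge : Set
  Fragments = (Sub s t × Sub s t) × ((Fin s × Mat s t) × (Fin t × Mat s t))
  Edge = Fin s × Fin t × Mat s t

  IsFragments : Sub s t → Fragments → Set
  IsFragments S ((S₁ , S₂) , (i , W₁) , (j , W₂)) = Split S S₁ S₂ × (Planted S₁ (inj₁ i) W₁ × Planted S₂ (inj₂ j) W₂)

  IsEdge : Sub s t → Edge → Set
  IsEdge S (i , j , W) = Marked S (inj₁ i) (inj₂ j) W

  joinWeight : Fin s → Mat s t → Fin t → Mat s t → ℕ
  joinWeight i W₁ j W₂ = gap (inj₁ i) W₁ ⊓ gap (inj₂ j) W₂

  join : Fragments → Edge
  join (_ , (i , W₁) , (j , W₂)) = i , j , joinMat W₁ W₂ i j (joinWeight i W₁ j W₂)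

  joinWeight-positive : ∀ {S₁ S₂} i W₁ j W₂ → Planted S₁ (inj₁ i) W₁ → Planted S₂ (inj₂ j) W₂ → 0 < joinWeight i W₁ j W₂
  joinWeight-positive i W₁ j W₂ (x , p) (y , q) = ℕₚ.⊓-glb (subst (1 ≤_) (sym (gap-planted (inj₁ i) W₁ p)) (proj₁ (proj₂ (proj₂ p)))) (subst (1 ≤_) (sym (gap-planted (inj₂ j) W₂ q)) (proj₁ (proj₂ (proj₂ q))))

  join-isEdge : ∀ S z → IsFragments S z → IsEdge S (join z)
  join-isEdge S ((S₁ , S₂) , (i , W₁) , (j , W₂)) (split , P@(x , p@(i∈ , T₁ , x≥1 , h)) , Q@(y , q@(j∈ , T₂ , y≥1 , h'))) =
    join-tree splits T₁ T₂ i j c i∈ j∈ c>0 joined , joined-edge {W = joinMat W₁ W₂ i j c} splits T₁ T₂ i j c i∈ j∈ c>0 joined , x ∸ c , y ∸ c , oneZero , balance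
    where
    splits = split⇒splits split
    c = joinWeight i W₁ j W₂
    c>0 = joinWeight-positive i W₁ j W₂ P Q
    joined = joinMat-joined W₁ W₂ i j c
    a b : Vertex s t
    a = inj₁ i
    b = inj₂ j
    c≡ : c ≡ x ⊓ y
    c≡ = cong₂ _⊓_ (gap-planted a W₁ p) (gap-planted b W₂ q)
    c≤x : c ≤ x
    c≤x = subst (_≤ x) (sym c≡) (ℕₚ.m⊓n≤m x y)
    c≤y : c ≤ y
    c≤y = subst (_≤ y) (sym c≡) (ℕₚ.m⊓n≤n x y)
    oneZero : x ∸ c ≡ 0 ⊎ y ∸ c ≡ 0
    oneZero = Sum.map (λ e → trans (cong (x ∸_) (trans c≡ e)) (ℕₚ.n∸n≡0 x)) (λ e → trans (cong (y ∸_) (trans c≡ e)) (ℕₚ.n∸n≡0 y)) (ℕₚ.⊓-sel x y)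
    balance : ∀ v → mg (joinMat W₁ W₂ i j c) v + (pt a (x ∸ c) v + pt b (y ∸ c) v) ≡ wS S v
    balance v = begin
      mg (joinMat W₁ W₂ i j c) v + (pt a (x ∸ c) v + pt b (y ∸ c) v)
        ≡⟨ cong (ℕ._+ (pt a (x ∸ c) v + pt b (y ∸ c) v)) (mg-joined {W = joinMat W₁ W₂ i j c} joined v) ⟩
      mg W₁ v + mg W₂ v + (pt a c v + pt b c v) + (pt a (x ∸ c) v + pt b (y ∸ c) v)
        ≡⟨ regroup (mg W₁ v) (mg W₂ v) (pt a c v) (pt b c v) (pt a (x ∸ c) v) (pt b (y ∸ c) v) ⟩
      (mg W₁ v + (pt a c v + pt a (x ∸ c) v)) + (mg W₂ v + (pt b c v + pt b (y ∸ c) v))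
        ≡⟨ cong₂ (λ p q → (mg W₁ v + p) + (mg W₂ v + q)) (sym (pt-+ a c (x ∸ c) v)) (sym (pt-+ b c (y ∸ c) v)) ⟩
      (mg W₁ v + pt a (c + (x ∸ c)) v) + (mg W₂ v + pt b (c + (y ∸ c)) v)
        ≡⟨ cong₂ (λ p q → (mg W₁ v + pt a p v) + (mg W₂ v + pt b q v)) (ℕₚ.m+[n∸m]≡n c≤x) (ℕₚ.m+[n∸m]≡n c≤y) ⟩
      (mg W₁ v + pt a x v) + (mg W₂ v + pt b y v)
        ≡⟨ cong₂ ℕ._+_ (h v) (h' v) ⟩
      wS S₁ v + wS S₂ v
        ≡⟨ wS-split {S} splits v ⟨
      wS S v ∎
      where
      open ≡-Reasoning
      regroup : ∀ m n a b a' b' → m + n + (a + b) + (a' + b') ≡ (m + (a + a')) + (n + (b + b'))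
      regroup = ℕ-solve-∀

  -- If the removed edge has weight c and its ends lack x and y, the pieces get half-edges of
  -- weights c + x and c + y. As x or y is 0, the minimum of these is c, and joining restores the
  -- edge.
  cut : ∀ S z → IsEdge S z → ∃[ f ] IsFragments S f × join f ≡ z
  cut S (i , j , W) (T , e , x , y , oneZero , h) =
    ((S₁ , S₂) , (i , W₁) , (j , W₂)) , (splits⇒split splits , (c + x , P) , (c + y , Q)) ,
    cong (λ z → i , j , z) (trans (cong (joinMat W₁ W₂ i j) weight) (mat-ext λ u v → trans (ent-mat _ u v) (sym (joined u v))))
    where
    S₁ = leftPart T i j e
    S₂ = rightPart T i j e
    W₁ = restrict W S₁
    W₂ = restrict W S₂
    T₁ = left-tree T i j e
    T₂ = right-tree T i j e
    c = ent W i j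
    a b : Vertex s t
    a = inj₁ i
    b = inj₂ j
    splits : Splits {s} {t} S S₁ S₂
    splits = splits-cut T i j e
    joined : Joined W₁ W₂ i j c W
    joined = restrict-joined T i j e splits (i∈left T i j e) (j∈right T i j e) (left-closed T i j e)
    total : ∀ v → mg W₁ v + mg W₂ v + (pt a c v + pt b c v) + (pt a x v + pt b y v) ≡ wS S₁ v + wS S₂ v
    total v = trans (cong (ℕ._+ (pt a x v + pt b y v)) (sym (mg-joined {W = W} joined v))) (trans (h v) (wS-split {S} splits v))
    outside₁ : ∀ (v : Vertex s t) → mem S₂ v ≡ true → mem S₁ v ≡ false
    outside₁ v = part-outsideˡ (splits v)
    outside₂ : ∀ (v : Vertex s t) → mem S₁ v ≡ true → mem S₂ v ≡ false
    outside₂ v = part-outsideʳ (splits v)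
    a∉ : ∀ (v : Vertex s t) → mem S₁ v ≡ false → v ≢ a
    a∉ v p q = false≢true p (trans (cong (mem S₁) q) (i∈left T i j e))
    b∉ : ∀ (v : Vertex s t) → mem S₂ v ≡ false → v ≢ b
    b∉ v p q = false≢true p (trans (cong (mem S₂) q) (j∈right T i j e))
    vanish₁ : ∀ v → mem S₁ v ≡ false → ∀ d → mg W₁ v + pt a d v ≡ 0
    vanish₁ v p d = cong₂ ℕ._+_ (mg-outside T₁ v p) (pt-miss a d v (a∉ v p))
    vanish₂ : ∀ v → mem S₂ v ≡ false → ∀ d → mg W₂ v + pt b d v ≡ 0
    vanish₂ v p d = cong₂ ℕ._+_ (mg-outside T₂ v p) (pt-miss b d v (b∉ v p))
    regroup : ∀ m n a b a' b' → m + n + (a + b) + (a' + b') ≡ (m + (a + a')) + (n + (b + b'))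
    regroup = ℕ-solve-∀
    total′ : ∀ v → (mg W₁ v + pt a (c + x) v) + (mg W₂ v + pt b (c + y) v) ≡ wS S₁ v + wS S₂ v
    total′ v = trans (trans (cong₂ (λ p q → (mg W₁ v + p) + (mg W₂ v + q)) (pt-+ a c x v) (pt-+ b c y v))
      (sym (regroup (mg W₁ v) (mg W₂ v) (pt a c v) (pt b c v) (pt a x v) (pt b y v)))) (total v)
    balance₁ : ∀ v → mg W₁ v + pt a (c + x) v ≡ wS S₁ v
    balance₁ v with mem S₁ v in p
    ... | false = vanish₁ v p (c + x)
    ... | true = trans (sym (ℕₚ.+-identityʳ _)) (trans (cong (mg W₁ v + pt a (c + x) v ℕ.+_) (sym (vanish₂ v (outside₂ v p) (c + y))))
      (trans (total′ v) (trans (cong₂ ℕ._+_ (wS-in {S₁} v p) (wS-out {S₂} v (outside₂ v p))) (ℕₚ.+-identityʳ (wt v)))))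
    balance₂ : ∀ v → mg W₂ v + pt b (c + y) v ≡ wS S₂ v
    balance₂ v with mem S₂ v in p
    ... | false = vanish₂ v p (c + y)
    ... | true = trans (cong (ℕ._+ (mg W₂ v + pt b (c + y) v)) (sym (vanish₁ v (outside₁ v p) (c + x))))
      (trans (total′ v) (cong₂ ℕ._+_ (wS-out {S₁} v (outside₁ v p)) (wS-in {S₂} v p)))
    P : PlantedWith (c + x) S₁ a W₁
    P = i∈left T i j e , T₁ , ℕₚ.≤-trans e (ℕₚ.m≤m+n c x) , balance₁
    Q : PlantedWith (c + y) S₂ b W₂
    Q = j∈right T i j e , T₂ , ℕₚ.≤-trans e (ℕₚ.m≤m+n c y) , balance₂
    min : x ≡ 0 ⊎ y ≡ 0 → (c + x) ⊓ (c + y) ≡ c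
    min (inj₁ refl) = trans (cong (_⊓ (c + y)) (ℕₚ.+-identityʳ c)) (ℕₚ.m≤n⇒m⊓n≡m (ℕₚ.m≤m+n c y))
    min (inj₂ refl) = trans (cong ((c + x) ⊓_) (ℕₚ.+-identityʳ c)) (ℕₚ.m≥n⇒m⊓n≡n (ℕₚ.m≤m+n c x))
    weight : joinWeight i W₁ j W₂ ≡ c
    weight = trans (cong₂ _⊓_ (gap-planted a W₁ P) (gap-planted b W₂ Q)) (min oneZero)

  -- Stated for a triple equal to the join, in order that two fragments with the same join can be
  -- compared with one and the same cut.
  fragments-determined : ∀ S (f : Fragments) (let ((S₁ , S₂) , (i , W₁) , (j , W₂)) = f) → IsFragments S f →
    ∀ i' j' W → (i , j , joinMat W₁ W₂ i j (joinWeight i W₁ j W₂)) ≡ (i' , j' , W) → (T : TreeOn S W) (e : 0 < ent W i' j') →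
    S₁ ≡ leftPart T i' j' e × i ≡ i' × j ≡ j' × W₁ ≡ restrict W S₁ × W₂ ≡ restrict W S₂
  fragments-determined S ((S₁ , S₂) , (i , W₁) , (j , W₂)) (split , P@(x , (i∈ , T₁ , _)) , Q@(y , (j∈ , T₂ , _))) _ _ _ refl T e =
    mem-ext (left-unique T i j e splits i∈ j∈ (join-closed₁ {W = joinMat W₁ W₂ i j c} splits T₁ T₂ i j c i∈ j∈ c>0 joined)) , refl , refl ,
    sym (join-restrict₁ {W = joinMat W₁ W₂ i j c} splits T₁ T₂ i j c i∈ j∈ c>0 joined) , sym (join-restrict₂ {W = joinMat W₁ W₂ i j c} splits T₁ T₂ i j c i∈ j∈ c>0 joined)
    where
    splits = split⇒splits split
    c = joinWeight i W₁ j W₂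
    c>0 = joinWeight-positive i W₁ j W₂ P Q
    joined = joinMat-joined W₁ W₂ i j c

  split-right-unique : ∀ {n} {S A B B' : Vec Bool n} → Split S A B → Split S A B' → B ≡ B'
  split-right-unique [] [] = refl
  split-right-unique (skip p) (skip q) = cong (false ∷_) (split-right-unique p q)
  split-right-unique (left p) (left q) = cong (false ∷_) (split-right-unique p q)
  split-right-unique (right p) (right q) = cong (true ∷_) (split-right-unique p q)

  join-injective : ∀ S f g → IsFragments S f → IsFragments S g → join f ≡ join g → f ≡ g
  join-injective S f g F G eq with join-isEdge S f F
  ... | T , e , _ with fragments-determined S f F _ _ (proj₂ (proj₂ (join f))) refl T e | fragments-determined S g G _ _ (proj₂ (proj₂ (join f))) (sym eq) T e
  ...   | s₁ , _ , _ , w₁ , w₂ | s₁' , i≡ , j≡ , w₁' , w₂' = assemble f g F G s₁≡ (sym i≡) (sym j≡)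
      (trans w₁ (trans (cong (restrict (proj₂ (proj₂ (join f)))) s₁≡) (sym w₁'))) (λ s₂≡ → trans w₂ (trans (cong (restrict (proj₂ (proj₂ (join f)))) s₂≡) (sym w₂')))
    where
    s₁≡ = trans s₁ (sym s₁')
    assemble : ∀ (f g : Fragments) → IsFragments S f → IsFragments S g →
      proj₁ (proj₁ f) ≡ proj₁ (proj₁ g) → proj₁ (proj₁ (proj₂ f)) ≡ proj₁ (proj₁ (proj₂ g)) → proj₁ (proj₂ (proj₂ f)) ≡ proj₁ (proj₂ (proj₂ g)) →
      proj₂ (proj₁ (proj₂ f)) ≡ proj₂ (proj₁ (proj₂ g)) →
      (proj₂ (proj₁ f) ≡ proj₂ (proj₁ g) → proj₂ (proj₂ (proj₂ f)) ≡ proj₂ (proj₂ (proj₂ g))) → f ≡ g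
    assemble _ _ (p , _) (q , _) refl refl refl refl h with split-right-unique p q
    ... | refl with h refl
    ...   | refl = refl

-- Recursive enumeration and weighted sums of planted trees

∑-ℕ : ∀ n (f : Fin n → ℕ) → ∑ (allFin n) (λ i → + f i) ≡ + Σᶠ f
∑-ℕ zero f = refl
∑-ℕ (suc n) f = trans (∑-allFin-suc n (λ i → + f i)) (trans (cong (λ z → + f zero ℤ.+ z) (∑-ℕ n (f ∘ suc))) (cong +_ (sym (Σᶠ-suc f))))

sg-indicator : ∀ n (d : Dec (0 < n)) → + sg n ≡ indicator d
sg-indicator zero (no _) = refl
sg-indicator zero (yes ())
sg-indicator (suc n) (yes _) = refl
sg-indicator (suc n) (no h) = ⊥-elim (h (s≤s z≤n))

∑-filter-const : ∀ {A : Set} {D : A → Set} (D? : ∀ x → Dec (D x)) (xs : List A) c → ∑ (filter D? xs) (λ _ → c) ≡ ∑ xs (λ x → indicator (D? x)) ℤ.* c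
∑-filter-const D? xs c = trans (∑-filter D? (λ _ → c) (λ x → indicator (D? x) ℤ.* c) xs
    (λ x _ d → on (D? x) d) (λ x _ ¬d → off (D? x) ¬d)) (∑-*ʳ c xs (λ x → indicator (D? x)))
  where
  on : ∀ {A : Set} (d : Dec A) → A → c ≡ indicator d ℤ.* c
  on (yes _) _ = sym (ℤₚ.*-identityˡ c)
  on (no h) a = ⊥-elim (h a)
  off : ∀ {A : Set} (d : Dec A) → ¬ A → indicator d ℤ.* c ≡ + 0
  off (yes a) h = ⊥-elim (h a)
  off (no _) _ = ℤₚ.*-zeroˡ c

module _ {s t : ℕ} where

  deg-white : ∀ (W : Mat s t) i → + deg W (inj₁ i) ≡ ∑ (allFin t) (λ j → indicator (Adj? W (inj₁ i) (inj₂ j)))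
  deg-white W i = trans (cong +_ (Σᶠ-cong (ent-mat (λ i j → sg (ent W i j)) i))) (trans (sym (∑-ℕ t (λ j → sg (ent W i j)))) (∑-cong (allFin t) (λ j → sg-indicator (ent W i j) (0 <? ent W i j))))

  deg-black : ∀ (W : Mat s t) j → + deg W (inj₂ j) ≡ ∑ (allFin s) (λ i → indicator (Adj? W (inj₂ j) (inj₁ i)))
  deg-black W j = trans (cong +_ (Σᶠ-cong (λ i → ent-mat (λ i j → sg (ent W i j)) i j))) (trans (sym (∑-ℕ s (λ i → sg (ent W i j)))) (∑-cong (allFin s) (λ i → sg-indicator (ent W i j) (0 <? ent W i j))))

  Adj⇒deg : ∀ (W : Mat s t) u v → Adj W u v → 0 < deg W u
  Adj⇒deg W u v e = mg-positive (support W) u v (Adj-support⁺ W u v e)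

  deg⇒Adj : ∀ (W : Mat s t) u → 0 < deg W u → ∃[ v ] Adj W u v
  deg⇒Adj W u p = let (v , e) = mg-positive⁻ (support W) u p in v , Adj-support⁻ W u v e

module Sums {s t} (k : Fin s → ℕ) (l : Fin t → ℕ) (k≥1 : ∀ i → 1 ≤ k i) (l≥1 : ∀ j → 1 ≤ l j) where

  open Weighted k l k≥1 l≥1

  -- Plantings at the vertices e x of one colour, whose neighbours are vertices o y of the other one.
  module Rooted {m n} (e : Fin m → Vertex s t) (o : Fin n → Vertex s t)
    (neighbour : ∀ (W : Mat s t) x u → Adj W (e x) u → ∃[ y ] u ≡ o y)
    (deg-∑ : ∀ (W : Mat s t) x → + deg W (e x) ≡ ∑ (allFin n) (λ y → indicator (Adj? W (e x) (o y))))
    (S : Sub s t) {zs : List (Fin m × Fin n × Mat s t)}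
    (enum-zs : Enumerates (λ (x , y , W) → Marked S (e x) (o y) W) zs) where

    Open : Fin m × Fin n × Mat s t → Set
    Open (x , y , W) = 1 ≤ gap (e x) W

    open? : ∀ z → Dec (Open z)
    open? (x , y , W) = 1 ≤? gap (e x) W

    marked⇒planted : ∀ x y W → Marked S (e x) (o y) W → 1 ≤ gap (e x) W → Planted S (e x) W
    marked⇒planted x y W M@(T , a , d , d' , zero? , h) pos = d , supp T (e x) (o y) a , T , d≥1 , λ v →
        trans (cong (mg W v ℕ.+_) (sym (trans (cong (λ z → pt (e x) d v + z) (other v (d'≡0 zero?))) (ℕₚ.+-identityʳ _)))) (h v)
      where
      d≥1 : 1 ≤ d
      d≥1 = subst (1 ≤_) (gap-marked {S} {e x} {o y} {W} M) pos
      d'≡0 : d ≡ 0 ⊎ d' ≡ 0 → d' ≡ 0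
      d'≡0 (inj₁ refl) = ⊥-elim (ℕₚ.<-irrefl refl d≥1)
      d'≡0 (inj₂ q) = q
      other : ∀ v → d' ≡ 0 → pt (o y) d' v ≡ 0
      other v refl = pt-0 (o y) v

    planted⇒marked : ∀ x y W → Planted S (e x) W → Adj W (e x) (o y) → Marked S (e x) (o y) W
    planted⇒marked x y W (d , (r∈ , T , _ , h)) a = T , a , d , 0 , inj₂ refl , λ v →
        trans (cong (mg W v ℕ.+_) (trans (cong (λ z → pt (e x) d v + z) (pt-0 (o y) v)) (ℕₚ.+-identityʳ _))) (h v)

    Linked⁺ Lonely : Fin m × Mat s t → Set
    Linked⁺ (x , W) = Planted S (e x) W × 0 < deg W (e x)
    Lonely (x , W) = S ≡ single (index (e x)) × W ≡ noEdges

    -- A planted tree with an edge at its root arises from marked trees by forgetting the neighbour,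
    -- once for each neighbour.
    enum-linked : ∃ (Enumerates Linked⁺)
    enum-linked = enum-image (Productₚ.≡-dec Fin._≟_ _≟ᴹ_) (λ (x , y , W) → x , W)
      (λ { (x , y , W) (M , p) → marked⇒planted x y W M p , Adj⇒deg W (e x) (o y) (proj₁ (proj₂ M)) })
      (λ { (x , W) (P , d) → surj x W P d })
      (enum-filter open? enum-zs)
      where
      surj : ∀ x W (P : Planted S (e x) W) → 0 < deg W (e x) → ∃[ z ] (Marked S (e (proj₁ z)) (o (proj₁ (proj₂ z))) (proj₂ (proj₂ z)) × Open z) × (proj₁ z , proj₂ (proj₂ z)) ≡ (x , W)
      surj x W P d with deg⇒Adj W (e x) d
      ... | u , a with neighbour W x u a
      ...   | y , refl = (x , y , W) , (planted⇒marked x y W P a , subst (1 ≤_) (sym (gap-planted (e x) W (proj₂ P))) (proj₁ (proj₂ (proj₂ (proj₂ P))))) , refl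

    lonelyRoots : List (Fin m)
    lonelyRoots = filter (λ x → S ≟ˢ single (index (e x))) (allFin m)

    lonely : List (Fin m × Mat s t)
    lonely = map (λ x → x , noEdges) lonelyRoots

    enum-lonely : Enumerates Lonely lonely
    enum-lonely = enum-map (λ x → x , noEdges) (λ { x (_ , q) → q , refl }) (λ { _ _ _ _ refl → refl })
      (λ { (x , W) (q , refl) → x , (tt , q) , refl }) (enum-filter (λ x → S ≟ˢ single (index (e x))) (enum-allFin m))

    lonely⇒planted : ∀ x → S ≡ single (index (e x)) → Planted S (e x) noEdges
    lonely⇒planted x refl = wt (e x) , ∈-single (e x) , single-tree (e x) , wt≥1 (e x) , balance
      where
      balance : ∀ v → mg noEdges v + pt (e x) (wt (e x)) v ≡ wS S v
      balance v with v ≟ⱽ e x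
      ... | yes refl = trans (cong₂ ℕ._+_ (mg-zero noEdges v (Adj-noEdges v)) (pt-hit v (wt v))) (sym (wS-in {S} v (∈-single v)))
      ... | no ne = trans (cong₂ ℕ._+_ (mg-zero noEdges v (Adj-noEdges v)) (pt-miss (e x) (wt (e x)) v ne)) (sym (wS-out {S} v (absent v ne)))
        where
        absent : ∀ v → v ≢ e x → mem S v ≡ false
        absent v ne with mem S v in p
        ... | false = refl
        ... | true = ⊥-elim (ne (∈-single⁻ (e x) v p))

    deg-noEdges : ∀ (v : Vertex s t) → deg noEdges v ≡ 0
    deg-noEdges v = mg-zero (support noEdges) v (λ u a → Adj-noEdges v u (Adj-support⁻ noEdges v u a))

    linked⊎lonely : ∀ z → Planted S (e (proj₁ z)) (proj₂ z) → Linked⁺ z ⊎ Lonely z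
    linked⊎lonely (x , W) P@(d , (r∈ , T , _)) with 0 <? deg W (e x)
    ... | yes pos = inj₁ (P , pos)
    ... | no isolated = inj₂ (isolated⇒single T (e x) r∈ (λ u a → isolated (Adj⇒deg W (e x) u a)))

    enum-both : Enumerates (λ (x , W) → Planted S (e x) W) (proj₁ enum-linked ++ lonely)
    enum-both = enum-⇔ (λ { (x , W) (inj₁ (P , _)) → P ; (x , W) (inj₂ (q , refl)) → lonely⇒planted x q }) linked⊎lonely
      (enum-++ (λ { (x , W) (_ , pos) (_ , refl) → ℕₚ.<-irrefl (sym (deg-noEdges (e x))) pos }) (proj₂ enum-linked) enum-lonely)

    -- A planted tree is a single vertex or has an edge at its root. In the second case its
    -- rotations number deg times `ω`, and the factor deg is spent on choosing the neighbour that
    -- marks an edge.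
    ∑-planted : ∀ {ps} → Enumerates (λ (x , W) → Planted S (e x) W) ps →
      ∑ ps (λ (x , W) → + ωₚ (e x) W) ≡
      ∑ (allFin m) (λ x → indicator (S ≟ˢ single (index (e x)))) ℤ.+ ∑ (filter open? zs) (λ (x , y , W) → + ω W)
    ∑-planted {ps} enum-ps = begin
      ∑ ps f
        ≡⟨ ∑-bijection enum-ps enum-both (λ z → z) (λ _ p → p) (λ _ _ _ _ q → q) (λ y p → y , p , refl) (λ _ _ → refl) ⟩
      ∑ (proj₁ enum-linked ++ lonely) f
        ≡⟨ ∑-++ (proj₁ enum-linked) lonely f ⟩
      ∑ (proj₁ enum-linked) f ℤ.+ ∑ lonely f
        ≡⟨ ℤₚ.+-comm (∑ (proj₁ enum-linked) f) (∑ lonely f) ⟩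
      ∑ lonely f ℤ.+ ∑ (proj₁ enum-linked) f
        ≡⟨ cong₂ ℤ._+_ lonely-sum linked-sum ⟩
      ∑ (allFin m) (λ x → indicator (S ≟ˢ single (index (e x)))) ℤ.+ ∑ (filter open? zs) (λ (x , y , W) → + ω W) ∎
      where
      open ≡-Reasoning
      f : Fin m × Mat s t → ℤ
      f (x , W) = + ωₚ (e x) W
      lonely-sum : ∑ lonely f ≡ ∑ (allFin m) (λ x → indicator (S ≟ˢ single (index (e x))))
      lonely-sum = trans (∑-map (λ x → x , noEdges) lonelyRoots f)
        (trans (∑-cong lonelyRoots (λ x → cong +_ (ωₚ-isolated (e x) noEdges deg-noEdges)))
          (trans (∑-filter-const (λ x → S ≟ˢ single (index (e x))) (allFin m) (+ 1)) (ℤₚ.*-identityʳ _)))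
      nbrs : Fin m × Mat s t → List (Fin n)
      nbrs (x , W) = filter (λ y → Adj? W (e x) (o y)) (allFin n)
      enum-nbrs : Enumerates (λ (z , y) → Linked⁺ z × ⊤ × Adj (proj₂ z) (e (proj₁ z)) (o y)) (pairs (proj₁ enum-linked) nbrs)
      enum-nbrs = enum-pairs nbrs (proj₂ enum-linked) (λ (x , W) _ → enum-filter (λ y → Adj? W (e x) (o y)) (enum-allFin n))
      linked-sum : ∑ (proj₁ enum-linked) f ≡ ∑ (filter open? zs) (λ (x , y , W) → + ω W)
      linked-sum = begin
        ∑ (proj₁ enum-linked) f
          ≡⟨ ∑-cong-∈ (proj₁ enum-linked) (λ (x , W) z∈ → trans (cong +_ (ωₚ-deg (e x) W (proj₂ (∈⇒P (proj₂ enum-linked) z∈))))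
               (trans (ℤₚ.pos-* (deg W (e x)) (ω W)) (trans (cong (ℤ._* + ω W) (deg-∑ W x)) (sym (∑-filter-const (λ y → Adj? W (e x) (o y)) (allFin n) (+ ω W)))))) ⟩
        ∑ (proj₁ enum-linked) (λ z → ∑ (nbrs z) (λ y → + ω (proj₂ z)))
          ≡⟨ ∑-pairs (proj₁ enum-linked) nbrs (λ (z , y) → + ω (proj₂ z)) ⟨
        ∑ (pairs (proj₁ enum-linked) nbrs) (λ (z , y) → + ω (proj₂ z))
          ≡⟨ ∑-bijection enum-nbrs (enum-filter open? enum-zs) (λ ((x , W) , y) → x , y , W)
               (λ { ((x , W) , y) ((P , _) , _ , a) → planted⇒marked x y W P a , subst (1 ≤_) (sym (gap-planted (e x) W (proj₂ P))) (proj₁ (proj₂ (proj₂ (proj₂ P)))) })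
               (λ { _ _ _ _ refl → refl })
               (λ { (x , y , W) (M , p) → ((x , W) , y) , ((marked⇒planted x y W M p , Adj⇒deg W (e x) (o y) (proj₁ (proj₂ M))) , tt , proj₁ (proj₂ M)) , refl })
               (λ _ _ → refl) ⟩
        ∑ (filter open? zs) (λ (x , y , W) → + ω W) ∎

  neighbour-white : ∀ (W : Mat s t) (i : Fin s) u → Adj W (inj₁ i) u → ∃[ y ] u ≡ inj₂ y
  neighbour-white W i (inj₂ j) _ = j , refl

  neighbour-black : ∀ (W : Mat s t) (j : Fin t) u → Adj W (inj₂ j) u → ∃[ y ] u ≡ inj₁ y
  neighbour-black W j (inj₁ i) _ = i , refl

  flip : Fin s × Fin t × Mat s t → Fin t × Fin s × Mat s t
  flip (i , j , W) = j , i , W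

  enum-flip : ∀ (S : Sub s t) {zs : List Edge} → Enumerates (IsEdge S) zs → Enumerates (λ (j , i , W) → Marked S (inj₂ j) (inj₁ i) W) (map flip zs)
  enum-flip S = enum-map flip (λ (i , j , W) → Marked-sym {S} {inj₁ i} {inj₂ j} {W}) (λ { _ _ _ _ refl → refl })
    (λ { (j , i , W) M → (i , j , W) , Marked-sym {S} {inj₂ j} {inj₁ i} {W} M , refl })

  module White (S : Sub s t) {zs : List Edge} (enum-zs : Enumerates (IsEdge S) zs) = Rooted inj₁ inj₂ neighbour-white deg-white S enum-zs
  module Black (S : Sub s t) {zs : List Edge} (enum-zs : Enumerates (IsEdge S) zs) = Rooted inj₂ inj₁ neighbour-black deg-black S (enum-flip S enum-zs)

  IsWhite : Sub s t → Fin s × Mat s t → Set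
  IsWhite S (i , W) = Planted S (inj₁ i) W

  IsBlack : Sub s t → Fin t × Mat s t → Set
  IsBlack S (j , W) = Planted S (inj₂ j) W

  Plantings : Sub s t → Set
  Plantings S = ∃ (Enumerates (IsWhite S)) × ∃ (Enumerates (IsBlack S))

  size-≥1 : ∀ (S : Sub s t) (v : Vertex s t) → v ∈ₛ S → 1 ≤ size S
  size-≥1 S v p = size-positive S (index v) (trans (mem-index S v) p)

  enum-fragments : ∀ S → (fs : Sub s t × Sub s t → List ((Fin s × Mat s t) × (Fin t × Mat s t))) →
    (∀ (ab : Sub s t × Sub s t) → Split S (proj₁ ab) (proj₂ ab) →
      Enumerates (λ (p , q) → IsWhite (proj₁ ab) p × IsBlack (proj₂ ab) q) (fs ab)) →
    Enumerates (IsFragments S) (pairs (splitList S) fs)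
  enum-fragments S fs h = enum-pairs fs (enum-splitList S) h

  enum-edges : ∀ (S : Sub s t) {xs : List Fragments} → Enumerates (IsFragments S) xs → Enumerates (IsEdge S) (map join xs)
  enum-edges S = enum-map join (join-isEdge S) (join-injective S) (cut S)

  -- Both pieces of a cut contain their root, so each is smaller than `S`.
  edgesFrom : ∀ S → (∀ S' → size S' < size S → Plantings S') → ∃ (Enumerates (IsEdge S))
  edgesFrom S rec = _ , enum-edges S (enum-fragments S (proj₁ ∘ fragments) (λ (A , B) p → proj₂ (fragments (A , B)) p))
    where
    fragments : (ab : Sub s t × Sub s t) → ∃[ zs ] (Split S (proj₁ ab) (proj₂ ab) →
      Enumerates (λ (p , q) → IsWhite (proj₁ ab) p × IsBlack (proj₂ ab) q) zs)
    fragments (A , B) with size A <? size S | size B <? size S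
    ... | yes p | yes q = _ , λ _ → enum-pairs _ (proj₂ (proj₁ (rec A p))) (λ _ _ → proj₂ (proj₂ (rec B q)))
    -- If `A` is not smaller than `S`, then `B` is empty and cannot contain a root.
    ... | no p | _ = [] , λ sp → enum-∅ λ { ((i , W₁) , (j , W₂)) (_ , (_ , j∈ , _)) → p (subst (size A <_) (sym (size-split sp))
      (ℕₚ.m<m+n (size A) (size-≥1 B (inj₂ j) j∈))) }
    ... | yes _ | no q = [] , λ sp → enum-∅ λ { ((i , W₁) , (j , W₂)) ((_ , i∈ , _) , _) → q (subst (size B <_) (sym (size-split sp))
      (ℕₚ.m<n+m (size B) (size-≥1 A (inj₁ i) i∈))) }

  plantingsFrom : ∀ S → ∃ (Enumerates (IsEdge S)) → Plantings S
  plantingsFrom S (zs , enum-zs) = (_ , White.enum-both S enum-zs) , (_ , Black.enum-both S enum-zs)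

  -- Planted trees on `S` come from marked trees on `S`, and these are joins of planted trees on
  -- smaller sets; `n` bounds the depth of the recursion.
  plantings : ∀ S → Plantings S
  plantings S = go (suc (size S)) S ℕₚ.≤-refl
    where
    go : ∀ n S → size S < n → Plantings S
    go (suc n) S lt = plantingsFrom S (edgesFrom S (λ S' lt' → go n S' (ℕₚ.<-≤-trans lt' (s≤s⁻¹ lt))))

  whites : ∀ S → List (Fin s × Mat s t)
  whites S = proj₁ (proj₁ (plantings S))

  blacks : ∀ S → List (Fin t × Mat s t)
  blacks S = proj₁ (proj₂ (plantings S))

  fragments : ∀ S → List Fragments
  fragments S = pairs (splitList S) (λ (A , B) → pairs (whites A) (λ _ → blacks B))

  enum-all-fragments : ∀ S → Enumerates (IsFragments S) (fragments S)
  enum-all-fragments S = enum-fragments S _ (λ (A , B) _ → enum-pairs _ (proj₂ (proj₁ (plantings A))) (λ _ _ → proj₂ (proj₂ (plantings B))))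

  edgeList : ∀ S → List Edge
  edgeList S = map join (fragments S)

  enum-edgeList : ∀ S → Enumerates (IsEdge S) (edgeList S)
  enum-edgeList S = enum-edges S (enum-all-fragments S)

  ws : Vec ℤ (s + t)
  ws = vertexWeights k l

  f⁺ f⁻ : K (s + t)
  f⁺ = tab (λ S → ∑ (whites S) (λ (i , W) → + ωₚ (inj₁ i) W))
  f⁻ = tab (λ S → ∑ (blacks S) (λ (j , W) → + ωₚ (inj₂ j) W))

  q : Sub s t → ℤ
  q S = ∑ (edgeList S) (λ (i , j , W) → + ω W)

  ∑-product : ∀ {A B : Set} (xs : List A) (ys : List B) f g → ∑ xs f ℤ.* ∑ ys g ≡ ∑ (pairs xs (λ _ → ys)) (λ (x , y) → f x ℤ.* g y)
  ∑-product xs ys f g = trans (sym (∑-*ʳ (∑ ys g) xs f)) (trans (∑-cong xs (λ x → sym (∑-*ˡ (f x) ys g))) (sym (∑-pairs xs (λ _ → ys) (λ (x , y) → f x ℤ.* g y))))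

  -- A term of the product is a pair of fragments with rotations; `join` is a bijection onto marked
  -- trees, and `ω-joined` matches the numbers of rotations.
  coef-f⁺⊛f⁻ : ∀ S → coef (f⁺ ⊛ f⁻) S ≡ q S
  coef-f⁺⊛f⁻ S = begin
    coef (f⁺ ⊛ f⁻) S
      ≡⟨ coef-⊛ f⁺ f⁻ S ⟩
    ∑ (splitList S) (λ (A , B) → coef f⁺ A ℤ.* coef f⁻ B)
      ≡⟨ ∑-cong (splitList S) (λ (A , B) → trans (cong₂ ℤ._*_ (coef-tab _ A) (coef-tab _ B)) (∑-product (whites A) (blacks B) _ _)) ⟩
    ∑ (splitList S) (λ (A , B) → ∑ (pairs (whites A) (λ _ → blacks B)) (λ ((i , W₁) , (j , W₂)) → + ωₚ (inj₁ i) W₁ ℤ.* + ωₚ (inj₂ j) W₂))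
      ≡⟨ ∑-pairs (splitList S) _ (λ (_ , (i , W₁) , (j , W₂)) → + ωₚ (inj₁ i) W₁ ℤ.* + ωₚ (inj₂ j) W₂) ⟨
    ∑ (fragments S) (λ (_ , (i , W₁) , (j , W₂)) → + ωₚ (inj₁ i) W₁ ℤ.* + ωₚ (inj₂ j) W₂)
      ≡⟨ ∑-cong-∈ (fragments S) (λ f f∈ → product f (∈⇒P (enum-all-fragments S) f∈)) ⟩
    ∑ (fragments S) (λ f → + ω (proj₂ (proj₂ (join f))))
      ≡⟨ ∑-map join (fragments S) (λ (i , j , W) → + ω W) ⟨
    q S ∎
    where
    open ≡-Reasoning
    product : ∀ f → IsFragments S f → (let (_ , (i , W₁) , (j , W₂)) = f) → + ωₚ (inj₁ i) W₁ ℤ.* + ωₚ (inj₂ j) W₂ ≡ + ω (proj₂ (proj₂ (join f)))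
    product (_ , (i , W₁) , (j , W₂)) (sp , P@(_ , i∈ , T₁ , _) , Q@(_ , j∈ , T₂ , _)) =
      trans (sym (ℤₚ.pos-* (ωₚ (inj₁ i) W₁) _)) (cong +_ (sym (ω-joined {W = joinMat W₁ W₂ i j (joinWeight i W₁ j W₂)} (split⇒splits sp) T₁ T₂ i j (joinWeight i W₁ j W₂) i∈ j∈
        (joinWeight-positive i W₁ j W₂ P Q) (joinMat-joined W₁ W₂ i j (joinWeight i W₁ j W₂)))))

-- The weight of a vertex set and the factorisation

tailFrom : ∀ {A : Set} s {t} → Vec A (s + t) → Vec A t
tailFrom zero    v       = v
tailFrom (suc s) (x ∷ v) = tailFrom s v

lookup-tailFrom : ∀ {A : Set} s {t} (v : Vec A (s + t)) j → lookup (tailFrom s v) j ≡ lookup v (s ↑ʳ j)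
lookup-tailFrom zero v j = refl
lookup-tailFrom (suc s) (x ∷ v) j = lookup-tailFrom s v j

weigh-positive : ∀ {s t} (k : Fin s → ℕ) (ws : Vec ℤ t) z (S : Vec Bool (s + t)) →
  weigh z (Vec.tabulate (λ i → + k i) Vec.++ ws) S ≡ weigh (z ℤ.+ + Σᶠ (λ i → if lookup S (i ↑ˡ t) then k i else 0)) ws (tailFrom s S)
weigh-positive {zero} k ws z S = cong (λ x → weigh x ws S) (sym (ℤₚ.+-identityʳ z))
weigh-positive {suc s} {t} k ws z (false ∷ S) = trans (weigh-positive (k ∘ suc) ws z S)
  (cong (λ x → weigh (z ℤ.+ + x) ws (tailFrom s S)) (sym (Σᶠ-suc (λ i → if lookup (false ∷ S) (i ↑ˡ t) then k i else 0))))
weigh-positive {suc s} {t} k ws z (true ∷ S) = trans (weigh-positive (k ∘ suc) ws (z ℤ.+ + k zero) S)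
  (cong (λ x → weigh x ws (tailFrom s S)) (trans (ℤₚ.+-assoc z (+ k zero) _) (cong (λ x → z ℤ.+ + x) (sym (Σᶠ-suc (λ i → if lookup (true ∷ S) (i ↑ˡ t) then k i else 0))))))

weigh-negative : ∀ {t} (l : Fin t → ℕ) z (S : Vec Bool t) →
  weigh z (Vec.tabulate (λ j → ℤ.- + l j)) S ≡ z ℤ.- + Σᶠ (λ j → if lookup S j then l j else 0)
weigh-negative {zero} l z [] = sym (ℤₚ.+-identityʳ z)
weigh-negative {suc t} l z (false ∷ S) = trans (weigh-negative (l ∘ suc) z S)
  (cong (λ x → z ℤ.- + x) (sym (Σᶠ-suc (λ j → if lookup (false ∷ S) j then l j else 0))))
weigh-negative {suc t} l z (true ∷ S) = trans (weigh-negative (l ∘ suc) (z ℤ.- + l zero) S)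
  (trans (regroup z (+ l zero) (+ Σᶠ (λ j → if lookup S j then l (suc j) else 0)))
    (cong (λ x → z ℤ.- + x) (sym (Σᶠ-suc (λ j → if lookup (true ∷ S) j then l j else 0)))))
  where
  regroup : ∀ z a b → z ℤ.- a ℤ.- b ≡ z ℤ.- (a ℤ.+ b)
  regroup = ℤ-solve-∀

∑-pick : ∀ {A B : Set} (d : Dec B) (xs : List A) f → ∑ xs (λ x → pick d (f x) (+ 0)) ≡ pick d (∑ xs f) (+ 0)
∑-pick (yes _) xs f = refl
∑-pick (no _) xs f = ∑-zero xs

pick-yes : ∀ {A X : Set} (d : Dec A) {x y : X} → A → pick d x y ≡ x
pick-yes (yes _) _ = refl
pick-yes (no ¬a) a = ⊥-elim (¬a a)

pick-no : ∀ {A X : Set} (d : Dec A) {x y : X} → ¬ A → pick d x y ≡ y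
pick-no (yes a) ¬a = ⊥-elim (¬a a)
pick-no (no _) _ = refl

module Trees {s t} (k : Fin s → ℕ) (l : Fin t → ℕ) (k≥1 : ∀ i → 1 ≤ k i) (l≥1 : ∀ j → 1 ≤ l j) where

  open Weighted k l k≥1 l≥1
  open Sums k l k≥1 l≥1

  weight : Sub s t → ℤ
  weight = weigh (+ 0) ws

  weight-Σᶠ : ∀ S → weight S ≡ + Σᶠ (wS S ∘ inj₁) ℤ.- + Σᶠ (wS S ∘ inj₂)
  weight-Σᶠ S = trans (weigh-positive k negatives (+ 0) S) (trans (cong (λ z → weigh z negatives (tailFrom s S)) (ℤₚ.+-identityˡ (+ Σᶠ (wS S ∘ inj₁))))
    (trans (weigh-negative l (+ Σᶠ (wS S ∘ inj₁)) (tailFrom s S)) (cong (λ z → + Σᶠ (wS S ∘ inj₁) ℤ.- + z)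
      (Σᶠ-cong (λ j → cong (λ b → if b then l j else 0) (lookup-tailFrom s S j))))))
    where
    negatives : Vec ℤ t
    negatives = Vec.tabulate (λ j → ℤ.- + l j)

  -- Row sums and column sums of `W` have the same total, so it cancels and only the deficits are
  -- left.
  weight-deficits : ∀ S W (α : Fin s → ℕ) (β : Fin t → ℕ) → (∀ i → mg W (inj₁ i) + α i ≡ wS S (inj₁ i)) →
    (∀ j → mg W (inj₂ j) + β j ≡ wS S (inj₂ j)) → weight S ≡ + Σᶠ α ℤ.- + Σᶠ β
  weight-deficits S W α β p r = trans (weight-Σᶠ S) (trans
    (cong₂ (λ x y → + x ℤ.- + y)
      (trans (Σᶠ-cong (λ i → sym (p i))) (Σᶠ-+ (mg W ∘ inj₁) α))
      (trans (Σᶠ-cong (λ j → sym (r j))) (trans (Σᶠ-+ (mg W ∘ inj₂) β) (cong (ℕ._+ Σᶠ β) (sym (Σᶠ-swap (ent W)))))))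
    (cancel (+ Σᶠ (mg W ∘ inj₁)) (+ Σᶠ α) (+ Σᶠ β)))
    where
    cancel : ∀ m a b → (m ℤ.+ a) ℤ.- (m ℤ.+ b) ≡ a ℤ.- b
    cancel = ℤ-solve-∀

  weight-edge : ∀ S i j W ((T , e , x , y , _) : IsEdge S (i , j , W)) → weight S ≡ + x ℤ.- + y
  weight-edge S i j W (T , e , x , y , _ , h) = trans (weight-deficits S W (spike i x) (spike j y)
      (λ i' → trans (cong (mg W (inj₁ i') ℕ.+_) (sym (ℕₚ.+-identityʳ (spike i x i')))) (h (inj₁ i'))) (λ j' → h (inj₂ j')))
    (cong₂ (λ a b → + a ℤ.- + b) (Σᶠ-spike i x) (Σᶠ-spike j y))

  weight-white : ∀ S i W → Planted S (inj₁ i) W → + 0 ℤ.< weight S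
  weight-white S i W (x , (_ , _ , x≥1 , h)) = subst (+ 0 ℤ.<_) (sym (trans
      (weight-deficits S W (spike i x) (λ _ → 0) (λ i' → h (inj₁ i')) (λ j → h (inj₂ j)))
      (trans (cong₂ (λ a b → + a ℤ.- + b) (Σᶠ-spike i x) (Σᶠ-zero {t} (λ _ → refl))) (ℤₚ.+-identityʳ (+ x))))) (ℤ.+<+ x≥1)

  weight-black : ∀ S j W → Planted S (inj₂ j) W → weight S ℤ.< + 0
  weight-black S j W (x , (_ , _ , x≥1 , h)) = subst (ℤ._< + 0) (sym (trans
      (weight-deficits S W (λ _ → 0) (spike j x) (λ i → h (inj₁ i)) (λ j' → h (inj₂ j')))
      (trans (cong₂ (λ a b → + a ℤ.- + b) (Σᶠ-zero {s} (λ _ → refl)) (Σᶠ-spike j x)) (ℤₚ.+-identityˡ (ℤ.- + x))))) (ℤₚ.neg-mono-< (ℤ.+<+ x≥1))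

  module _ (S : Sub s t) where

    open White S (enum-edgeList S) using () renaming (open? to openWhite?; ∑-planted to ∑-white; lonely⇒planted to lonelyWhite)
    open Black S (enum-edgeList S) using () renaming (open? to openBlack?; ∑-planted to ∑-black; lonely⇒planted to lonelyBlack)

    positive? : Dec (+ 0 ℤ.< weight S)
    positive? = + 0 ℤₚ.<? weight S

    negative? : Dec (weight S ℤ.< + 0)
    negative? = weight S ℤₚ.<? + 0

    singleWhite singleBlack : ℤ
    singleWhite = ∑ (allFin s) (λ i → indicator (S ≟ˢ single (index (inj₁ i))))
    singleBlack = ∑ (allFin t) (λ j → indicator (S ≟ˢ single (index (inj₂ j))))

    -- The weight of `S` is x - y, where x or y is 0, so its sign tells which deficit is positive.
    -- Thus at which end the marked trees on `S` are planted depends on `S` alone.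
    edge-signs : ∀ i j W (M : IsEdge S (i , j , W)) → (1 ≤ gap (inj₁ i) W → + 0 ℤ.< weight S) × (¬ 1 ≤ gap (inj₁ i) W → ¬ + 0 ℤ.< weight S)
      × (1 ≤ gap (inj₂ j) W → weight S ℤ.< + 0) × (¬ 1 ≤ gap (inj₂ j) W → ¬ weight S ℤ.< + 0)
    edge-signs i j W M@(T , e , x , y , zero? , h) rewrite gap-marked {S} {inj₁ i} {inj₂ j} {W} M
      | gap-marked {S} {inj₂ j} {inj₁ i} {W} (Marked-sym {S} {inj₁ i} {inj₂ j} {W} M) | weight-edge S i j W M = signs x y zero?
      where
      signs : ∀ x y → x ≡ 0 ⊎ y ≡ 0 → (1 ≤ x → + 0 ℤ.< + x ℤ.- + y) × (¬ 1 ≤ x → ¬ + 0 ℤ.< + x ℤ.- + y)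
        × (1 ≤ y → + x ℤ.- + y ℤ.< + 0) × (¬ 1 ≤ y → ¬ + x ℤ.- + y ℤ.< + 0)
      signs zero zero _ = (λ ()) , (λ { _ (ℤ.+<+ ()) }) , (λ ()) , (λ { _ (ℤ.+<+ ()) })
      signs zero (suc y) _ = (λ ()) , (λ { _ () }) , (λ _ → ℤ.-<+) , (λ n _ → n (s≤s z≤n))
      signs (suc x) zero _ = (λ _ → ℤ.+<+ (s≤s z≤n)) , (λ n _ → n (s≤s z≤n)) , (λ ()) , (λ { _ (ℤ.+<+ ()) })
      signs (suc x) (suc y) (inj₁ ())
      signs (suc x) (suc y) (inj₂ ())

    coef-f⁺ : coef f⁺ S ≡ singleWhite ℤ.+ pick positive? (q S) (+ 0)
    coef-f⁺ = trans (coef-tab _ S) (trans (∑-white (proj₂ (proj₁ (plantings S)))) (cong (λ z → singleWhite ℤ.+ z)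
      (trans (∑-filter openWhite? _ (λ (i , j , W) → pick positive? (+ ω W) (+ 0)) (edgeList S)
        (λ (i , j , W) z∈ o → sym (pick-yes positive? (proj₁ (edge-signs i j W (∈⇒P (enum-edgeList S) z∈)) o)))
        (λ (i , j , W) z∈ ¬o → pick-no positive? (proj₁ (proj₂ (edge-signs i j W (∈⇒P (enum-edgeList S) z∈))) ¬o)))
        (∑-pick positive? (edgeList S) (λ (i , j , W) → + ω W)))))

    coef-f⁻ : coef f⁻ S ≡ singleBlack ℤ.+ pick negative? (q S) (+ 0)
    coef-f⁻ = trans (coef-tab _ S) (trans (∑-black (proj₂ (proj₂ (plantings S)))) (cong (λ z → singleBlack ℤ.+ z)
      (trans (∑-filter openBlack? _ (λ (j , i , W) → pick negative? (+ ω W) (+ 0)) (map flip (edgeList S))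
        (λ (j , i , W) z∈ o → sym (pick-yes negative? (proj₁ (proj₂ (proj₂ (edge-signs i j W (unflip j i W z∈)))) o)))
        (λ (j , i , W) z∈ ¬o → pick-no negative? (proj₂ (proj₂ (proj₂ (edge-signs i j W (unflip j i W z∈)))) ¬o)))
        (trans (∑-map flip (edgeList S) (λ (j , i , W) → pick negative? (+ ω W) (+ 0))) (∑-pick negative? (edgeList S) (λ (i , j , W) → + ω W))))))
      where
      unflip : ∀ j i W → (j , i , W) ∈ map flip (edgeList S) → IsEdge S (i , j , W)
      unflip j i W z∈ = Marked-sym {S} {inj₂ j} {inj₁ i} {W} (∈⇒P (enum-flip S (enum-edgeList S)) z∈)

    indicator-no : {A : Set} (d : Dec A) → ¬ A → indicator d ≡ + 0
    indicator-no d = pick-no d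

    positive-coef : coef f⁺ S ≡ + 0 ⊎ + 0 ℤ.< weight S
    positive-coef = go positive?
      where
      go : Dec (+ 0 ℤ.< weight S) → coef f⁺ S ≡ + 0 ⊎ + 0 ℤ.< weight S
      go (yes p) = inj₂ p
      go (no ¬p) = inj₁ (trans coef-f⁺ (trans (cong₂ ℤ._+_
        (trans (∑-cong (allFin s) (λ i → indicator-no (S ≟ˢ single (index (inj₁ i))) (λ e → ¬p (weight-white S i noEdges (lonelyWhite i e))))) (∑-zero (allFin s)))
        (pick-no positive? ¬p)) refl))

    negative-coef : coef f⁻ S ≡ + 0 ⊎ weight S ℤ.< + 0
    negative-coef = go negative?
      where
      go : Dec (weight S ℤ.< + 0) → coef f⁻ S ≡ + 0 ⊎ weight S ℤ.< + 0
      go (yes p) = inj₂ p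
      go (no ¬p) = inj₁ (trans coef-f⁻ (trans (cong₂ ℤ._+_
        (trans (∑-cong (allFin t) (λ j → indicator-no (S ≟ˢ single (index (inj₂ j))) (λ e → ¬p (weight-black S j noEdges (lonelyBlack j e))))) (∑-zero (allFin t)))
        (pick-no negative? ¬p)) refl))

    trichotomy : pick positive? (q S) (+ 0) ℤ.+ pick negative? (q S) (+ 0) ℤ.+ pick (weight S ℤ.≟ + 0) (q S) (+ 0) ≡ q S
    trichotomy = go (ℤₚ.<-cmp (weight S) (+ 0))
      where
      go : Tri (weight S ℤ.< + 0) (weight S ≡ + 0) (+ 0 ℤ.< weight S) →
        pick positive? (q S) (+ 0) ℤ.+ pick negative? (q S) (+ 0) ℤ.+ pick (weight S ℤ.≟ + 0) (q S) (+ 0) ≡ q S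
      go (tri< n z p) = trans (cong₂ ℤ._+_ (cong₂ ℤ._+_ (pick-no positive? p) (pick-yes negative? n)) (pick-no (weight S ℤ.≟ + 0) z))
        (trans (ℤₚ.+-identityʳ _) (ℤₚ.+-identityˡ (q S)))
      go (tri≈ n z p) = trans (cong₂ ℤ._+_ (cong₂ ℤ._+_ (pick-no positive? p) (pick-no negative? n)) (pick-yes (weight S ℤ.≟ + 0) z)) (ℤₚ.+-identityˡ (q S))
      go (tri> n z p) = trans (cong₂ ℤ._+_ (cong₂ ℤ._+_ (pick-yes positive? p) (pick-no negative? n)) (pick-no (weight S ℤ.≟ + 0) z))
        (trans (ℤₚ.+-identityʳ _) (ℤₚ.+-identityʳ (q S)))

    -- According to the sign of the weight of `S`, all of `q S` goes into one of the three summands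
    -- on the left; the single vertices add up to `εΣ`.
    coef-factorisation : coef (f⁺ ⊕ f⁻ ⊕ π (+ 0) ws (f⁺ ⊛ f⁻)) S ≡ coef (εΣ (s + t) ⊕ f⁺ ⊛ f⁻) S
    coef-factorisation = begin
      coef (f⁺ ⊕ f⁻ ⊕ π (+ 0) ws (f⁺ ⊛ f⁻)) S
        ≡⟨ trans (coef-⊕ (f⁺ ⊕ f⁻) _ S) (cong₂ ℤ._+_ (trans (coef-⊕ f⁺ f⁻ S) (cong₂ ℤ._+_ coef-f⁺ coef-f⁻))
             (trans (coef-π (+ 0) ws (f⁺ ⊛ f⁻) S) (cong (λ z → pick (weight S ℤ.≟ + 0) z (+ 0)) (coef-f⁺⊛f⁻ S)))) ⟩
      singleWhite ℤ.+ a ℤ.+ (singleBlack ℤ.+ b) ℤ.+ c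
        ≡⟨ regroup singleWhite singleBlack a b c ⟩
      singleWhite ℤ.+ singleBlack ℤ.+ (a ℤ.+ b ℤ.+ c)
        ≡⟨ cong₂ ℤ._+_ (sym (trans (coef-εΣ (s + t) S) (∑-allFin-+ s (λ x → indicator (S ≟ˢ single x))))) (trans trichotomy (sym (coef-f⁺⊛f⁻ S))) ⟩
      coef (εΣ (s + t)) S ℤ.+ coef (f⁺ ⊛ f⁻) S
        ≡⟨ coef-⊕ (εΣ (s + t)) (f⁺ ⊛ f⁻) S ⟨
      coef (εΣ (s + t) ⊕ f⁺ ⊛ f⁻) S ∎
      where
      open ≡-Reasoning
      a = pick positive? (q S) (+ 0)
      b = pick negative? (q S) (+ 0)
      c = pick (weight S ℤ.≟ + 0) (q S) (+ 0)
      regroup : ∀ x y a b c → x ℤ.+ a ℤ.+ (y ℤ.+ b) ℤ.+ c ≡ x ℤ.+ y ℤ.+ (a ℤ.+ b ℤ.+ c)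
      regroup = ℤ-solve-∀

  factorisation : f⁺ ⊕ f⁻ ⊕ π (+ 0) ws (f⁺ ⊛ f⁻) ≡ εΣ (s + t) ⊕ f⁺ ⊛ f⁻
  factorisation = coef-ext _ _ coef-factorisation

  f⁺>0 : Supp (λ z → + 0 ℤ.< z) ws f⁺
  f⁺>0 = Supp-mono ws f⁺ (λ x → subst (+ 0 ℤ.<_) (ℤₚ.+-identityˡ x)) (Supp-coef {P = λ z → + 0 ℤ.< z} (+ 0) ws f⁺ positive-coef)

  f⁻<0 : Supp (λ z → z ℤ.< + 0) ws f⁻
  f⁻<0 = Supp-mono ws f⁻ (λ x → subst (ℤ._< + 0) (ℤₚ.+-identityˡ x)) (Supp-coef {P = λ z → z ℤ.< + 0} (+ 0) ws f⁻ negative-coef)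

  edges-noEdges : edges {s} {t} noEdges ≡ 0
  edges-noEdges = Σᶠ-zero {s} (λ i → mg-zero (support {s} {t} noEdges) (inj₁ i) (λ u a → Adj-noEdges (inj₁ i) u (Adj-support⁻ noEdges (inj₁ i) u a)))

  -- Cutting at an edge removes one edge and leaves two trees on smaller sets; `n` bounds the size
  -- for the induction.
  edge-count : ∀ n (S : Sub s t) (W : Mat s t) (r : Vertex s t) → size S ≤ n → TreeOn S W → r ∈ₛ S → edges W + 1 ≡ size S
  edge-count zero S W r le T r∈ = ⊥-elim (ℕₚ.<⇒≱ (size-≥1 S r r∈) le)
  edge-count (suc n) S W r le T r∈ with 0 <? deg W r
  ... | no isolated = trans (cong (ℕ._+ 1) (trans (cong edges (proj₂ lonely)) edges-noEdges)) (sym (trans (cong size (proj₁ lonely)) (size-single (index r))))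
    where
    lonely : S ≡ single (index r) × W ≡ noEdges
    lonely = isolated⇒single T r r∈ (λ u a → isolated (Adj⇒deg W r u a))
  edge-count (suc n) S W r le T r∈ | yes pos = go r (proj₁ (deg⇒Adj W r pos)) (proj₂ (deg⇒Adj W r pos))
    where
    cutAt : ∀ i j → 0 < ent W i j → edges W + 1 ≡ size S
    cutAt i j e = begin
      edges W + 1                             ≡⟨ cong (ℕ._+ 1) (edges-joined {W = W} splits T₁ T₂ i j (ent W i j) i∈ j∈ e joined) ⟩
      edges W₁ + edges W₂ + 1 + 1         ≡⟨ regroup (edges W₁) (edges W₂) ⟩
      (edges W₁ + 1) + (edges W₂ + 1)     ≡⟨ cong₂ ℕ._+_
        (edge-count n S₁ W₁ (inj₁ i) (smaller (ℕₚ.m<m+n (size S₁) (size-≥1 S₂ (inj₂ j) j∈))) T₁ i∈)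
        (edge-count n S₂ W₂ (inj₂ j) (smaller (ℕₚ.m<n+m (size S₂) (size-≥1 S₁ (inj₁ i) i∈))) T₂ j∈) ⟩
      size S₁ + size S₂                       ≡⟨ size-split (splits⇒split {S = S} splits) ⟨
      size S                                    ∎
      where
      open ≡-Reasoning
      S₁ = leftPart T i j e
      S₂ = rightPart T i j e
      W₁ = restrict W S₁
      W₂ = restrict W S₂
      T₁ = left-tree T i j e
      T₂ = right-tree T i j e
      i∈ = i∈left T i j e
      j∈ = j∈right T i j e
      splits : Splits {s} {t} S S₁ S₂
      splits = splits-cut T i j e
      joined = restrict-joined T i j e splits i∈ j∈ (left-closed T i j e)
      smaller : ∀ {m} → m < size S₁ + size S₂ → m ≤ n
      smaller lt = s≤s⁻¹ (ℕₚ.≤-trans lt (subst (_≤ suc n) (size-split (splits⇒split {S = S} splits)) le))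
      regroup : ∀ a b → a + b + 1 + 1 ≡ (a + 1) + (b + 1)
      regroup = ℕ-solve-∀
    go : ∀ u v → Adj W u v → edges W + 1 ≡ size S
    go (inj₁ i) (inj₂ j) e = cutAt i j e
    go (inj₂ j) (inj₁ i) e = cutAt i j e

  IsTreeOf : Sub s t → Mat s t → Set
  IsTreeOf S W = TreeOn S W × (∀ v → mg W v ≡ wS S v)

  module _ (S : Sub s t) (w≡0 : weight S ≡ + 0) (r : Vertex s t) (r∈ : _∈ₛ_ {s} {t} r S) where

    -- On a balanced set the two deficits are equal, and one of them is 0.
    edge⇒tree : ∀ i j W → IsEdge S (i , j , W) → IsTreeOf S W
    edge⇒tree i j W M@(T , e , x , y , zero? , h) = T , λ v → trans (sym (trans (cong₂ (λ a b → mg W v + (a + b))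
        (pt-zero (inj₁ i) x v (proj₁ both)) (pt-zero (inj₂ j) y v (proj₂ both))) (ℕₚ.+-identityʳ _))) (h v)
      where
      bothZero : ∀ x y → x ≡ 0 ⊎ y ≡ 0 → + x ≡ + y → x ≡ 0 × y ≡ 0
      bothZero x y (inj₁ refl) refl = refl , refl
      bothZero x y (inj₂ refl) refl = refl , refl
      both = bothZero x y zero? (ℤₚ.i-j≡0⇒i≡j (+ x) (+ y) (trans (sym (weight-edge S i j W M)) w≡0))
      pt-zero : ∀ r x v → x ≡ 0 → pt r x v ≡ 0
      pt-zero r x v refl = pt-0 r v

    tree⇒edge : ∀ i j W → IsTreeOf S W → 0 < ent W i j → IsEdge S (i , j , W)
    tree⇒edge i j W (T , h) e = T , e , 0 , 0 , inj₁ refl , λ v →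
        trans (cong₂ (λ a b → mg W v + (a + b)) (pt-0 (inj₁ i) v) (pt-0 (inj₂ j) v)) (trans (ℕₚ.+-identityʳ _) (h v))

    enum-trees : ∃ (Enumerates (IsTreeOf S))
    enum-trees = enum-image _≟ᴹ_ (λ (i , j , W) → W) (λ (i , j , W) → edge⇒tree i j W) hasEdge (enum-edgeList S)
      where
      hasEdge : ∀ W → IsTreeOf S W → ∃[ z ] IsEdge S z × proj₂ (proj₂ z) ≡ W
      hasEdge W tree@(T , h) = go r (proj₁ edge) (proj₂ edge)
        where
        edge = mg-positive⁻ W r (subst (1 ≤_) (sym (trans (h r) (wS-in {S} r r∈))) (wt≥1 r))
        go : ∀ u v → Adj W u v → ∃[ z ] IsEdge S z × proj₂ (proj₂ z) ≡ W
        go (inj₁ i) (inj₂ j) e = (i , j , W) , tree⇒edge i j W tree e , refl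
        go (inj₂ j) (inj₁ i) e = (i , j , W) , tree⇒edge i j W tree e , refl

    -- Double counting of pairs of a tree and one of its edges.
    ∑-trees : ∀ {ts} → Enumerates (IsTreeOf S) ts → + (size S ∸ 1) ℤ.* ∑ ts (λ W → + ω W) ≡ q S
    ∑-trees {ts} enum-ts = begin
      + (size S ∸ 1) ℤ.* ∑ ts (λ W → + ω W)
        ≡⟨ ∑-*ˡ (+ (size S ∸ 1)) ts (λ W → + ω W) ⟨
      ∑ ts (λ W → + (size S ∸ 1) ℤ.* + ω W)
        ≡⟨ ∑-cong-∈ ts (λ W W∈ → cong (ℤ._* + ω W) (trans (cong +_ (edgeCount W (∈⇒P enum-ts W∈))) (edges-∑ W))) ⟩
      ∑ ts (λ W → ∑ (allFin s) (λ i → ∑ (allFin t) (λ j → indicator (Adj? W (inj₁ i) (inj₂ j)))) ℤ.* + ω W)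
        ≡⟨ ∑-cong ts (λ W → trans (sym (∑-*ʳ (+ ω W) (allFin s) _)) (trans
             (∑-cong (allFin s) (λ i → sym (∑-filter-const (λ j → Adj? W (inj₁ i) (inj₂ j)) (allFin t) (+ ω W))))
             (sym (∑-pairs (allFin s) (nbrs W) (λ _ → + ω W))))) ⟩
      ∑ ts (λ W → ∑ (pairs (allFin s) (nbrs W)) (λ _ → + ω W))
        ≡⟨ ∑-pairs ts (λ W → pairs (allFin s) (nbrs W)) (λ (W , _) → + ω W) ⟨
      ∑ (pairs ts (λ W → pairs (allFin s) (nbrs W))) (λ (W , _) → + ω W)
        ≡⟨ ∑-bijection enum-marked (enum-edgeList S) (λ (W , i , j) → i , j , W) (λ { (W , i , j) (tree , _ , _ , e) → tree⇒edge i j W tree e })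
             (λ { _ _ _ _ refl → refl }) (λ { (i , j , W) M → (W , i , j) , (edge⇒tree i j W M , tt , tt , proj₁ (proj₂ M)) , refl }) (λ _ _ → refl) ⟩
      q S ∎
      where
      open ≡-Reasoning
      nbrs : Mat s t → Fin s → List (Fin t)
      nbrs W i = filter (λ j → Adj? W (inj₁ i) (inj₂ j)) (allFin t)
      enum-marked : Enumerates (λ (W , i , j) → IsTreeOf S W × ⊤ × ⊤ × 0 < ent W i j) (pairs ts (λ W → pairs (allFin s) (nbrs W)))
      enum-marked = enum-pairs _ enum-ts (λ W _ → enum-pairs (nbrs W) (enum-allFin s) (λ i _ → enum-filter (λ j → Adj? W (inj₁ i) (inj₂ j)) (enum-allFin t)))
      edgeCount : ∀ W → IsTreeOf S W → size S ∸ 1 ≡ edges W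
      edgeCount W (T , _) = trans (cong (_∸ 1) (sym (edge-count (size S) S W r ℕₚ.≤-refl T r∈))) (ℕₚ.m+n∸n≡m (edges W) 1)
      edges-∑ : ∀ W → + edges W ≡ ∑ (allFin s) (λ i → ∑ (allFin t) (λ j → indicator (Adj? W (inj₁ i) (inj₂ j))))
      edges-∑ W = trans (sym (∑-ℕ s (λ i → deg W (inj₁ i)))) (∑-cong (allFin s) (λ i → deg-white W i))

-- Cyclic orders

length-pairs : {A B : Set} (xs : List A) (ys : List B) → length (pairs xs (λ _ → ys)) ≡ length xs * length ys
length-pairs [] ys = refl
length-pairs (x ∷ xs) ys = trans (Listₚ.length-++ (map (x ,_) ys)) (cong₂ ℕ._+_ (Listₚ.length-map (x ,_) ys) (length-pairs xs ys))

length-vecs : ∀ {A : Set} {n} (xs : Fin n → List A) → length (vecs xs) ≡ Πᶠ (length ∘ xs)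
length-vecs {n = zero} xs = refl
length-vecs {n = suc n} xs = trans (Listₚ.length-map _ (pairs (xs zero) (λ _ → vecs (xs ∘ suc))))
  (trans (length-pairs (xs zero) (vecs (xs ∘ suc))) (trans (cong (length (xs zero) ℕ.*_) (length-vecs (xs ∘ suc))) (sym (Πᶠ-suc (length ∘ xs)))))

vec-ext : ∀ {A : Set} {n} (u v : Vec A n) → (∀ x → lookup u x ≡ lookup v x) → u ≡ v
vec-ext u v h = trans (sym (Vecₚ.tabulate∘lookup u)) (trans (Vecₚ.tabulate-cong h) (Vecₚ.tabulate∘lookup v))

cyclic-⇔ : ∀ {m} {N M : Fin m → Set} {σ : Fin m → Fin m} → (∀ x → N x → M x) → (∀ x → M x → N x) → IsCyclicOn N σ → IsCyclicOn M σ
cyclic-⇔ f g (fix , closed , inj , trans′) = (λ x ¬m → fix x (¬m ∘ f x)) , (λ x m → f _ (closed x (g x m))) ,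
  (λ x y p q → inj x y (g x p) (g y q)) , (λ x y p q → trans′ x y (g x p) (g y q))

module _ {m : ℕ} where

  Reach : (Fin m → Fin m) → Fin m → Fin m → Set
  Reach σ x y = ∃[ n ] iter σ n x ≡ y

  reach-trans : ∀ σ {x y z} → Reach σ x y → Reach σ y z → Reach σ x z
  reach-trans σ {x} (n , refl) (zero , refl) = n , refl
  reach-trans σ {x} (n , refl) (suc k , refl) = let (j , e) = reach-trans σ (n , refl) (k , refl) in suc j , cong σ e

  reach-step : ∀ σ {x y} → σ x ≡ y → Reach σ x y
  reach-step σ e = 1 , e

  iter-fixed : ∀ σ {a : Fin m} → σ a ≡ a → ∀ n → iter σ n a ≡ a
  iter-fixed σ e zero = refl
  iter-fixed σ e (suc n) = trans (cong σ (iter-fixed σ e n)) e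

  iter-closed : ∀ {N : Fin m → Set} σ → (∀ x → N x → N (σ x)) → ∀ n {x} → N x → N (iter σ n x)
  iter-closed σ closed zero p = p
  iter-closed σ closed (suc n) p = closed _ (iter-closed σ closed n p)

  Cyclic : List (Fin m) → Vec (Fin m) m → Set
  Cyclic xs v = IsCyclicOn (_∈ xs) (lookup v)

  override : Fin m → Fin m → Fin m → Fin m → (Fin m → Fin m) → Fin m → Fin m
  override a a' y y' σ x with x Fin.≟ a | x Fin.≟ y
  ... | yes _ | _     = a'
  ... | no _  | yes _ = y'
  ... | no _  | no _  = σ x

  override-1 : ∀ a a' y y' σ → override a a' y y' σ a ≡ a'
  override-1 a a' y y' σ with a Fin.≟ a
  ... | yes _ = refl
  ... | no h = ⊥-elim (h refl)

  override-2 : ∀ a a' y y' σ → y ≢ a → override a a' y y' σ y ≡ y'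
  override-2 a a' y y' σ ne with y Fin.≟ a | y Fin.≟ y
  ... | yes e | _ = ⊥-elim (ne e)
  ... | no _ | yes _ = refl
  ... | no _ | no h = ⊥-elim (h refl)

  override-3 : ∀ a a' y y' σ x → x ≢ a → x ≢ y → override a a' y y' σ x ≡ σ x
  override-3 a a' y y' σ x ne ne' with x Fin.≟ a | x Fin.≟ y
  ... | yes e | _ = ⊥-elim (ne e)
  ... | no _ | yes e = ⊥-elim (ne' e)
  ... | no _ | no _ = refl

  -- Puts `a` into the cycle between `y` and its successor.
  insert : Fin m → Fin m → Vec (Fin m) m → Vec (Fin m) m
  insert a y v = Vec.tabulate (override a (lookup v y) y a (lookup v))

  module _ {a : Fin m} {zs : List (Fin m)} (a∉ : a ∉ zs) where

    ≢a : ∀ {x} → x ∈ zs → x ≢ a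
    ≢a x∈ refl = a∉ x∈

    module Insertion {y} (y∈ : y ∈ zs) (v : Vec (Fin m) m) where

      τ : Fin m → Fin m
      τ = lookup (insert a y v)

      τ-a : τ a ≡ lookup v y
      τ-a = trans (Vecₚ.lookup∘tabulate _ a) (override-1 a _ y a _)

      τ-y : τ y ≡ a
      τ-y = trans (Vecₚ.lookup∘tabulate _ y) (override-2 a _ y a _ (≢a y∈))

      τ-other : ∀ x → x ≢ a → x ≢ y → τ x ≡ lookup v x
      τ-other x p q = trans (Vecₚ.lookup∘tabulate _ x) (override-3 a _ y a _ x p q)

    insert-cyclic : ∀ {y} v → y ∈ zs → Cyclic zs v → Cyclic (a ∷ zs) (insert a y v)
    insert-cyclic {y} v y∈ (fix , closed , inj , transitive) = fix′ , closed′ , inj′ , transitive′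
      where
      open Insertion y∈ v
      fix′ : ∀ x → ¬ x ∈ a ∷ zs → τ x ≡ x
      fix′ x x∉ = trans (τ-other x (x∉ ∘ here) (λ { refl → x∉ (there y∈) })) (fix x (x∉ ∘ there))
      closed′ : ∀ x → x ∈ a ∷ zs → τ x ∈ a ∷ zs
      closed′ x (here refl) = there (subst (_∈ zs) (sym τ-a) (closed y y∈))
      closed′ x (there x∈) with x Fin.≟ y
      ... | yes refl = here τ-y
      ... | no ne = there (subst (_∈ zs) (sym (τ-other x (≢a x∈) ne)) (closed x x∈))
      avoids : ∀ {x} → x ∈ zs → x ≢ y → τ a ≢ τ x
      avoids {x} x∈ ne e = ne (sym (inj y x y∈ x∈ (trans (sym τ-a) (trans e (τ-other x (≢a x∈) ne)))))
      avoids-y : τ a ≢ τ y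
      avoids-y e = a∉ (subst (_∈ zs) (trans (sym τ-a) (trans e τ-y)) (closed y y∈))
      τy≢τx : ∀ {x} → x ∈ zs → x ≢ y → τ y ≢ τ x
      τy≢τx {x} x∈ ne e = a∉ (subst (_∈ zs) (trans (sym (τ-other x (≢a x∈) ne)) (trans (sym e) τ-y)) (closed x x∈))
      inj′ : ∀ x x' → x ∈ a ∷ zs → x' ∈ a ∷ zs → τ x ≡ τ x' → x ≡ x'
      inj′ x x' (here refl) (here refl) e = refl
      inj′ x x' (here refl) (there x'∈) e with x' Fin.≟ y
      ... | yes refl = ⊥-elim (avoids-y e)
      ... | no ne = ⊥-elim (avoids x'∈ ne e)
      inj′ x x' (there x∈) (here refl) e with x Fin.≟ y
      ... | yes refl = ⊥-elim (avoids-y (sym e))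
      ... | no ne = ⊥-elim (avoids x∈ ne (sym e))
      inj′ x x' (there x∈) (there x'∈) e with x Fin.≟ y | x' Fin.≟ y
      ... | yes refl | yes refl = refl
      ... | yes refl | no ne = ⊥-elim (τy≢τx x'∈ ne e)
      ... | no ne | yes refl = ⊥-elim (τy≢τx x∈ ne (sym e))
      ... | no ne | no ne' = inj x x' x∈ x'∈ (trans (sym (τ-other x (≢a x∈) ne)) (trans e (τ-other x' (≢a x'∈) ne')))
      follow : ∀ {x} → x ∈ zs → Reach τ x (lookup v x)
      follow {x} x∈ with x Fin.≟ y
      -- The arrow from `y` to its old successor has become a detour over `a`.
      ... | yes refl = 2 , trans (cong τ τ-y) τ-a
      ... | no ne = reach-step τ (τ-other x (≢a x∈) ne)
      simulate : ∀ n {x} → x ∈ zs → Reach τ x (iter (lookup v) n x)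
      simulate zero x∈ = 0 , refl
      simulate (suc n) x∈ = reach-trans τ (simulate n x∈) (follow (iter-closed (lookup v) closed n x∈))
      inside : ∀ {x z} → x ∈ zs → z ∈ zs → Reach τ x z
      inside {x} {z} x∈ z∈ = let (n , e) = transitive x z x∈ z∈ in subst (Reach τ x) e (simulate n x∈)
      transitive′ : ∀ x z → x ∈ a ∷ zs → z ∈ a ∷ zs → Reach τ x z
      transitive′ x z (here refl) (here refl) = 0 , refl
      transitive′ x z (here refl) (there z∈) = reach-trans τ (reach-step τ τ-a) (inside (closed y y∈) z∈)
      transitive′ x z (there x∈) (here refl) = reach-trans τ (inside x∈ y∈) (reach-step τ τ-y)
      transitive′ x z (there x∈) (there z∈) = inside x∈ z∈

    insert-injective : ∀ y y' v v' → y ∈ zs → y' ∈ zs → Cyclic zs v → Cyclic zs v' → insert a y v ≡ insert a y' v' → (y , v) ≡ (y' , v')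
    insert-injective y y' v v' y∈ y'∈ (fix , closed , _) (fix' , closed' , _) e = go y≡y'
      where
      module I = Insertion y∈ v
      module I' = Insertion y'∈ v'
      at : ∀ x → I.τ x ≡ I'.τ x
      at x = cong (λ u → lookup u x) e
      y≡y' : y ≡ y'
      y≡y' with y Fin.≟ y'
      ... | yes p = p
      ... | no ne = ⊥-elim (a∉ (subst (_∈ zs) (trans (sym (I'.τ-other y (≢a y∈) ne)) (trans (sym (at y)) I.τ-y)) (closed' y y∈)))
      go : y ≡ y' → (y , v) ≡ (y' , v')
      go refl = cong (y ,_) (vec-ext v v' same)
        where
        same : ∀ x → lookup v x ≡ lookup v' x
        same x with x Fin.≟ a | x Fin.≟ y
        ... | yes refl | _ = trans (fix a a∉) (sym (fix' a a∉))
        ... | no _ | yes refl = trans (sym I.τ-a) (trans (at a) I'.τ-a)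
        ... | no p | no q = trans (sym (I.τ-other x p q)) (trans (at x) (I'.τ-other x p q))

    -- Delete `a` from the cycle by sending its predecessor `y` to its successor. The predecessor
    -- appears on the orbit from `b` to `a`, and `b` also prevents `a` from being fixed.
    insert-surjective : ∀ {b} → b ∈ zs → ∀ w → Cyclic (a ∷ zs) w → ∃[ z ] (proj₁ z ∈ zs × Cyclic zs (proj₂ z)) × insert a (proj₁ z) (proj₂ z) ≡ w
    insert-surjective {b} b∈ w (fix , closed , inj , transitive) = (y , v) , (y∈ , fix′ , closed′ , inj′ , transitive′) , vec-ext _ w rebuilt
      where
      σ : Fin m → Fin m
      σ = lookup w
      σa≢a : σ a ≢ a
      σa≢a e = let (n , e') = transitive a b (here refl) (there b∈) in ≢a b∈ (trans (sym e') (iter-fixed σ e n))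
      predecessor : ∃[ y ] y ∈ a ∷ zs × σ y ≡ a
      predecessor with transitive b a (there b∈) (here refl)
      ... | zero , e = ⊥-elim (≢a b∈ e)
      ... | suc n , e = iter σ n b , iter-closed σ closed n (there b∈) , e
      y = proj₁ predecessor
      σy : σ y ≡ a
      σy = proj₂ (proj₂ predecessor)
      y≢a : y ≢ a
      y≢a e = σa≢a (trans (cong σ (sym e)) σy)
      drop : ∀ {x} → x ∈ a ∷ zs → x ≢ a → x ∈ zs
      drop (here e) ne = ⊥-elim (ne e)
      drop (there p) _ = p
      y∈ : y ∈ zs
      y∈ = drop (proj₁ (proj₂ predecessor)) y≢a
      v : Vec (Fin m) m
      v = Vec.tabulate (override a a y (σ a) σ)
      v-a : lookup v a ≡ a
      v-a = trans (Vecₚ.lookup∘tabulate _ a) (override-1 a a y (σ a) σ)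
      v-y : lookup v y ≡ σ a
      v-y = trans (Vecₚ.lookup∘tabulate _ y) (override-2 a a y (σ a) σ y≢a)
      v-other : ∀ x → x ≢ a → x ≢ y → lookup v x ≡ σ x
      v-other x p q = trans (Vecₚ.lookup∘tabulate _ x) (override-3 a a y (σ a) σ x p q)
      σx≢a : ∀ x → x ∈ a ∷ zs → x ≢ y → σ x ≢ a
      σx≢a x x∈ ne e = ne (inj x y x∈ (there y∈) (trans e (sym σy)))
      fix′ : ∀ x → ¬ x ∈ zs → lookup v x ≡ x
      fix′ x x∉ with x Fin.≟ a
      ... | yes refl = v-a
      ... | no ne = trans (v-other x ne (λ { refl → x∉ y∈ })) (fix x (λ p → x∉ (drop p ne)))
      closed′ : ∀ x → x ∈ zs → lookup v x ∈ zs
      closed′ x x∈ with x Fin.≟ y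
      ... | yes refl = subst (_∈ zs) (sym v-y) (drop (closed a (here refl)) σa≢a)
      ... | no ne = subst (_∈ zs) (sym (v-other x (≢a x∈) ne)) (drop (closed x (there x∈)) (σx≢a x (there x∈) ne))
      inj′ : ∀ x x' → x ∈ zs → x' ∈ zs → lookup v x ≡ lookup v x' → x ≡ x'
      inj′ x x' x∈ x'∈ e with x Fin.≟ y | x' Fin.≟ y
      ... | yes p | yes q = trans p (sym q)
      ... | yes refl | no q = ⊥-elim (≢a x'∈ (sym (inj a x' (here refl) (there x'∈) (trans (sym v-y) (trans e (v-other x' (≢a x'∈) q))))))
      ... | no p | yes refl = ⊥-elim (≢a x∈ (inj x a (there x∈) (here refl) (trans (sym (v-other x (≢a x∈) p)) (trans e v-y))))
      ... | no p | no q = inj x x' (there x∈) (there x'∈) (trans (sym (v-other x (≢a x∈) p)) (trans e (v-other x' (≢a x'∈) q)))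
      -- Skips the visits of an orbit to a.
      bypass : Fin m → Fin m
      bypass x with x Fin.≟ a
      ... | yes _ = y
      ... | no _ = x
      bypass-a : bypass a ≡ y
      bypass-a with a Fin.≟ a
      ... | yes _ = refl
      ... | no h = ⊥-elim (h refl)
      bypass-other : ∀ x → x ≢ a → bypass x ≡ x
      bypass-other x ne with x Fin.≟ a
      ... | yes e = ⊥-elim (ne e)
      ... | no _ = refl
      follow : ∀ x → x ∈ a ∷ zs → Reach (lookup v) (bypass x) (bypass (σ x))
      follow x x∈ = go (x Fin.≟ a) (x Fin.≟ y)
        where
        go : Dec (x ≡ a) → Dec (x ≡ y) → Reach (lookup v) (bypass x) (bypass (σ x))
        go (yes refl) _ = 1 , trans (cong (lookup v) bypass-a) (trans v-y (sym (bypass-other (σ a) σa≢a)))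
        -- The arrow from `y` to `a` shrinks to a point, because `bypass` identifies the two.
        go (no p) (yes refl) = 0 , trans (bypass-other y p) (sym (trans (cong bypass σy) bypass-a))
        go (no p) (no q) = 1 , trans (cong (lookup v) (bypass-other x p)) (trans (v-other x p q) (sym (bypass-other (σ x) (σx≢a x x∈ q))))
      simulate : ∀ n {x} → x ∈ zs → Reach (lookup v) x (bypass (iter σ n x))
      simulate zero {x} x∈ = 0 , sym (bypass-other x (≢a x∈))
      simulate (suc n) x∈ = reach-trans (lookup v) (simulate n x∈) (follow _ (iter-closed σ closed n (there x∈)))
      transitive′ : ∀ x z → x ∈ zs → z ∈ zs → Reach (lookup v) x z
      transitive′ x z x∈ z∈ = let (n , e) = transitive x z (there x∈) (there z∈) in
        subst (Reach (lookup v) x) (trans (cong bypass e) (bypass-other z (≢a z∈))) (simulate n x∈)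
      open Insertion y∈ v
      rebuilt : ∀ x → τ x ≡ σ x
      rebuilt x = go (x Fin.≟ a) (x Fin.≟ y)
        where
        go : Dec (x ≡ a) → Dec (x ≡ y) → τ x ≡ σ x
        go (yes refl) _ = trans τ-a v-y
        go (no _) (yes refl) = trans τ-y (sym σy)
        go (no p) (no q) = trans (τ-other x p q) (v-other x p q)

  identity : Vec (Fin m) m
  identity = Vec.tabulate id

  enum-identity : ∀ xs → (∀ x → x ∈ xs → ∀ z → z ∈ xs → x ≡ z) → Enumerates (Cyclic xs) (identity ∷ [])
  enum-identity xs small = enum-singleton
    ((λ x _ → Vecₚ.lookup∘tabulate id x) , (λ x x∈ → subst (_∈ xs) (sym (Vecₚ.lookup∘tabulate id x)) x∈) ,
     (λ x y p q _ → small x p y q) , λ x y p q → 0 , small x p y q)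
    (λ v (fix , closed , _) → vec-ext v identity (λ x → trans (fixed v fix closed x) (sym (Vecₚ.lookup∘tabulate id x))))
    where
    fixed : ∀ v → (∀ x → ¬ x ∈ xs → lookup v x ≡ x) → (∀ x → x ∈ xs → lookup v x ∈ xs) → ∀ x → lookup v x ≡ x
    fixed v fix closed x with _∈?_ Fin._≟_ x xs
    ... | yes x∈ = small _ (closed x x∈) x x∈
    ... | no x∉ = fix x x∉

  -- A new member can be inserted behind each of the others, which gives the next factor of the
  -- factorial. For the empty list truncated subtraction gives 0! = 1, as it does in `ω` for
  -- vertices of degree 0.
  enum-cyclic : ∀ xs → Unique xs → ∃[ vs ] Enumerates (Cyclic xs) vs × length vs ≡ (length xs ∸ 1) !
  enum-cyclic [] _ = _ , enum-identity [] (λ _ ()) , refl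
  enum-cyclic (a ∷ []) _ = _ , enum-identity (a ∷ []) (λ { x (here p) z (here q) → trans p (sym q) }) , refl
  enum-cyclic (a ∷ zs@(b ∷ bs)) (a∉ ∷ unique) =
    let (vs , enum-vs , count) = enum-cyclic zs unique in
    map (λ (y , v) → insert a y v) (pairs zs (λ _ → vs)) ,
    enum-map (λ (y , v) → insert a y v) (λ (y , v) (y∈ , c) → insert-cyclic a∉zs v y∈ c)
      (λ (y , v) (y' , v') (y∈ , c) (y'∈ , c') → insert-injective a∉zs y y' v v' y∈ y'∈ c c')
      (λ w c → insert-surjective a∉zs (here refl) w c)
      (enum-pairs (λ _ → vs) (unique , All.tabulate id , λ _ → id) (λ _ _ → enum-vs)) ,
    trans (Listₚ.length-map _ (pairs zs (λ _ → vs))) (trans (length-pairs zs vs) (cong (length zs ℕ.*_) count))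
    where
    a∉zs : a ∉ zs
    a∉zs p = All.lookup a∉ p refl

module _ {m} {N : Fin m → Set} (N? : Decidable N) where

  members : List (Fin m)
  members = filter N? (allFin m)

  rotations : List (Vec (Fin m) m)
  rotations = proj₁ (enum-cyclic members (Uniqueₚ.filter⁺ N? (Uniqueₚ.allFin⁺ m)))

  enum-rotations : Enumerates (IsCyclicOn N ∘ lookup) rotations
  enum-rotations = enum-⇔ (λ v → cyclic-⇔ (λ x p → proj₂ (∈-filter⁻ N? {xs = allFin m} p)) (λ x n → ∈-filter⁺ N? (∈-allFin x) n))
    (λ v → cyclic-⇔ (λ x n → ∈-filter⁺ N? (∈-allFin x) n) (λ x p → proj₂ (∈-filter⁻ N? {xs = allFin m} p)))
    (proj₁ (proj₂ (enum-cyclic members (Uniqueₚ.filter⁺ N? (Uniqueₚ.allFin⁺ m)))))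

  length-rotations : ∀ d → + d ≡ ∑ (allFin m) (λ x → indicator (N? x)) → length rotations ≡ (d ∸ 1) !
  length-rotations d e = trans (proj₂ (proj₂ (enum-cyclic members (Uniqueₚ.filter⁺ N? (Uniqueₚ.allFin⁺ m)))))
    (cong (λ z → (z ∸ 1) !) (ℤₚ.+-injective (trans (length≡∑ members)
      (trans (∑-filter-const N? (allFin m) (+ 1)) (trans (ℤₚ.*-identityʳ _) (sym e))))))

-- Rotation systems and w-trees

module _ {s t : ℕ} where

  whiteRotations : Mat s t → List (Vec (Vec (Fin t) t) s)
  whiteRotations W = vecs (λ i → rotations (λ j → Adj? W (inj₁ i) (inj₂ j)))

  blackRotations : Mat s t → List (Vec (Vec (Fin s) s) t)
  blackRotations W = vecs (λ j → rotations (λ i → Adj? W (inj₂ j) (inj₁ i)))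

  rotationSystems : Mat s t → List (Vec (Vec (Fin t) t) s × Vec (Vec (Fin s) s) t)
  rotationSystems W = pairs (whiteRotations W) (λ _ → blackRotations W)

  length-rotationSystems : ∀ W → length (rotationSystems W) ≡ ω W
  length-rotationSystems W = trans (length-pairs (whiteRotations W) (blackRotations W)) (cong₂ ℕ._*_
    (trans (length-vecs (λ i → rotations (λ j → Adj? W (inj₁ i) (inj₂ j)))) (Πᶠ-cong (λ i → length-rotations (λ j → Adj? W (inj₁ i) (inj₂ j)) (deg W (inj₁ i)) (deg-white W i))))
    (trans (length-vecs (λ j → rotations (λ i → Adj? W (inj₂ j) (inj₁ i)))) (Πᶠ-cong (λ j → length-rotations (λ i → Adj? W (inj₂ j) (inj₁ i)) (deg W (inj₂ j)) (deg-black W j)))))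

  mem-full : ∀ (v : Vertex s t) → mem full v ≡ true
  mem-full v = trans (sym (mem-index full v)) (Vecₚ.lookup-replicate (index v) true)

module _ {s t} (k : Fin s → ℕ) (l : Fin t → ℕ) (k≥1 : ∀ i → 1 ≤ k i) (l≥1 : ∀ j → 1 ≤ l j) where

  open Weighted k l k≥1 l≥1
  open Trees k l k≥1 l≥1

  wS-full : ∀ v → wS full v ≡ wt v
  wS-full v = wS-in {full} v (mem-full v)

  weight-full : Σᶠ k ≡ Σᶠ l → weight full ≡ + 0
  weight-full balanced = trans (weight-Σᶠ full) (trans
    (cong₂ (λ a b → + a ℤ.- + b) (trans (Σᶠ-cong (λ i → wS-full (inj₁ i))) balanced) (Σᶠ-cong (λ j → wS-full (inj₂ j))))
    (ℤₚ.+-inverseʳ (+ Σᶠ l)))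

  -- Rotation systems are independent of the weights once the tree is fixed. Acyclicity and the
  -- bridge property are exchanged in both directions.
  enum-wtrees : ∀ {ts : List (Mat s t)} → Enumerates (IsTreeOf full) ts → Enumerates (IsWTree k l) (pairs ts rotationSystems)
  enum-wtrees enum-ts = enum-⇔ sound complete
      (enum-pairs rotationSystems enum-ts (λ W _ → enum-pairs _
        (enum-vecs _ (λ i → enum-rotations (λ j → Adj? W (inj₁ i) (inj₂ j))))
        (λ _ _ → enum-vecs _ (λ j → enum-rotations (λ i → Adj? W (inj₂ j) (inj₁ i))))))
    where
    sound : ∀ z → _ → IsWTree k l z
    sound (W , ρw , ρb) ((T , h) , cw , cb) =
      (λ i → trans (h (inj₁ i)) (wS-full (inj₁ i))) , (λ j → trans (h (inj₂ j)) (wS-full (inj₂ j))) ,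
      ((λ u v → conn T u v (mem-full u) (mem-full v)) , bridges⇒acyclic W (bridges T)) , cw , cb
    complete : ∀ z → IsWTree k l z → _
    complete (W , ρw , ρb) (rows , columns , (connected , acyclic) , cw , cb) =
      (treeOn (λ u _ _ → mem-full u) (λ u v _ _ → connected u v) (acyclic⇒bridges W acyclic) ,
        λ { (inj₁ i) → trans (rows i) (sym (wS-full (inj₁ i))) ; (inj₂ j) → trans (columns j) (sym (wS-full (inj₂ j))) }) , cw , cb

  length-wtrees : ∀ (ts : List (Mat s t)) → + length (pairs ts rotationSystems) ≡ ∑ ts (λ W → + ω W)
  length-wtrees ts = trans (length≡∑ (pairs ts rotationSystems)) (trans (∑-pairs ts rotationSystems (λ _ → + 1))
    (∑-cong ts (λ W → trans (sym (length≡∑ (rotationSystems W))) (cong +_ (length-rotationSystems W)))))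

theorem3 : (s t : ℕ) (k : Fin s → ℕ) (l : Fin t → ℕ) →
    1 ≤ s → 1 ≤ t →
    (∀ i → 1 ≤ k i) → (∀ j → 1 ≤ l j) →
    Σᶠ k ≡ Σᶠ l →
    Injective _≡_ _≡_ k → Injective _≡_ _≡_ l →
    ∃[ trees ] ∃[ parts ]
    (Enumerates (IsWTree k l) trees ×
    Enumerates (IsPartition k l) parts ×
    + length trees ≡ sumℤ (map (summand (s + t)) parts))
theorem3 (suc s) (suc t) k l _ _ k≥1 l≥1 balanced _ _ =
  pairs ts rotationSystems , allParts , enum-wtrees k l k≥1 l≥1 (proj₂ trees) , enum-allParts ,
  -- Both sides are compared after multiplication by N², where N + 1 is the number of vertices: one
  -- factor N counts the edges of a tree, the other comes from Lagrange inversion.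
  trans (length-wtrees k l k≥1 l≥1 ts) (cancel (begin
    + N ℤ.* (+ N ℤ.* F)
      ≡⟨ cong (λ z → + N ℤ.* z) counted ⟩
    + N ℤ.* top (π (+ 0) ws (f⁺ ⊛ f⁻))
      ≡⟨ negate (+ N) (top (π (+ 0) ws (f⁺ ⊛ f⁻))) ⟩
    ℤ.- ((ℤ.- + N) ℤ.* top (π (+ 0) ws (f⁺ ⊛ f⁻)))
      ≡⟨ cong ℤ.-_ (top-exp-B ws f⁺ f⁻ f⁺>0 f⁻<0 factorisation) ⟨
    ℤ.- top (exp (ι (ℤ.- + N) ⊛ 𝓑))
      ≡⟨ ∑-allParts refl N≥1 ⟨
    + N ℤ.* + N ℤ.* sumℤ (map (summand (suc s + suc t)) allParts)
      ≡⟨ ℤₚ.*-assoc (+ N) (+ N) _ ⟩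
    + N ℤ.* (+ N ℤ.* sumℤ (map (summand (suc s + suc t)) allParts)) ∎))
  where
  open ≡-Reasoning
  open Sums k l k≥1 l≥1 using (ws; f⁺; f⁻; q; coef-f⁺⊛f⁻)
  open Trees k l k≥1 l≥1
  open Partitions k l k≥1 l≥1 using (𝓑; allParts; enum-allParts; ∑-allParts)
  N = s + suc t
  N≥1 : 1 ≤ N
  N≥1 = ℕₚ.≤-trans (s≤s z≤n) (ℕₚ.m≤n+m (suc t) s)
  w≡0 = weight-full k l k≥1 l≥1 balanced
  trees = enum-trees full w≡0 (inj₁ zero) (mem-full {suc s} {suc t} (inj₁ zero))
  ts = proj₁ trees
  F = ∑ ts (λ W → + ω W)
  counted : + N ℤ.* F ≡ top (π (+ 0) ws (f⁺ ⊛ f⁻))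
  counted = begin
    + N ℤ.* F                                       ≡⟨ cong (λ z → + (z ∸ 1) ℤ.* F) (size-full (suc s + suc t)) ⟨
    + (size (full {suc s + suc t}) ∸ 1) ℤ.* F       ≡⟨ ∑-trees full w≡0 (inj₁ zero) (mem-full {suc s} {suc t} (inj₁ zero)) (proj₂ trees) ⟩
    q full                                          ≡⟨ coef-f⁺⊛f⁻ full ⟨
    coef (f⁺ ⊛ f⁻) full                             ≡⟨ pick-yes (weight full ℤ.≟ + 0) w≡0 ⟨
    pick (weight full ℤ.≟ + 0) (coef (f⁺ ⊛ f⁻) full) (+ 0) ≡⟨ coef-π (+ 0) ws (f⁺ ⊛ f⁻) full ⟨
    coef (π (+ 0) ws (f⁺ ⊛ f⁻)) full                ≡⟨ top-coef (π (+ 0) ws (f⁺ ⊛ f⁻)) ⟨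
    top (π (+ 0) ws (f⁺ ⊛ f⁻))                      ∎
  negate : ∀ x y → x ℤ.* y ≡ ℤ.- ((ℤ.- x) ℤ.* y)
  negate = ℤ-solve-∀
  cancel : ∀ {x y} → + N ℤ.* (+ N ℤ.* x) ≡ + N ℤ.* (+ N ℤ.* y) → x ≡ y
  cancel {x} {y} e = ℤₚ.*-cancelˡ-≡ (+ N) x y (ℤₚ.*-cancelˡ-≡ (+ N) _ _ e)
    where instance _ = ℕ.>-nonZero N≥1
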